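{- Let $k$ be a positive integer, let $G$ be a $2$-connected graph, let $x,y$ be two distinct vertices of $G$, and let $z$ be a vertex of $G$ (possibly $z\in\{x,y\}$) such that $V(G)\setminus\{x,y,z\}\neq\emptyset$. If $\deg_G(v)\ge k+1$ for each $v\in V(G)\setminus\{x,y,z\}$, then $G$ contains $k$ admissible paths from $x$ to $y$.
   Context: All graphs are finite, undirected, without loops or multiple edges. For a path $P$, $|E(P)|$ denotes its length (number of edges). A sequence of $k$ paths $P_1,\dots,P_k$ is called admissible if $|E(P_1)|\ge 2$ and either $|E(P_{i+1})|-|E(P_i)|=1$ for all $1\le i\le k-1$, or $|E(P_{i+1})|-|E(P_i)|=2$ for all $1\le i\le k-1$. "$G$ contains $k$ admissible paths from $x$ to $y$" means there exist $k$ paths in $G$, each with end-vertices $x$ and $y$, forming an admissible sequence. -}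

module Defs where

open import Data.Nat using (ℕ; zero; suc; _+_; _∸_; _≤_; _<_)
open import Data.Bool using (Bool; true; false; T; if_then_else_)
open import Data.Fin using (Fin)
open import Data.List using (List; length; head; last; map; allFin)
open import Data.Nat.ListAction using (sum)
open import Data.List.Relation.Unary.All using (All)
open import Data.List.Relation.Unary.Linked using (Linked)
open import Data.List.Relation.Unary.Unique.Propositional using (Unique)
open import Data.Maybe using (just)
open import Data.Product using (Σ; _×_; ∃; ∃-syntax)
open import Data.Sum using (_⊎_)
open import Relation.Binary.PropositionalEquality using (_≡_; _≢_)

record Graph (n : ℕ) : Set where
  field
    adj    : Fin n → Fin n → Bool
    sym    : ∀ u v → adj u v ≡ adj v u
    irrefl : ∀ v → adj v v ≡ false
open Graph public

Adj : ∀ {n} → Graph n → Fin n → Fin n → Set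
Adj G u v = T (adj G u v)

deg : ∀ {n} → Graph n → Fin n → ℕ
deg {n} G v = sum (map (λ u → if adj G v u then 1 else 0) (allFin n))

IsPath : ∀ {n} → Graph n → List (Fin n) → Set
IsPath G P = Unique P × Linked (Adj G) P

PathFromTo : ∀ {n} → Graph n → Fin n → Fin n → List (Fin n) → Set
PathFromTo G x y P = IsPath G P × head P ≡ just x × last P ≡ just y

edgeLen : ∀ {n} → List (Fin n) → ℕ
edgeLen P = length P ∸ 1

Avoids : ∀ {n} → Fin n → List (Fin n) → Set
Avoids w P = All (λ u → u ≢ w) P

Connected : ∀ {n} → Graph n → Set
Connected {n} G = ∀ (a b : Fin n) → ∃[ P ] PathFromTo G a b P

TwoConnected : ∀ {n} → Graph n → Set
TwoConnected {n} G =
  3 ≤ n × Connected G ×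
  (∀ (w a b : Fin n) → a ≢ w → b ≢ w → ∃[ P ] (PathFromTo G a b P × Avoids w P))

AdmissiblePaths : ∀ {n} → Graph n → ℕ → Fin n → Fin n → Set
AdmissiblePaths {n} G k x y =
  Σ (ℕ → List (Fin n)) λ P →
    (∀ i → i < k → PathFromTo G x y (P i)) ×
    2 ≤ edgeLen (P 0) ×
    ((∀ i → suc i < k → edgeLen (P (suc i)) ≡ edgeLen (P i) + 1) ⊎
     (∀ i → suc i < k → edgeLen (P (suc i)) ≡ edgeLen (P i) + 2))

-- Delete x and y and keep their neighbourhoods A and B in the rest W of the graph: the paths become paths from A to B
-- in W, and one argues by induction on |W|. Choose a core H in W: a maximal clique of A; or, if A is independent, a
-- maximal clique M with |M| ≥ 2 joined to two vertices of A; or else a biclique (S, T) with T ⊆ A, |S| < |T| and S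
-- maximal. Inside H there are paths of m + 1 lengths in progression from A to each attachment vertex, and by maximality
-- a vertex outside H loses at most m neighbours when H is contracted into the root x. Hence k - m admissible paths in a
-- component of W ∖ H, given by induction, extend to k of them. If that component is not 2-connected relative to its
-- roots, a part of it behind a cutvertex is used instead; a cutvertex that loses neighbours takes the role of z. If B
-- lies in H, exchange x and y; if this fails as well, counting gives A = B, and y can be replaced by a vertex b ∈ A.

module Submission where

open import Defs hiding (sym)
import Data.Bool as Bool
open import Data.Bool using (true; false; if_then_else_)
open import Data.Bool.Properties using (T?)
open import Data.Empty using (⊥; ⊥-elim)
open import Data.Fin using (Fin; zero; suc)
import Data.Fin.Properties as Fin
open import Data.List using (List; []; _∷_; head; last; map; tabulate)
open import Data.List.Properties using (map-tabulate)
open import Data.List.Relation.Unary.All as All using (All; []; _∷_)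
open import Data.List.Relation.Unary.AllPairs using ([]; _∷_)
open import Data.List.Relation.Unary.Linked using (Linked; [-]; _∷_)
open import Data.Maybe using (just)
open import Data.Nat hiding (parity)
open import Data.Nat.ListAction using (sum)
open import Data.Nat.Properties
open import Data.Nat.Tactic.RingSolver using (solve-∀)
open import Data.Product using (Σ; _×_; ∃; ∃-syntax; _,_; proj₁; proj₂)
open import Data.Sum using (_⊎_; inj₁; inj₂; [_,_]′; swap)
open import Data.Unit using (⊤; tt)
open import Function using (_∘_; id)
open import Relation.Binary.PropositionalEquality hiding ([_])
open import Relation.Nullary using (¬_; Dec; yes; no; contradiction)
open import Relation.Nullary.Decidable using (_×-dec_; _⊎-dec_; ¬?; map′; decidable-stable)

-- Counting in finite sets

-- The induction tolerates a single vertex of low degree, and this shapes the case analysis.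
-- Contracting a core keeps degrees high enough, so `z` retains the privilege; cutting a component
-- at `e` costs `e` neighbours, which is allowed once `z` lies in the part cut off. A part cut off
-- without `z` is used itself, its cutvertex serving as second root. If the part cut off is `z`
-- alone and only `e` remains, neither side has an ordinary vertex: this is `Pendant`.
--
-- A core has two attachment sets since it offers them different lengths: a biclique has |S| + 1
-- even lengths towards T but only |S| odd ones towards S, and these must pay wherever T is out of
-- reach. For |S| = 1 they pay for nothing, not even for the edge to x of a vertex of A without
-- neighbours in the core; hence `Single`.
--
-- When A = B and y is replaced by b, every other vertex of A loses its edge to y without
-- compensation. This is repaired only by absorbing these vertices, so the next core has to contain
-- all of A - b.

∑ : ∀ {n} → (Fin n → ℕ) → ℕ
∑ {zero}  f = 0
∑ {suc n} f = f zero + ∑ (f ∘ suc)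

∑-mono : ∀ {n} {f g : Fin n → ℕ} → (∀ i → f i ≤ g i) → ∑ f ≤ ∑ g
∑-mono {zero}  h = z≤n
∑-mono {suc n} h = +-mono-≤ (h zero) (∑-mono (h ∘ suc))

+-interchange : ∀ a b c d → (a + b) + (c + d) ≡ (a + c) + (b + d)
+-interchange a b c d = begin
  (a + b) + (c + d) ≡⟨ +-assoc a b (c + d) ⟩
  a + (b + (c + d)) ≡⟨ cong (a +_) (sym (+-assoc b c d)) ⟩
  a + ((b + c) + d) ≡⟨ cong (λ e → a + (e + d)) (+-comm b c) ⟩
  a + ((c + b) + d) ≡⟨ cong (a +_) (+-assoc c b d) ⟩
  a + (c + (b + d)) ≡⟨ sym (+-assoc a c (b + d)) ⟩
  (a + c) + (b + d) ∎
  where open ≡-Reasoning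

∑-+ : ∀ {n} (f g : Fin n → ℕ) → ∑ (λ i → f i + g i) ≡ ∑ f + ∑ g
∑-+ {zero}  f g = refl
∑-+ {suc n} f g = trans (cong (f zero + g zero +_) (∑-+ (f ∘ suc) (g ∘ suc)))
                        (+-interchange (f zero) (g zero) _ _)

∑-0 : ∀ n → ∑ {n} (λ _ → 0) ≡ 0
∑-0 zero    = refl
∑-0 (suc n) = ∑-0 n

sum-tabulate : ∀ {n} (f : Fin n → ℕ) → sum (tabulate f) ≡ ∑ f
sum-tabulate {zero}  f = refl
sum-tabulate {suc n} f = cong (f zero +_) (sum-tabulate (f ∘ suc))

χ : ∀ {P : Set} → Dec P → ℕ
χ (yes _) = 1
χ (no _)  = 0

χ-yes : ∀ {P : Set} (d : Dec P) → P → χ d ≡ 1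
χ-yes (yes _) p = refl
χ-yes (no ¬p) p = contradiction p ¬p

χ-no : ∀ {P : Set} (d : Dec P) → ¬ P → χ d ≡ 0
χ-no (yes p) ¬p = contradiction p ¬p
χ-no (no _)  ¬p = refl

χ≤1 : ∀ {P : Set} (d : Dec P) → χ d ≤ 1
χ≤1 (yes _) = s≤s z≤n
χ≤1 (no _)  = z≤n

χ-mono : ∀ {P Q : Set} (d : Dec P) (e : Dec Q) → (P → Q) → χ d ≤ χ e
χ-mono (no _)  e h = z≤n
χ-mono (yes p) e h = ≤-reflexive (sym (χ-yes e (h p)))

χ-⊎ : ∀ {P Q R : Set} (d : Dec P) (e : Dec Q) (f : Dec R) → (P → Q ⊎ R) → χ d ≤ χ e + χ f
χ-⊎ (no _)  e f h = z≤n
χ-⊎ (yes p) e f h with h p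
... | inj₁ q = ≤-trans (≤-reflexive (sym (χ-yes e q))) (m≤m+n _ _)
... | inj₂ r = ≤-trans (≤-reflexive (sym (χ-yes f r))) (m≤n+m _ _)

χ-disjoint : ∀ {P Q R : Set} (d : Dec P) (e : Dec Q) (f : Dec R) →
  (Q → P) → (R → P) → (Q → R → ⊥) → χ e + χ f ≤ χ d
χ-disjoint d (yes q) (yes r) _ _ h = ⊥-elim (h q r)
χ-disjoint d (yes q) (no _) i _ _  = ≤-reflexive (sym (χ-yes d (i q)))
χ-disjoint d (no _) f _ j _        = χ-mono f d j

-- Membership is an arbitrary type together with a decision, so that components, neighbourhoods and
-- other sets defined by a property keep their witnesses and can still be counted.
record DSet (n : ℕ) : Set₁ where
  field
    ∋   : Fin n → Set
    mem : ∀ v → Dec (∋ v)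
open DSet public

infix 4 _∈_
_∈_ : ∀ {n} → Fin n → DSet n → Set
v ∈ X = ∋ X v

infix 4 _⊆_
_⊆_ : ∀ {n} → DSet n → DSet n → Set
X ⊆ Y = ∀ v → v ∈ X → v ∈ Y

infixl 6 _∪_ _∖_ _-_
infixl 7 _∩_

_∪_ _∩_ _∖_ : ∀ {n} → DSet n → DSet n → DSet n
X ∪ Y = record { ∋ = λ v → v ∈ X ⊎ v ∈ Y ; mem = λ v → mem X v ⊎-dec mem Y v }
X ∩ Y = record { ∋ = λ v → v ∈ X × v ∈ Y ; mem = λ v → mem X v ×-dec mem Y v }
X ∖ Y = record { ∋ = λ v → v ∈ X × ¬ v ∈ Y ; mem = λ v → mem X v ×-dec ¬? (mem Y v) }

∅ : ∀ {n} → DSet n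
∅ = record { ∋ = λ _ → ⊥ ; mem = λ _ → no id }

⁅_⁆ : ∀ {n} → Fin n → DSet n
⁅ u ⁆ = record { ∋ = _≡ u ; mem = Fin._≟ u }

_-_ : ∀ {n} → DSet n → Fin n → DSet n
X - u = X ∖ ⁅ u ⁆

module _ {n : ℕ} where

  ind : DSet n → Fin n → ℕ
  ind X v = χ (mem X v)

  count : DSet n → ℕ
  count X = ∑ (ind X)

  count-⊆ : ∀ X Y → X ⊆ Y → count X ≤ count Y
  count-⊆ X Y h = ∑-mono (λ v → χ-mono (mem X v) (mem Y v) (h v))

  count-∪ : ∀ X Y Z → (∀ v → v ∈ X → v ∈ Y ⊎ v ∈ Z) → count X ≤ count Y + count Z
  count-∪ X Y Z h = ≤-trans (∑-mono (λ v → χ-⊎ (mem X v) (mem Y v) (mem Z v) (h v)))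
                            (≤-reflexive (∑-+ (ind Y) (ind Z)))

  count-⊎ : ∀ X Y Z → Y ⊆ X → Z ⊆ X → (∀ v → v ∈ Y → v ∈ Z → ⊥) → count Y + count Z ≤ count X
  count-⊎ X Y Z i j h = ≤-trans (≤-reflexive (sym (∑-+ (ind Y) (ind Z))))
    (∑-mono (λ v → χ-disjoint (mem X v) (mem Y v) (mem Z v) (i v) (j v) (h v)))

  count-empty : ∀ (X : DSet n) → (∀ v → ¬ v ∈ X) → count X ≡ 0
  count-empty X h = n≤0⇒n≡0 (≤-trans (count-⊆ X ∅ (λ v m → h v m)) (≤-reflexive (∑-0 n)))

  any∈ : ∀ (X : DSet n) → Dec (∃ λ v → v ∈ X)
  any∈ X = Fin.any? (mem X)

  count-pos : ∀ (X : DSet n) → 1 ≤ count X → ∃ λ v → v ∈ X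
  count-pos X p with any∈ X
  ... | yes q = q
  ... | no ¬q = contradiction (subst (1 ≤_) (count-empty X (λ v m → ¬q (v , m))) p) λ ()

count-sing : ∀ {n} (v : Fin n) → count ⁅ v ⁆ ≡ 1
count-sing {suc n} zero    = cong suc (∑-0 n)
count-sing {suc n} (suc v) = trans (≤-antisym
    (∑-mono (λ i → χ-mono (suc i Fin.≟ suc v) (i Fin.≟ v) Fin.suc-injective))
    (∑-mono (λ i → χ-mono (i Fin.≟ v) (suc i Fin.≟ suc v) (cong suc))))
  (count-sing v)

module _ {n : ℕ} where

  count-del : ∀ (X : DSet n) v → count X ≤ suc (count (X - v))
  count-del X v = ≤-trans (count-∪ X ⁅ v ⁆ (X - v) split) (≤-reflexive (cong (_+ count (X - v)) (count-sing v)))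
    where
    split : ∀ u → u ∈ X → u ≡ v ⊎ u ∈ (X - v)
    split u m with u Fin.≟ v
    ... | yes e = inj₁ e
    ... | no e  = inj₂ (m , e)

  count-⊂ : ∀ (X Y : DSet n) v → X ⊆ Y → v ∈ Y → ¬ v ∈ X → count X < count Y
  count-⊂ X Y v i m o = ≤-trans (≤-reflexive (cong (_+ count X) (sym (count-sing v))))
    (count-⊎ Y ⁅ v ⁆ X (λ { u refl → m }) i (λ { u refl q → o q }))

  count-del-< : ∀ (X : DSet n) v → v ∈ X → count (X - v) < count X
  count-del-< X v m = count-⊂ (X - v) X v (λ _ → proj₁) m (λ q → proj₂ q refl)

  count-two : ∀ (X : DSet n) → 2 ≤ count X → ∃ λ u → ∃ λ v → u ∈ X × v ∈ X × u ≢ v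
  count-two X p with count-pos X (≤-trans (s≤s z≤n) p)
  ... | u , m with count-pos (X - u) (≤-pred (≤-trans p (count-del X u)))
  ... | v , q , v≢u = u , v , m , q , (λ e → v≢u (sym e))

  one≤count : ∀ (X : DSet n) v → v ∈ X → 1 ≤ count X
  one≤count X v m = ≤-trans (s≤s z≤n) (count-del-< X v m)

  two≤count : ∀ (X : DSet n) u v → u ∈ X → v ∈ X → u ≢ v → 2 ≤ count X
  two≤count X u v m q u≢v = ≤-trans (s≤s (one≤count (X - v) u (m , u≢v))) (count-del-< X v q)

  count≤1 : ∀ (X : DSet n) → (∀ u v → u ∈ X → v ∈ X → u ≡ v) → count X ≤ 1
  count≤1 X h with 2 ≤? count X
  ... | no ¬p = ≤-pred (≰⇒> ¬p)
  ... | yes p with count-two X p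
  ... | u , v , m , q , u≢v = contradiction (h u v m q) u≢v

-- Sums of arithmetic progressions with difference 1 or 2

Step : ℕ → Set
Step d = d ≡ 1 ⊎ d ≡ 2

-- The progression with difference 2 absorbs 2 at a time until the rest is at most `suc m`. A rest
-- of 0 or 1 always is, so two consecutive terms of the other progression settle the parity.
sum-1-2 : ∀ m r q → q ≤ suc m + r → ∃ λ i → ∃ λ j → i ≤ suc m × j ≤ r × i * 1 + j * 2 ≡ q * 1
sum-1-2 m r q h with q ≤? suc m
... | yes p = q , 0 , p , z≤n , +-identityʳ _
sum-1-2 m zero q h | no ¬p = contradiction (subst (q ≤_) (+-identityʳ _) h) ¬p
sum-1-2 m (suc r) zero h | no ¬p = contradiction z≤n ¬p
sum-1-2 m (suc r) (suc zero) h | no ¬p = contradiction (s≤s z≤n) ¬p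
sum-1-2 m (suc r) (suc (suc q)) h | no ¬p
  with sum-1-2 m r q (≤-trans (n≤1+n q) (≤-pred (≤-trans h (≤-reflexive (+-suc (suc m) r)))))
... | i , j , a , b , e = i , suc j , a , s≤s b ,
  trans (+-suc (i * 1) (suc (j * 2))) (cong suc (trans (+-suc (i * 1) (j * 2)) (cong suc e)))

sum-same : ∀ m r q d → q ≤ m + r → ∃ λ i → ∃ λ j → i ≤ m × j ≤ r × i * d + j * d ≡ q * d
sum-same m r q d h = m ⊓ q , q ∸ m , m⊓n≤m m q ,
  ≤-trans (∸-monoˡ-≤ m h) (≤-reflexive (m+n∸m≡n m r)) ,
  trans (sym (*-distribʳ-+ d (m ⊓ q) (q ∸ m))) (cong (_* d) (m⊓n+n∸m≡n m q))

-- Two progressions with m + 1 and r + 1 terms have sums covering a progression with m + r + 1 terms.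
sum-progressions : ∀ {d e} → Step d → Step e → ∀ m r →
  ∃ λ f → Step f × ∀ q → q ≤ m + r → ∃ λ i → ∃ λ j → i ≤ m × j ≤ r × i * d + j * e ≡ q * f
sum-progressions (inj₁ refl) (inj₁ refl) m r = 1 , inj₁ refl , λ q → sum-same m r q 1
sum-progressions (inj₂ refl) (inj₂ refl) m r = 2 , inj₂ refl , λ q → sum-same m r q 2
sum-progressions (inj₁ refl) (inj₂ refl) zero r = 2 , inj₂ refl , λ q h → 0 , q , z≤n , h , refl
sum-progressions (inj₁ refl) (inj₂ refl) (suc m) r = 1 , inj₁ refl , sum-1-2 m r
sum-progressions (inj₂ refl) (inj₁ refl) m zero =
  2 , inj₂ refl , λ q h → q , 0 , subst (q ≤_) (+-identityʳ m) h , z≤n , +-identityʳ _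
sum-progressions (inj₂ refl) (inj₁ refl) m (suc r) = 1 , inj₁ refl , λ q h → flip q (sum-1-2 r m q (subst (q ≤_) (+-comm m (suc r)) h))
  where
  flip : ∀ q → (∃ λ i → ∃ λ j → i ≤ suc r × j ≤ m × i * 1 + j * 2 ≡ q * 1) →
         ∃ λ i → ∃ λ j → i ≤ m × j ≤ suc r × i * 2 + j * 1 ≡ q * 1
  flip q (i , j , a , b , e) = j , i , b , a , trans (+-comm (j * 2) (i * 1)) e

module AdmissiblePathsIn {n : ℕ} (G : Graph n) where

  V : Set
  V = Fin n

  infix 4 _~_ _~?_
  _~_ : V → V → Set
  u ~ v = Adj G u v

  _~?_ : ∀ u v → Dec (u ~ v)
  u ~? v = T? (adj G u v)

  ~-sym : ∀ {u v} → u ~ v → v ~ u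
  ~-sym {u} {v} = subst Bool.T (Graph.sym G u v)

  ~-irrefl : ∀ {v} → v ~ v → ⊥
  ~-irrefl {v} = subst Bool.T (Graph.irrefl G v)

  ~⇒≢ : ∀ {u v} → u ~ v → u ≢ v
  ~⇒≢ p refl = ~-irrefl p

  N : V → DSet n
  N v = record { ∋ = v ~_ ; mem = v ~?_ }

  Nb : DSet n → DSet n
  Nb X = record { ∋ = λ v → ∃ λ t → t ∈ X × t ~ v ; mem = λ v → Fin.any? (λ t → mem X t ×-dec (t ~? v)) }

  deg≡count : ∀ v → deg G v ≡ count (N v)
  deg≡count v = trans (cong sum (map-tabulate id (λ u → if adj G v u then 1 else 0)))
    (trans (sum-tabulate (λ u → if adj G v u then 1 else 0))
           (≤-antisym (∑-mono (λ u → le u)) (∑-mono (λ u → ge u))))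
    where
    le : ∀ u → (if adj G v u then 1 else 0) ≤ χ (v ~? u)
    le u with adj G v u
    ... | true  = ≤-refl
    ... | false = z≤n
    ge : ∀ u → χ (v ~? u) ≤ (if adj G v u then 1 else 0)
    ge u with adj G v u
    ... | true  = ≤-refl
    ... | false = z≤n

  -- Walks and paths

  data Reach (W : DSet n) : V → V → Set where
    here : ∀ {u} → u ∈ W → Reach W u u
    step : ∀ {u v w} → u ∈ W → u ~ v → Reach W v w → Reach W u w

  -- Each vertex is deleted from the ambient set once it is visited, so the type itself excludes
  -- repetitions. `Reach` permits them and therefore composes freely.
  data Path (W : DSet n) : V → V → ℕ → Set where
    end  : ∀ {u} → u ∈ W → Path W u u 0
    cons : ∀ {u v w l} → u ∈ W → u ~ v → Path (W - u) v w l → Path W u w (suc l)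

  src : ∀ {W u v} → Reach W u v → u ∈ W
  src (here m)     = m
  src (step m _ _) = m

  tgt : ∀ {W u v} → Reach W u v → v ∈ W
  tgt (here m)     = m
  tgt (step _ _ r) = tgt r

  rmono : ∀ {W X u v} → W ⊆ X → Reach W u v → Reach X u v
  rmono i (here m)     = here (i _ m)
  rmono i (step m a r) = step (i _ m) a (rmono i r)

  rtrans : ∀ {W u v w} → Reach W u v → Reach W v w → Reach W u w
  rtrans (here _)     s = s
  rtrans (step m a r) s = step m a (rtrans r s)

  rsym : ∀ {W u v} → Reach W u v → Reach W v u
  rsym (here m)     = here m
  rsym (step m a r) = rtrans (rsym r) (step (src r) (~-sym a) (here m))

  -- The edge by which a walk first quits `E`. Most connectivity arguments below identify its outer
  -- end as a root or a cutvertex.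
  leave : ∀ {W u v} (E : DSet n) → u ∈ E → Reach W u v →
    Reach E u v ⊎ ∃ λ p → ∃ λ q → Reach E u p × p ~ q × q ∈ W × ¬ q ∈ E
  leave E e (here _) = inj₁ (here e)
  leave E e (step {v = v} m a r) with mem E v
  ... | no ¬f = inj₂ (_ , v , here e , a , src r , ¬f)
  ... | yes f with leave E f r
  ... | inj₁ s = inj₁ (step e a s)
  ... | inj₂ (p , q , s , rest) = inj₂ (p , q , step e a s , rest)

  stay : ∀ {W u v} (E : DSet n) → (∀ p q → p ∈ E → q ∈ W → p ~ q → q ∈ E) →
    u ∈ E → Reach W u v → Reach E u v
  stay E cl e r with leave E e r
  ... | inj₁ s = s
  ... | inj₂ (p , q , s , a , m , o) = contradiction (cl p q (tgt s) m a) o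

  psrc : ∀ {W u v l} → Path W u v l → u ∈ W
  psrc (end m)      = m
  psrc (cons m _ _) = m

  ptgt : ∀ {W u v l} → Path W u v l → v ∈ W
  ptgt (end m)      = m
  ptgt (cons _ _ p) = proj₁ (ptgt p)

  pmono : ∀ {W X u v l} → W ⊆ X → Path W u v l → Path X u v l
  pmono i (end m)      = end (i _ m)
  pmono i (cons m a p) = cons (i _ m) a (pmono (λ v q → i v (proj₁ q) , proj₂ q) p)

  cat : ∀ {X Y W u p q v l m} → Path X u p l → p ~ q → Path Y q v m → X ⊆ W → Y ⊆ W →
    (∀ v → v ∈ X → v ∈ Y → ⊥) → Path W u v (l + suc m)
  cat (end e) a s i j d = cons (i _ e) a (pmono (λ v q → j v q , λ { refl → d v e q }) s)
  cat (cons e b r) a s i j d = cons (i _ e) b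
    (cat r a s (λ v q → i v (proj₁ q) , proj₂ q) (λ v q → j v q , λ { refl → d v e q })
       (λ v q → d v (proj₁ q)))

  prev : ∀ {W u v l} → Path W u v l → Path W v u l
  prev (end m) = end m
  prev {W} {u} {v} (cons {l = l} m a p) = subst (Path W v u) (+-comm l 1)
    (cat (prev p) (~-sym a) (end {⁅ u ⁆} refl) (λ _ → proj₁) (λ { _ refl → m }) (λ { _ q refl → proj₂ q refl }))

  -- Loop erasure: a later visit to `u` yields a suffix that starts at `u`.
  avoid : ∀ {W a b l} u → Path W a b l → Path (W - u) a b l ⊎ ∃ λ l′ → Path W u b l′
  avoid {a = a} u p with a Fin.≟ u
  avoid u p | yes refl = inj₂ (_ , p)
  avoid u (end m) | no a≢u = inj₁ (end (m , a≢u))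
  avoid u (cons m a p) | no a≢u with avoid u p
  ... | inj₁ q = inj₁ (cons (m , a≢u) a (pmono (λ { v ((x , y) , z) → (x , z) , y }) q))
  ... | inj₂ (l , q) = inj₂ (l , pmono (λ _ → proj₁) q)

  toPath : ∀ {W u v} → Reach W u v → ∃ λ l → Path W u v l
  toPath (here m) = 0 , end m
  toPath (step {u} m a r) with toPath r
  ... | l , p with avoid u p
  ... | inj₁ q = suc l , cons m a q
  ... | inj₂ q = q

  toReach : ∀ {W u v l} → Path W u v l → Reach W u v
  toReach (end m)      = here m
  toReach (cons m a p) = step m a (rmono (λ _ → proj₁) (toReach p))

  -- A walk can be shortened to a path, so `u` may be deleted before the search moves on; this makes
  -- the fuel decrease.
  reach-fuel : ∀ m (W : DSet n) u v → count W ≤ m → Dec (Reach W u v)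
  reach-fuel m W u v h with mem W u
  ... | no ¬i = no (¬i ∘ src)
  reach-fuel zero W u v h | yes i = contradiction (≤-trans (one≤count W u i) h) λ ()
  reach-fuel (suc m) W u v h | yes i with u Fin.≟ v
  ... | yes refl = yes (here i)
  ... | no u≢v = map′ (λ { (w , a , r) → step i a (rmono (λ _ → proj₁) r) })
          (λ r → back (proj₂ (toPath r)))
          (Fin.any? (λ w → (u ~? w) ×-dec reach-fuel m (W - u) w v (≤-pred (≤-trans (count-del-< W u i) h))))
    where
    back : ∀ {l} → Path W u v l → ∃ λ w → u ~ w × Reach (W - u) w v
    back (end _)      = contradiction refl u≢v
    back (cons _ a p) = _ , a , toReach p

  reach? : ∀ W u v → Dec (Reach W u v)
  reach? W u v = reach-fuel (count W) W u v ≤-refl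

  comp : DSet n → V → DSet n
  comp W v = record { ∋ = Reach W v ; mem = reach? W v }

  comp-connected : ∀ W c u v → u ∈ comp W c → v ∈ comp W c → Reach (comp W c) u v
  comp-connected W c u v p q =
    stay (comp W c) (λ x y r m a → rtrans r (step (tgt r) a (here m))) p (rtrans (rsym p) q)

  -- Rooted graphs and admissible paths

  record Between (W A B : DSet n) (m : ℕ) : Set where
    constructor between
    field
      {s t} : V
      s∈   : s ∈ A
      t∈   : t ∈ B
      path : Path W s t m

  record Adm (k : ℕ) (W A B : DSet n) : Set where
    constructor adm
    field
      first  : ℕ
      {diff} : ℕ
      isStep : Step diff
      paths  : ∀ i → i < k → Between W A B (first + i * diff)

  adm-mono : ∀ {k k′ W W′ A A′ B B′} → k ≤ k′ → W′ ⊆ W → (∀ v → v ∈ W′ → v ∈ A′ → v ∈ A) →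
    (∀ v → v ∈ W′ → v ∈ B′ → v ∈ B) → Adm k′ W′ A′ B′ → Adm k W A B
  adm-mono k≤ w a b (adm l s f) = adm l s λ i h → let between p q r = f i (≤-trans h k≤) in
    between (a _ (psrc r) p) (b _ (ptgt r) q) (pmono w r)

  adm-rev : ∀ {k W A B} → Adm k W A B → Adm k W B A
  adm-rev (adm l s f) = adm l s λ i h → let between p q r = f i h in between q p (prev r)

  -- What an edge from the root x to `v` stands for after `H` has been contracted into x. The length
  -- includes the last edge into `v`, but not the edge from x to A.
  data Entry (A H : DSet n) (v : V) : ℕ → Set where
    direct : v ∈ A → Entry A H v 0
    via    : ∀ {u p l} → u ∈ A → Path H u p l → p ~ v → Entry A H v (suc l)

  -- The lengths are the same for all `v`: the vertices at which the inductively given paths begin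
  -- are unknown and may vary from path to path.
  record Family (A H C A′ : DSet n) (m : ℕ) : Set where
    constructor family
    field
      first  : ℕ
      {diff} : ℕ
      isStep : Step diff
      entry  : ∀ v → v ∈ C → v ∈ A′ → ∀ i → i ≤ m → Entry A H v (first + i * diff)

  record Exits (B H C B′ : DSet n) : Set where
    constructor exits
    field
      len  : ℕ
      exit : ∀ v → v ∈ C → v ∈ B′ → Entry B H v len

  enter : ∀ {A H C W v w a m} → Entry A H v a → Path C v w m → H ⊆ W → C ⊆ W →
    (∀ v → v ∈ H → v ∈ C → ⊥) → ∃ λ u → u ∈ A × Path W u w (a + m)
  enter (direct m) p i j d = _ , m , pmono j p
  enter {W = W} {w = w} {m = m} (via {u} {l = l} a q e) p i j d =
    u , a , subst (Path W u w) (+-suc l m) (cat q e p i j d)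

  join : ∀ {A B H K C W v w a b m} → Entry A H v a → Path C v w m → Entry B K w b →
    H ⊆ W → K ⊆ W → C ⊆ W →
    (∀ v → v ∈ H → v ∈ C → ⊥) → (∀ v → v ∈ K → v ∈ C → ⊥) → (∀ v → v ∈ H → v ∈ K → ⊥) →
    Between W A B (b + (a + m))
  join {H = H} {C = C} en p ex i i′ j d d′ d″
    with enter {W = H ∪ C} en p (λ _ → inj₁) (λ _ → inj₂) d
  ... | u , ua , q with enter ex (prev q) i′ (λ { v (inj₁ h) → i v h ; v (inj₂ c) → j v c })
                         (λ { v h (inj₁ h′) → d″ v h′ h ; v h (inj₂ c) → d′ v h c })
  ... | x , xb , r = between ua xb (prev r)

  -- Every entry length can be combined with every path of `C`, so the available lengths are all
  -- sums of two progressions, shifted by the fixed length of the exit.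
  extend : ∀ {W A B C A′ B′ H K m r} → Adm (suc r) C A′ B′ → Family A H C A′ m → Exits B K C B′ →
    H ⊆ W → K ⊆ W → C ⊆ W →
    (∀ v → v ∈ H → v ∈ C → ⊥) → (∀ v → v ∈ K → v ∈ C → ⊥) → (∀ v → v ∈ H → v ∈ K → ⊥) →
    Adm (suc (m + r)) W A B
  extend {W} {A} {B} {m = m} {r} (adm l s f) (family l′ s′ f′) (exits x g) i i′ j a b c
    with sum-progressions s′ s m r
  ... | e , s″ , h = adm (x + (l′ + l)) s″ λ q q< →
    let (i₁ , j₁ , i≤ , j≤ , eq) = h q (≤-pred q<)
        between ua vb p = f j₁ (s≤s j≤)
    in subst (Between W A B) (arith (i₁ * _) (j₁ * _) eq)
         (join (f′ _ (psrc p) ua i₁ i≤) p (g _ (ptgt p) vb) i i′ j a b c)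
    where
    arith : ∀ y y′ {q} → y + y′ ≡ q → x + ((l′ + y) + (l + y′)) ≡ x + (l′ + l) + q
    arith y y′ refl = trans (cong (x +_) (+-interchange l′ y l y′)) (sym (+-assoc x (l′ + l) (y + y′)))

  -- (W, A, B) stands for W with two further vertices x and y, adjacent to A and to B respectively;
  -- the conditions say that adding the edge xy makes this graph 2-connected.
  record IsRooted (W A B : DSet n) : Set where
    field
      toA : ∀ v → v ∈ W → ∃ λ a → a ∈ A × Reach W v a
      toB : ∀ v → v ∈ W → ∃ λ b → b ∈ B × Reach W v b
      two : ∀ w v → w ∈ W → v ∈ W → v ≢ w → ∃ λ u → (u ∈ A ⊎ u ∈ B) × Reach (W - w) v u

    two′ : ∀ w v → v ∈ W → v ≢ w → ∃ λ u → (u ∈ A ⊎ u ∈ B) × Reach (W - w) v u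
    two′ w v m v≢w with mem W w
    ... | yes q = two w v q m v≢w
    ... | no ¬q with toA v m
    ... | a , a∈ , r = a , inj₁ a∈ , rmono (λ u u∈ → u∈ , λ { refl → ¬q u∈ }) r

  open IsRooted public

  rooted-swap : ∀ {W A B} → IsRooted W A B → IsRooted W B A
  rooted-swap r = record { toA = toB r ; toB = toA r
    ; two = λ w v p q e → let (u , s , t) = two r w v p q e in u , swap s , t }

  connected-rooted : ∀ {D A B} → (∀ u v → u ∈ D → v ∈ D → Reach D u v) →
    (∃ λ a → a ∈ D × a ∈ A) → (∃ λ b → b ∈ D × b ∈ B) →
    (∀ w v → w ∈ D → v ∈ D → v ≢ w → ∃ λ u → (u ∈ A ⊎ u ∈ B) × Reach (D - w) v u) → IsRooted D A B
  connected-rooted c (a , ad , aa) (b , bd , bb) t = record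
    { toA = λ v m → a , aa , c v a m ad ; toB = λ v m → b , bb , c v b m bd ; two = t }

  -- The degree of `v` once x and y are restored as neighbours of A and B.
  DegreeAt : ℕ → DSet n → DSet n → DSet n → V → Set
  DegreeAt k W A B v = suc k ≤ count (N v ∩ W) + (ind A v + ind B v)

  record Prob (k : ℕ) (W A B : DSet n) (z : V) : Set where
    field
      rooted : IsRooted W A B
      large  : ∀ v → v ∈ W → v ≢ z → DegreeAt k W A B v
      vertex : ∃ λ v → v ∈ W × v ≢ z

  open Prob public

  IH : ℕ → Set₁
  IH m = ∀ k W A B z → count W < m → Prob k W A B z → Adm k W A B

  adm-one : ∀ {W A B} → IsRooted W A B → (∃ λ v → v ∈ W) → Adm 1 W A B
  adm-one r (v , m) with toA r v m | toB r v m
  ... | a , a∈ , p | b , b∈ , q with toPath (rtrans (rsym p) q)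
  ... | l , path = adm l (inj₁ refl) λ { zero _ → between a∈ b∈ (subst (Path _ a b) (sym (+-identityʳ l)) path)
                                    ; (suc i) (s≤s ()) }

  -- The m + 1 lengths of the entries pay for the m neighbours that a vertex of C may lose.
  recurse : ∀ {k W A B} → IH (count W) → (C A′ B′ H K : DSet n) (e : V) (m : ℕ) →
    C ⊆ W → (∃ λ v → v ∈ W × ¬ v ∈ C) → IsRooted C A′ B′ → (∃ λ v → v ∈ C × v ≢ e) →
    H ⊆ (W ∖ C) → K ⊆ (W ∖ C) → (∀ v → v ∈ H → v ∈ K → ⊥) →
    Family A H C A′ m → Exits B K C B′ →
    (∀ v → v ∈ C → v ≢ e → suc k ≤ (count (N v ∩ C) + (ind A′ v + ind B′ v)) + m) →
    Adm k W A B
  recurse {k} {W} {A} {B} ih C A′ B′ H K e m C⊆W (w , w∈ , w∉) rt (v₀ , v∈ , v≢e) H⊆ K⊆ dis fam ex dg with suc m ≤? k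
  -- For k ≤ m a single path through `C` already gives m + 1 lengths. Otherwise the induction has to
  -- supply k - m = r + 1 paths.
  ... | no ¬p = adm-mono {W = W} {W} (≤-trans (≤-pred (≰⇒> ¬p)) (≤-trans (m≤m+n m 0) (n≤1+n (m + 0))))
                  (λ _ x → x) (λ _ _ x → x) (λ _ _ x → x)
                  (extend (adm-one rt (v₀ , v∈)) fam ex (λ v h → proj₁ (H⊆ v h)) (λ v h → proj₁ (K⊆ v h)) C⊆W
                    (λ v h → proj₂ (H⊆ v h)) (λ v h → proj₂ (K⊆ v h)) dis)
  ... | yes p = subst (λ j → Adm j W A B) k≡
                  (extend (ih (suc r) C A′ B′ e (count-⊂ C W w C⊆W w∈ w∉)
                            (record { rooted = rt ; large = large′ ; vertex = v₀ , v∈ , v≢e }))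
                    fam ex (λ v h → proj₁ (H⊆ v h)) (λ v h → proj₁ (K⊆ v h)) C⊆W
                    (λ v h → proj₂ (H⊆ v h)) (λ v h → proj₂ (K⊆ v h)) dis)
    where
    r = k ∸ suc m
    k≡ : suc (m + r) ≡ k
    k≡ = m+[n∸m]≡n p
    large′ : ∀ v → v ∈ C → v ≢ e → DegreeAt (suc r) C A′ B′ v
    large′ v i ne = +-cancelʳ-≤ m _ _ (≤-trans
      (≤-reflexive (trans (cong (λ j → suc (suc j)) (+-comm r m)) (cong suc k≡))) (dg v i ne))

  -- The witness of a failure of the last condition of IsRooted.
  record Cut (D A B : DSet n) (w : V) (Q : DSet n) : Set where
    field
      w∈     : w ∈ D
      Q⊆     : Q ⊆ (D - w)
      some   : ∃ λ q → q ∈ Q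
      closed : ∀ u v → u ∈ Q → v ∈ D → u ~ v → v ∈ Q ⊎ v ≡ w
      noA    : ∀ v → v ∈ Q → ¬ v ∈ A
      noB    : ∀ v → v ∈ Q → ¬ v ∈ B

  open Cut public

  two? : ∀ D A B → (∀ w v → w ∈ D → v ∈ D → v ≢ w → ∃ λ u → (u ∈ A ⊎ u ∈ B) × Reach (D - w) v u)
    ⊎ ∃ λ w → Σ (DSet n) λ Q → Cut D A B w Q
  two? D A B with Fin.any? (λ w → Fin.any? (λ v → mem D w ×-dec (mem D v ×-dec (¬? (v Fin.≟ w) ×-dec ¬? (good? w v)))))
    where
    good? : ∀ w v → Dec (∃ λ u → (u ∈ A ⊎ u ∈ B) × Reach (D - w) v u)
    good? w v = Fin.any? (λ u → (mem A u ⊎-dec mem B u) ×-dec reach? (D - w) v u)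
  ... | no ¬bad = inj₁ (λ w v w∈ v∈ v≢w → decidable-stable
          (Fin.any? (λ u → (mem A u ⊎-dec mem B u) ×-dec reach? (D - w) v u))
          (λ ¬good → ¬bad (w , v , w∈ , v∈ , v≢w , ¬good)))
  ... | yes (w , v , w∈ , v∈ , v≢w , ¬good) = inj₂ (w , comp (D - w) v , record
    { w∈ = w∈ ; Q⊆ = λ u r → tgt r ; some = v , here (v∈ , v≢w)
    ; closed = cl
    ; noA = λ u r a → ¬good (u , inj₁ a , r) ; noB = λ u r b → ¬good (u , inj₂ b , r) })
    where
    cl : ∀ u x → Reach (D - w) v u → x ∈ D → u ~ x → Reach (D - w) v x ⊎ x ≡ w
    cl u x r m a with x Fin.≟ w
    ... | yes e = inj₂ e
    ... | no ne = inj₁ (rtrans r (step (tgt r) a (here (m , ne))))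

  -- Parts behind a cutvertex

  Closed : DSet n → DSet n → V → Set
  Closed D Q w = ∀ u v → u ∈ Q → v ∈ D → u ~ v → v ∈ Q ⊎ v ≡ w

  count-N-sing : ∀ v w → count (N v ∩ ⁅ w ⁆) ≤ ind (N w) v
  count-N-sing v w with w ~? v
  ... | yes a = ≤-trans (count-⊆ (N v ∩ ⁅ w ⁆) ⁅ w ⁆ (λ _ → proj₂)) (≤-reflexive (count-sing w))
  ... | no ¬a = ≤-reflexive (count-empty (N v ∩ ⁅ w ⁆) (λ { u (a , refl) → ¬a (~-sym a) }))

  comp-closed : ∀ D Q w q → Q ⊆ D → Closed D Q w → Closed D (comp Q q) w
  comp-closed D Q w q Q⊆D cl u v r m a with cl u v (tgt r) m a
  ... | inj₁ i = inj₁ (rtrans r (step (tgt r) a (here i)))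
  ... | inj₂ e = inj₂ e

  -- A walk into `Q` can only enter from `w`, because `w` is the only outside vertex with neighbours
  -- in `Q`.
  approach : ∀ D Q w {b q} → Closed D Q w → ¬ b ∈ Q → q ∈ Q → Reach D b q → Reach (D ∖ Q) b w
  approach D Q w cl b∉ q∈ r with leave (D ∖ Q) (src r , b∉) r
  ... | inj₁ s = contradiction q∈ (proj₂ (tgt s))
  ... | inj₂ (p , q′ , s , a , m , ¬i) with mem Q q′
  ...   | no ¬j = contradiction (m , ¬j) ¬i
  ...   | yes j with cl q′ p j (proj₁ (tgt s)) (~-sym a)
  ...     | inj₁ k = contradiction k (proj₂ (tgt s))
  ...     | inj₂ refl = s

  touch : ∀ D Q w {v u} → Closed D Q w → v ∈ Q → ¬ u ∈ Q → Reach D v u → ∃ λ p → p ∈ N w × Reach Q v p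
  touch D Q w cl i o r with leave Q i r
  ... | inj₁ s = contradiction (tgt s) o
  ... | inj₂ (p , q , s , a , m , ¬j) with cl p q (tgt s) m a
  ...   | inj₁ j = contradiction j ¬j
  ...   | inj₂ refl = p , ~-sym a , s

  abstract
    swap-summands : ∀ {x} q h a → x ≤ (q + h) + (a + 0) → x ≤ (q + (a + h)) + 0
    swap-summands {x} q h a p = subst (x ≤_) (eq q h a) p
      where eq : ∀ q h a → (q + h) + (a + 0) ≡ (q + (a + h)) + 0
            eq = solve-∀

    -- The account of a contraction: `f` distributes the neighbours of a vertex over the part kept,
    -- the core and the second root; `g` says that replacing the edges to the core and to x by one
    -- edge to the new root costs at most `m`.
    transfer-degree : ∀ k w a b q h b′ m a′ → suc k ≤ w + (a + b) → w + b ≤ (q + h) + b′ → h + a ≤ m + a′ →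
      suc k ≤ (q + (a′ + b′)) + m
    transfer-degree k w a b q h b′ m a′ e f g = begin
      suc k             ≤⟨ e ⟩
      w + (a + b)       ≡⟨ e₁ w a b ⟩
      (w + b) + a       ≤⟨ +-monoˡ-≤ a f ⟩
      (q + h) + b′ + a  ≡⟨ e₂ q h b′ a ⟩
      (q + b′) + (h + a) ≤⟨ +-monoʳ-≤ (q + b′) g ⟩
      (q + b′) + (m + a′) ≡⟨ e₃ q b′ m a′ ⟩
      (q + (a′ + b′)) + m ∎
      where
      open ≤-Reasoning
      e₁ : ∀ w a b → w + (a + b) ≡ (w + b) + a
      e₁ = solve-∀
      e₂ : ∀ q h b′ a → (q + h) + b′ + a ≡ (q + b′) + (h + a)
      e₂ = solve-∀
      e₃ : ∀ q b′ m a′ → (q + b′) + (m + a′) ≡ (q + (a′ + b′)) + m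
      e₃ = solve-∀

  -- A part `Q` that sees B only through `w` becomes a smaller problem with roots x and `w`; one
  -- fixed path from B to `w` outside `Q` completes all of its paths, and no degree is lost.
  module Separated {k : ℕ} {W A B : DSet n} {z : V} (rt : IsRooted W A B) (ih : IH (count W)) where

    -- If `Q` contains `z`, which lies in neither A nor B, then after deletion of `w` the vertex `z`
    -- escapes only through a neighbour, and this neighbour is again in `Q`.
    non-exceptional : ∀ w Q → ¬ z ∈ A → Q ⊆ (W - w) → (∃ λ q → q ∈ Q) → Closed W Q w →
      (∀ v → v ∈ Q → ¬ v ∈ B) → ∃ λ v → v ∈ Q × v ≢ z
    non-exceptional w Q z∉A Q⊆ (q , i) cl noB with q Fin.≟ z
    ... | no q≢z = q , i , q≢z
    ... | yes refl with two′ rt w q (proj₁ (Q⊆ q i)) (proj₂ (Q⊆ q i))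
    ...   | .q , inj₁ a , here _ = contradiction a z∉A
    ...   | .q , inj₂ b , here _ = contradiction b (noB q i)
    ...   | u , _ , step {v = v} m a r with cl q v i (proj₁ (src r)) a
    ...     | inj₁ j = v , j , λ { refl → ~-irrefl a }
    ...     | inj₂ e = contradiction e (proj₂ (src r))

    separated : ∀ w Q → w ∈ W → Q ⊆ (W - w) → Closed W Q w → (∀ v → v ∈ Q → ¬ v ∈ B) →
      (∀ v → v ∈ Q → v ≢ z → DegreeAt k W A B v) → (∃ λ v → v ∈ Q × v ≢ z) → Adm k W A B
    separated w Q w∈ Q⊆ cl noB dg (v₀ , i₀ , ne₀) =
      recurse ih Q A (N w) ∅ (W ∖ Q) z 0 (λ v i → proj₁ (Q⊆ v i)) (w , w∈ , λ i → proj₂ (Q⊆ w i) refl)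
        (record { toA = toA′ ; toB = toB′ ; two = two″ }) (v₀ , i₀ , ne₀)
        (λ _ ()) (λ _ i → i) (λ _ ())
        (family 0 (inj₁ refl) (λ { v _ a zero _ → direct a ; v _ a (suc _) () }))
        (exits (suc (proj₁ road)) (λ v _ a → via (proj₁ (proj₂ out)) (proj₂ road) a))
        deg′
      where
      toA′ : ∀ v → v ∈ Q → ∃ λ a → a ∈ A × Reach Q v a
      toA′ v i with two′ rt w v (proj₁ (Q⊆ v i)) (proj₂ (Q⊆ v i))
      ... | u , s , r with stay Q (λ p q p∈ q∈ a → [ id , (λ e → contradiction e (proj₂ q∈)) ]′ (cl p q p∈ (proj₁ q∈) a)) i r
      ...   | r′ = u , [ id , (λ b → contradiction b (noB u (tgt r′))) ]′ s , r′
      toB′ : ∀ v → v ∈ Q → ∃ λ b → b ∈ N w × Reach Q v b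
      toB′ v i with toB rt v (proj₁ (Q⊆ v i))
      ... | b , b∈ , r = touch W Q w cl i (λ j → noB b j b∈) r
      two″ : ∀ x v → x ∈ Q → v ∈ Q → v ≢ x → ∃ λ u → (u ∈ A ⊎ u ∈ N w) × Reach (Q - x) v u
      two″ x v x∈ i ne with two′ rt x v (proj₁ (Q⊆ v i)) ne
      ... | u , s , r with leave (Q - x) (i , ne) r
      ...   | inj₁ r′ = u , inj₁ ([ id , (λ b → contradiction b (noB u (proj₁ (tgt r′)))) ]′ s) , r′
      ...   | inj₂ (p , q , r′ , a , m , ¬j) with cl p q (proj₁ (tgt r′)) (proj₁ m) a
      ...     | inj₁ j = contradiction (j , proj₂ m) ¬j
      ...     | inj₂ refl = p , inj₂ (~-sym a) , r′
      out : ∃ λ b → b ∈ B × Reach (W ∖ Q) b w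
      out with toB rt v₀ (proj₁ (Q⊆ v₀ i₀))
      ... | b , b∈ , r = b , b∈ , approach W Q w cl (λ j → noB b j b∈) i₀ (rsym r)
      road : ∃ λ l → Path (W ∖ Q) (proj₁ out) w l
      road = toPath (proj₂ (proj₂ out))
      deg′ : ∀ v → v ∈ Q → v ≢ z → suc k ≤ (count (N v ∩ Q) + (ind A v + ind (N w) v)) + 0
      deg′ v i ne = swap-summands (count (N v ∩ Q)) (ind (N w) v) (ind A v) (≤-trans (dg v i ne) (+-mono-≤
        (≤-trans (count-∪ (N v ∩ W) (N v ∩ Q) (N v ∩ ⁅ w ⁆) spl) (+-monoʳ-≤ (count (N v ∩ Q)) (count-N-sing v w)))
        (≤-reflexive (cong (ind A v +_) (χ-no (mem B v) (noB v i))))))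
        where
        spl : ∀ u → u ∈ (N v ∩ W) → u ∈ (N v ∩ Q) ⊎ u ∈ (N v ∩ ⁅ w ⁆)
        spl u (a , m) with cl v u i m a
        ... | inj₁ j = inj₁ (a , j)
        ... | inj₂ e = inj₂ (a , e)

  -- Cores

  record Source (A H T : DSet n) (m : ℕ) : Set where
    constructor source
    field
      first  : ℕ
      {diff} : ℕ
      isStep : Step diff
      route  : ∀ p → p ∈ T → ∀ i → i ≤ m → Between H A ⁅ p ⁆ (first + i * diff)

  source-family : ∀ {A H T m} C → Source A H T m → Family A H C (Nb T) m
  source-family C (source l s f) = family (suc l) s λ { v _ (p , p∈ , a) i i≤ → go a (f p p∈ i i≤) }
    where
    go : ∀ {A H p v l} → p ~ v → Between H A ⁅ p ⁆ l → Entry A H v (suc l)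
    go a (between u∈ refl q) = via u∈ q a

  -- `loss₁` balances the edges from `v` to the core and to x against the one edge to x left after
  -- contraction. The m₁ + 1 lengths of the routes to `T₁` pay the difference; `T₂` serves the parts
  -- that `T₁` does not reach.
  module CoreStep {k : ℕ} {W A B : DSet n} {z : V} (rt : IsRooted W A B) (ih : IH (count W)) (z∉A : ¬ z ∈ A)
    (H T₁ T₂ : DSet n) (H⊆W : H ⊆ W) (H⊆T : ∀ v → v ∈ H → v ∈ T₁ ⊎ v ∈ T₂) (T₁⊆H : T₁ ⊆ H) (T₂⊆H : T₂ ⊆ H)
    (dg : ∀ v → v ∈ W → ¬ v ∈ H → v ≢ z → DegreeAt k W A B v)
    {m₁ m₂ : ℕ} (src₁ : Source A H T₁ m₁) (src₂ : Source A H T₂ m₂)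
    (loss₁ : ∀ v → v ∈ W → ¬ v ∈ H → count (N v ∩ H) + ind A v ≤ m₁ + ind (Nb T₁) v)
    (h₀ : V) (h₀∈ : h₀ ∈ H) (b₀ : V) (b₀∈W : b₀ ∈ W) (b₀∉H : ¬ b₀ ∈ H) (b₀∈B : b₀ ∈ B) (b₀≢z : b₀ ≢ z) where

    open Separated {k} {W} {A} {B} {z} rt ih public

    D : DSet n
    D = comp (W ∖ H) b₀

    D-connected : ∀ u v → u ∈ D → v ∈ D → Reach D u v
    D-connected = comp-connected (W ∖ H) b₀

    D⊆ : D ⊆ (W ∖ H)
    D⊆ v r = tgt r

    b₀∈D : b₀ ∈ D
    b₀∈D = here (b₀∈W , b₀∉H)

    D-closed : ∀ u v → u ∈ D → v ∈ W → u ~ v → v ∈ D ⊎ v ∈ H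
    D-closed u v r m a with mem H v
    ... | yes h = inj₂ h
    ... | no ¬h = inj₁ (rtrans r (step (tgt r) a (here (m , ¬h))))

    -- Two ways from a part `Q` of `D` to y under one interface: `Q` is all of `D` and uses B, or
    -- `Q` lies behind a cutvertex of `D`, whose neighbourhood replaces B while a path through the
    -- rest of `D` leads on.
    record Outlet (Q B′ : DSet n) : Set₁ where
      field
        K    : DSet n
        K⊆   : K ⊆ (D ∖ Q)
        ex   : Exits B K Q B′
        covB : ∀ v → v ∈ Q → v ∈ B → v ∈ B′
        cl   : ∀ u v → u ∈ Q → v ∈ D → u ~ v → v ∈ Q ⊎ u ∈ B′
        nc   : ∀ v → v ∈ Q → count (N v ∩ W) + ind B v ≤ (count (N v ∩ Q) + count (N v ∩ H)) + ind B′ v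
        out  : ∃ λ v → v ∈ Q × v ∈ B′

    outlet-whole : Outlet D B
    outlet-whole = record
      { K = ∅ ; K⊆ = λ _ () ; ex = exits 0 (λ v _ b → direct b)
      ; covB = λ _ _ b → b ; cl = λ u v i j a → inj₁ j
      ; nc = λ v i → +-monoˡ-≤ (ind B v) (count-∪ (N v ∩ W) (N v ∩ D) (N v ∩ H)
               λ { u (a , m) → [ (λ j → inj₁ (a , j)) , (λ j → inj₂ (a , j)) ]′ (D-closed v u i m a) })
      ; out = b₀ , b₀∈D , b₀∈B }

    outlet-cut : ∀ w Q → w ∈ D → Q ⊆ (D - w) → Closed D Q w → (∀ v → v ∈ Q → ¬ v ∈ B) →
      (∃ λ q → q ∈ Q) → Outlet Q (N w)
    outlet-cut w Q w∈ Q⊆ clos noB (q , q∈) = record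
      { K = D ∖ Q ; K⊆ = λ _ i → i
      ; ex = exits (suc (proj₁ road)) (λ v _ a → via b₀∈B (proj₂ road) a)
      ; covB = λ v i b → contradiction b (noB v i)
      ; cl = λ u v i j a → [ inj₁ , (λ { refl → inj₂ (~-sym a) }) ]′ (clos u v i j a)
      ; nc = nc′ ; out = out′ }
      where
      road : ∃ λ l → Path (D ∖ Q) b₀ w l
      road = toPath (approach D Q w clos (λ i → noB b₀ i b₀∈B) q∈ (D-connected b₀ q b₀∈D (proj₁ (Q⊆ q q∈))))
      out′ : ∃ λ v → v ∈ Q × v ∈ N w
      out′ with touch D Q w clos q∈ (λ i → proj₂ (Q⊆ w i) refl) (D-connected q w (proj₁ (Q⊆ q q∈)) w∈)
      ... | p , a , r = p , tgt r , a
      nc′ : ∀ v → v ∈ Q → count (N v ∩ W) + ind B v ≤ (count (N v ∩ Q) + count (N v ∩ H)) + ind (N w) v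
      nc′ v i = begin
        count (N v ∩ W) + ind B v ≡⟨ cong (count (N v ∩ W) +_) (χ-no (mem B v) (noB v i)) ⟩
        count (N v ∩ W) + 0       ≡⟨ +-identityʳ _ ⟩
        count (N v ∩ W)           ≤⟨ count-∪ (N v ∩ W) ((N v ∩ Q) ∪ (N v ∩ H)) (N v ∩ ⁅ w ⁆) spl ⟩
        count ((N v ∩ Q) ∪ (N v ∩ H)) + count (N v ∩ ⁅ w ⁆)
          ≤⟨ +-mono-≤ (count-∪ ((N v ∩ Q) ∪ (N v ∩ H)) (N v ∩ Q) (N v ∩ H) (λ _ x → x)) (count-N-sing v w) ⟩
        (count (N v ∩ Q) + count (N v ∩ H)) + ind (N w) v ∎
        where
        open ≤-Reasoning
        spl : ∀ u → u ∈ (N v ∩ W) → u ∈ ((N v ∩ Q) ∪ (N v ∩ H)) ⊎ u ∈ (N v ∩ ⁅ w ⁆)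
        spl u (a , m) with D-closed v u (proj₁ (Q⊆ v i)) m a
        ... | inj₂ h = inj₁ (inj₂ (a , h))
        ... | inj₁ d with clos v u i d a
        ...   | inj₁ j = inj₁ (inj₁ (a , j))
        ...   | inj₂ e = inj₂ (a , e)

    dgD : ∀ v → v ∈ D → v ≢ z → DegreeAt k W A B v
    dgD v i = dg v (proj₁ (D⊆ v i)) (proj₂ (D⊆ v i))

    -- Without neighbours in `T₁` and `T₂` the part misses the whole core. It is then cut off by `w`
    -- in W itself, not only in `D`.
    detached : ∀ w Q → w ∈ D → Q ⊆ (D - w) → Closed D Q w → (∀ v → v ∈ Q → ¬ v ∈ B) →
      (∀ v → v ∈ Q → ¬ v ∈ Nb T₁) → (∀ v → v ∈ Q → ¬ v ∈ Nb T₂) → (∃ λ q → q ∈ Q) → Adm k W A B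
    detached w Q w∈ Q⊆ clos noB no₁ no₂ q = separated w Q (proj₁ (D⊆ w w∈)) Q⊆W cl noB
        (λ v i → dgD v (proj₁ (Q⊆ v i))) (non-exceptional w Q z∉A Q⊆W q cl noB)
      where
      Q⊆W : Q ⊆ (W - w)
      Q⊆W v i = proj₁ (D⊆ v (proj₁ (Q⊆ v i))) , proj₂ (Q⊆ v i)
      cl : Closed W Q w
      cl u v i m a with D-closed u v (proj₁ (Q⊆ u i)) m a
      ... | inj₁ d = clos u v i d a
      ... | inj₂ h with H⊆T v h
      ...   | inj₁ t = contradiction (v , t , ~-sym a) (no₁ u i)
      ...   | inj₂ t = contradiction (v , t , ~-sym a) (no₂ u i)

    -- A failure of 2-connectedness produces a part that has no neighbour in `T₂` either, and such a
    -- part is detached.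
    via-T₂ : ∀ Q B′ → Outlet Q B′ → Q ⊆ D → (∀ u v → u ∈ Q → v ∈ Q → Reach Q u v) → (∃ λ v → v ∈ Q × v ≢ z) →
      (∀ v → v ∈ Q → ¬ v ∈ Nb T₁) →
      (∃ λ v → v ∈ Q × v ∈ Nb T₂) →
      (∀ v → v ∈ Q → v ≢ z → count (N v ∩ H) + ind A v ≤ m₂ + ind (Nb T₂) v) → Adm k W A B
    via-T₂ Q B′ o Q⊆ con v₀ no₁ att loss₂ with two? Q (Nb T₂) B′
    ... | inj₂ (w , R , c) = detached w R (Q⊆ w (w∈ c)) (λ v i → Q⊆ v (R⊆ v i) , proj₂ (Q⊆c v i)) clR
            (λ v i b → noB c v i (covB v (R⊆ v i) b)) (λ v i → no₁ v (R⊆ v i)) (noA c) (some c)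
      where
      open Outlet o
      Q⊆c = Cut.Q⊆ c
      R⊆ : R ⊆ Q
      R⊆ v i = proj₁ (Q⊆c v i)
      clR : Closed D R w
      clR u v i d a with cl u v (R⊆ u i) d a
      ... | inj₁ j = closed c u v i j a
      ... | inj₂ b = contradiction b (noB c u i)
    ... | inj₁ t = recurse ih Q (Nb T₂) B′ H K z m₂ (λ v i → proj₁ (D⊆ v (Q⊆ v i)))
            (h₀ , H⊆W h₀ h₀∈ , λ i → proj₂ (D⊆ h₀ (Q⊆ h₀ i)) h₀∈)
            (connected-rooted con att out t) v₀
            (λ v h → H⊆W v h , λ i → proj₂ (D⊆ v (Q⊆ v i)) h)
            (λ v i → proj₁ (D⊆ v (proj₁ (K⊆ v i))) , proj₂ (K⊆ v i))
            (λ v h i → proj₂ (D⊆ v (proj₁ (K⊆ v i))) h)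
            (source-family Q src₂) ex
            (λ v i ne → transfer-degree k _ (ind A v) (ind B v) (count (N v ∩ Q)) (count (N v ∩ H)) (ind B′ v) m₂ _ (dgD v (Q⊆ v i) ne) (nc v i) (loss₂ v i ne))
      where open Outlet o

    -- The component of a vertex other than `z` is taken, so that the smaller problem is connected
    -- and still has an ordinary vertex.
    via-T₂-cut : ∀ w Q → w ∈ D → Q ⊆ (D - w) → Closed D Q w → (∀ v → v ∈ Q → ¬ v ∈ B) →
      (∀ v → v ∈ Q → ¬ v ∈ Nb T₁) → (∃ λ v → v ∈ Q × v ≢ z) →
      ((∃ λ v → v ∈ Q × v ∈ Nb T₂) → ∀ v → v ∈ Q → v ≢ z → count (N v ∩ H) + ind A v ≤ m₂ + ind (Nb T₂) v) →
      Adm k W A B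
    via-T₂-cut w Q w∈ Q⊆ clos noB no₁ (v₀ , i₀ , ne₀) loss₂ with any∈ (comp Q v₀ ∩ Nb T₂)
    ... | no ¬t = detached w (comp Q v₀) w∈ (λ v i → Q⊆ v (tgt i)) (comp-closed D Q w v₀ (λ v i → proj₁ (Q⊆ v i)) clos)
            (λ v i → noB v (tgt i)) (λ v i → no₁ v (tgt i)) (λ v i t → ¬t (v , i , t)) (v₀ , here i₀)
    ... | yes (t , i , nb) = via-T₂ (comp Q v₀) (N w)
            (outlet-cut w (comp Q v₀) w∈ (λ v i → Q⊆ v (tgt i)) (comp-closed D Q w v₀ (λ v i → proj₁ (Q⊆ v i)) clos)
              (λ v i → noB v (tgt i)) (v₀ , here i₀))
            (λ v i → proj₁ (Q⊆ v (tgt i))) (comp-connected Q v₀) (v₀ , here i₀ , ne₀)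
            (λ v i → no₁ v (tgt i)) (t , i , nb)
            (λ v j → loss₂ (t , tgt i , nb) v (tgt j))

    record Leftover : Set₁ where
      field
        Q     : DSet n
        e     : V
        inD   : Q ⊆ (D - e)
        clos  : Closed D Q e
        cover : ∀ v → v ∈ D → v ∈ Q ⊎ v ≡ e
        no₁   : ∀ v → v ∈ Q → ¬ v ∈ Nb T₁
        freeB : ∀ v → v ∈ Q → ¬ v ∈ B
        z∈Q   : z ∈ Q

    -- Q collects what is cut off from B and Nb T₁; only e loses neighbours when Q is removed from D.
    via-T₁ : (∀ w Q → Cut D (Nb T₁) B w Q → ¬ z ∈ Q → Adm k W A B) → (∃ λ a → a ∈ D × a ∈ Nb T₁) →
      Adm k W A B ⊎ Leftover
    via-T₁ handle (a₁ , a₁∈ , a₁nb) = loop (count (D ∖ ∅)) ∅ z ≤-refl (λ _ ()) (λ ()) (λ _ _ ()) (λ _ ()) (λ _ ())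
                                           (λ _ → inj₂ refl) (inj₁ refl)
      where
      -- `f` bounds what is left of `D`. The vertex `e` starts as `z`; after the first absorption
      -- `z` lies in `Q`, and `e` is the cutvertex from which `Q` hangs.
      loop : ∀ f Q e → count (D ∖ Q) ≤ f → Q ⊆ D → ¬ e ∈ Q → Closed D Q e → (∀ v → v ∈ Q → ¬ v ∈ Nb T₁) →
        (∀ v → v ∈ Q → ¬ v ∈ B) → (z ∈ D → z ∈ Q ⊎ z ≡ e) → e ≡ z ⊎ z ∈ Q → Adm k W A B ⊎ Leftover
      loop f Q e le Q⊆ e∉ cl no₁ noB inv inv′ with two? (D ∖ Q) (Nb T₁) B
      ... | inj₁ t with Fin.any? (λ v → mem (D ∖ Q) v ×-dec ¬? (v Fin.≟ e))
      ...   | yes v₀ = inj₁ (recurse ih (D ∖ Q) (Nb T₁) B H ∅ e m₁ (λ v i → proj₁ (D⊆ v (proj₁ i)))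
                (h₀ , H⊆W h₀ h₀∈ , λ i → proj₂ (D⊆ h₀ (proj₁ i)) h₀∈)
                (connected-rooted con (a₁ , (a₁∈ , λ i → no₁ a₁ i a₁nb) , a₁nb) (b₀ , (b₀∈D , λ i → noB b₀ i b₀∈B) , b₀∈B) t)
                v₀ (λ v h → H⊆W v h , λ i → proj₂ (D⊆ v (proj₁ i)) h) (λ _ ()) (λ _ _ ())
                (source-family (D ∖ Q) src₁) (exits 0 (λ v _ b → direct b)) deg′)
        where
        to-e : ∀ {u} → u ∈ (D ∖ Q) → ∀ {p q} → Reach (D ∖ Q) u p → p ~ q → q ∈ D → ¬ q ∈ (D ∖ Q) → Reach (D ∖ Q) u e
        to-e i {p} {q} r a m ¬j with mem Q q
        ... | no ¬q = contradiction (m , ¬q) ¬j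
        ... | yes q∈ with cl q p q∈ (proj₁ (tgt r)) (~-sym a)
        ...   | inj₁ p∈ = contradiction p∈ (proj₂ (tgt r))
        ...   | inj₂ refl = r
        con : ∀ u v → u ∈ (D ∖ Q) → v ∈ (D ∖ Q) → Reach (D ∖ Q) u v
        con u v i j with leave (D ∖ Q) i (D-connected u v (proj₁ i) (proj₁ j)) | leave (D ∖ Q) j (D-connected v u (proj₁ j) (proj₁ i))
        ... | inj₁ r | _ = r
        ... | inj₂ _ | inj₁ r = rsym r
        ... | inj₂ (p , q , r , a , m , ¬x) | inj₂ (p′ , q′ , r′ , a′ , m′ , ¬x′) =
          rtrans (to-e i r a m ¬x) (rsym (to-e j r′ a′ m′ ¬x′))
        deg′ : ∀ v → v ∈ (D ∖ Q) → v ≢ e → suc k ≤ (count (N v ∩ (D ∖ Q)) + (ind (Nb T₁) v + ind B v)) + m₁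
        deg′ v i ne = transfer-degree k _ (ind A v) (ind B v) (count (N v ∩ (D ∖ Q))) (count (N v ∩ H)) (ind B v) m₁ _ (dgD v (proj₁ i) v≢z)
            (+-monoˡ-≤ (ind B v) (count-∪ (N v ∩ W) (N v ∩ (D ∖ Q)) (N v ∩ H) spl))
            (loss₁ v (proj₁ (D⊆ v (proj₁ i))) (proj₂ (D⊆ v (proj₁ i))))
          where
          v≢z : v ≢ z
          v≢z refl with inv (proj₁ i)
          ... | inj₁ x = proj₂ i x
          ... | inj₂ x = ne x
          spl : ∀ u → u ∈ (N v ∩ W) → u ∈ (N v ∩ (D ∖ Q)) ⊎ u ∈ (N v ∩ H)
          spl u (a , m) with D-closed v u (proj₁ i) m a
          ... | inj₂ h = inj₂ (a , h)
          ... | inj₁ d with mem Q u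
          ...   | no ¬q = inj₁ (a , d , ¬q)
          ...   | yes q with cl u v q (proj₁ i) (~-sym a)
          ...     | inj₁ x = contradiction x (proj₂ i)
          ...     | inj₂ x = contradiction x ne
      ...   | no ¬v = inj₂ (left inv′)
        where
        cover : ∀ v → v ∈ D → v ∈ Q ⊎ v ≡ e
        cover v d with mem Q v
        ... | yes q = inj₁ q
        ... | no ¬q = inj₂ (decidable-stable (v Fin.≟ e) (λ ne → ¬v (v , (d , ¬q) , ne)))
        left : e ≡ z ⊎ z ∈ Q → Leftover
        -- Here `D` is covered by `Q` and `e`. As `b₀` is in B and `Q` misses B, `e` must be `b₀`,
        -- which differs from `z`.
        left (inj₁ refl) = contradiction ([ (λ q → contradiction b₀∈B (noB b₀ q)) , id ]′ (cover b₀ b₀∈D)) b₀≢z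
        left (inj₂ z∈Q) = record { Q = Q ; e = e ; inD = λ v i → Q⊆ v i , λ { refl → e∉ i } ; clos = cl
                                 ; cover = cover ; no₁ = no₁ ; freeB = noB ; z∈Q = z∈Q }
      loop f Q e le Q⊆ e∉ cl no₁ noB′ inv inv′ | inj₂ (w , R , c) with mem R e
      -- `Q` hangs only from `e`, so it has no edge to `R`. Hence `R` is cut off in `D` itself, and
      -- by the invariant it misses `z`.
      ... | no e∉R = inj₁ (handle w R (record
              { w∈ = proj₁ (w∈ c) ; Q⊆ = λ v i → proj₁ (proj₁ (Cut.Q⊆ c v i)) , proj₂ (Cut.Q⊆ c v i) ; some = some c
              ; closed = clR ; noA = noA c ; noB = noB c })
              (λ i → [ proj₂ (proj₁ (Cut.Q⊆ c z i)) , (λ { refl → e∉R i }) ]′ (inv (proj₁ (proj₁ (Cut.Q⊆ c z i))))))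
        where
        clR : Closed D R w
        clR u v i d a with mem Q v
        ... | no ¬q = closed c u v i (d , ¬q) a
        ... | yes q with cl v u q (proj₁ (proj₁ (Cut.Q⊆ c u i))) (~-sym a)
        ...   | inj₁ x = contradiction x (proj₂ (proj₁ (Cut.Q⊆ c u i)))
        ...   | inj₂ refl = contradiction i e∉R
      loop zero Q e le Q⊆ e∉ cl no₁ noB′ inv inv′ | inj₂ (w , R , c) | yes e∈R =
        contradiction (≤-trans (one≤count (D ∖ Q) e (proj₁ (Cut.Q⊆ c e e∈R))) le) λ ()
      loop (suc f) Q e le Q⊆ e∉ cl no₁ noB′ inv inv′ | inj₂ (w , R , c) | yes e∈R =
        -- `Q` hangs from `e`, which belongs to `R`, so both together hang from `w`; the role of
        -- exceptional vertex moves from `e` to `w`.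
        loop f (Q ∪ R) w
          (≤-pred (≤-trans (count-⊂ (D ∖ (Q ∪ R)) (D ∖ Q) e (λ v i → proj₁ i , (λ q → proj₂ i (inj₁ q)))
                     (proj₁ (Cut.Q⊆ c e e∈R)) (λ i → proj₂ i (inj₂ e∈R))) le))
          (λ v → [ Q⊆ v , (λ i → proj₁ (proj₁ (Cut.Q⊆ c v i))) ]′)
          [ proj₂ (w∈ c) , (λ i → proj₂ (Cut.Q⊆ c w i) refl) ]′
          clU
          (λ v → [ no₁ v , noA c v ]′) (λ v → [ noB′ v , noB c v ]′)
          (λ d → inj₁ ([ inj₁ , (λ { refl → inj₂ e∈R }) ]′ (inv d)))
          (inj₂ ([ (λ { refl → inj₂ e∈R }) , inj₁ ]′ inv′))
        where
        clU : Closed D (Q ∪ R) w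
        clU u v (inj₁ q) d a with cl u v q d a
        ... | inj₁ x = inj₁ (inj₁ x)
        ... | inj₂ refl = inj₁ (inj₂ e∈R)
        clU u v (inj₂ r) d a with mem Q v
        ... | yes q = inj₁ (inj₁ q)
        ... | no ¬q with closed c u v r (d , ¬q) a
        ...   | inj₁ x = inj₁ (inj₂ x)
        ...   | inj₂ x = inj₂ x

  module Pendants {k : ℕ} {W A B : DSet n} {z : V} (rt : IsRooted W A B) (ih : IH (count W)) (z∉A : ¬ z ∈ A)
    (H T₁ T₂ : DSet n) (H⊆W : H ⊆ W) (H⊆T : ∀ v → v ∈ H → v ∈ T₁ ⊎ v ∈ T₂) (T₁⊆H : T₁ ⊆ H) (T₂⊆H : T₂ ⊆ H)
    (dg : ∀ v → v ∈ W → ¬ v ∈ H → v ≢ z → DegreeAt k W A B v)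
    {m₁ m₂ : ℕ} (src₁ : Source A H T₁ m₁) (src₂ : Source A H T₂ m₂)
    (loss₁ : ∀ v → v ∈ W → ¬ v ∈ H → count (N v ∩ H) + ind A v ≤ m₁ + ind (Nb T₁) v)
    (h₀ : V) (h₀∈ : h₀ ∈ H) (b₀ : V) (b₀∈W : b₀ ∈ W) (b₀∉H : ¬ b₀ ∈ H) (b₀∈B : b₀ ∈ B) (b₀≢z : b₀ ≢ z) where

    open CoreStep {k} rt ih z∉A H T₁ T₂ H⊆W H⊆T T₁⊆H T₂⊆H dg src₁ src₂ loss₁ h₀ h₀∈ b₀ b₀∈W b₀∉H b₀∈B b₀≢z public

    -- Here `D` consists of `z` and `e` only. Dropping `z` would make `e` exceptional and leave no
    -- ordinary vertex, so the core decides how this case is settled.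
    record Pendant : Set where
      field
        e     : V
        e∈D   : e ∈ D
        e∈B   : e ∈ B
        e∈Nb  : e ∈ Nb T₁
        z∈D   : z ∈ D
        e≢z   : e ≢ z
        z~e   : z ~ e
        foot  : ∃ λ t → t ∈ T₂ × t ~ z
        only  : ∀ b → b ∈ D → b ∈ B → b ≡ e
        z-nbs : ∀ u → u ∈ W → z ~ u → u ∈ T₂ ⊎ u ≡ e
        e-nbs : ∀ u → u ∈ W → e ~ u → u ∈ H ⊎ u ≡ z

    module _ (L : Leftover) (a₁ : ∃ λ a → a ∈ D × a ∈ Nb T₁) where
      open Leftover L

      left-B : e ∈ B
      left-B = [ (λ q → contradiction b₀∈B (freeB b₀ q)) , (λ { refl → b₀∈B }) ]′ (cover b₀ b₀∈D)

      left-Nb : e ∈ Nb T₁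
      left-Nb = go a₁
        where
        go : (∃ λ a → a ∈ D × a ∈ Nb T₁) → e ∈ Nb T₁
        go (a , d , t) with cover a d
        ... | inj₁ q = contradiction t (no₁ a q)
        ... | inj₂ refl = t

      left-D : e ∈ D
      left-D = [ (λ q → contradiction b₀∈B (freeB b₀ q)) , (λ { refl → b₀∈D }) ]′ (cover b₀ b₀∈D)

      pendant : (∀ v → v ∈ Q → v ≡ z) → Pendant
      pendant just-z = record
        { e = e ; e∈D = left-D ; e∈B = left-B ; e∈Nb = left-Nb ; z∈D = z∈D
        ; e≢z = λ { refl → proj₂ (inD e z∈Q) refl }
        ; z~e = z~e ; foot = foot
        ; only = λ b d b∈ → [ (λ q → contradiction b∈ (freeB b q)) , id ]′ (cover b d) ; z-nbs = z-nbs ; e-nbs = e-nbs }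
        where
        z∈D : z ∈ D
        z∈D = proj₁ (inD z z∈Q)
        z-nbs : ∀ u → u ∈ W → z ~ u → u ∈ T₂ ⊎ u ≡ e
        z-nbs u m a with D-closed z u z∈D m a
        ... | inj₂ h = [ (λ t → contradiction (u , t , ~-sym a) (no₁ z z∈Q)) , inj₁ ]′ (H⊆T u h)
        ... | inj₁ d with cover u d
        ...   | inj₂ x = inj₂ x
        ...   | inj₁ q with just-z u q
        ...     | refl = contradiction a ~-irrefl
        e-nbs : ∀ u → u ∈ W → e ~ u → u ∈ H ⊎ u ≡ z
        e-nbs u m a with D-closed e u left-D m a
        ... | inj₂ h = inj₁ h
        ... | inj₁ d with cover u d
        ...   | inj₁ q = inj₂ (just-z u q)
        ...   | inj₂ refl = contradiction a ~-irrefl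
        z~e : z ~ e
        z~e with D-connected z e z∈D left-D
        ... | here _ = contradiction left-B (freeB z z∈Q)
        ... | step {v = v} _ a r with cover v (src r)
        ...   | inj₂ refl = a
        ...   | inj₁ q with just-z v q
        ...     | refl = contradiction a ~-irrefl
        foot : ∃ λ t → t ∈ T₂ × t ~ z
        foot with two′ rt e z (proj₁ (D⊆ z z∈D)) (proj₂ (inD z z∈Q))
        ... | _ , inj₁ a , here _ = contradiction a z∉A
        ... | _ , inj₂ b , here _ = contradiction b (freeB z z∈Q)
        ... | _ , _ , step {v = v} _ a r with z-nbs v (proj₁ (src r)) a
        ...   | inj₁ t = v , t , ~-sym a
        ...   | inj₂ x = contradiction x (proj₂ (src r))

    attached : ∀ {h} → h ∈ H → Reach W b₀ h → ∃ λ a → a ∈ D × (a ∈ Nb T₁ ⊎ a ∈ Nb T₂)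
    attached {h} h∈ rh with leave D b₀∈D rh
    ... | inj₁ r = contradiction h∈ (proj₂ (D⊆ h (tgt r)))
    ... | inj₂ (p , q , r , a , m , ¬d) with D-closed p q (tgt r) m a
    ...   | inj₁ d = contradiction d ¬d
    ...   | inj₂ h with H⊆T q h
    ...     | inj₁ t = p , tgt r , inj₁ (q , t , ~-sym a)
    ...     | inj₂ t = p , tgt r , inj₂ (q , t , ~-sym a)

    -- The bound for `T₂` is required only at vertices without neighbours in `T₁`: routes to `T₂`
    -- are fewer, and they are used only for parts that `T₁` does not touch.
    core-result : (∃ λ a → a ∈ D × (a ∈ Nb T₁ ⊎ a ∈ Nb T₂)) →
      ((∃ λ t → t ∈ T₂) → ∀ v → v ∈ W → ¬ v ∈ H → ¬ v ∈ Nb T₁ → count (N v ∩ H) + ind A v ≤ m₂ + ind (Nb T₂) v) →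
      Adm k W A B ⊎ Pendant
    core-result att loss₂ with any∈ (D ∩ Nb T₁)
    ... | no ¬a = inj₁ (whole att)
      where
      no₁ : ∀ v → v ∈ D → ¬ v ∈ Nb T₁
      no₁ v d t = ¬a (v , d , t)
      whole : (∃ λ a → a ∈ D × (a ∈ Nb T₁ ⊎ a ∈ Nb T₂)) → Adm k W A B
      whole (a , d , inj₁ t) = contradiction t (no₁ a d)
      whole (a , d , inj₂ (t , t∈ , e)) = via-T₂ D B outlet-whole (λ _ i → i) D-connected (b₀ , b₀∈D , b₀≢z) no₁
        (a , d , t , t∈ , e) (λ v i _ → loss₂ (t , t∈) v (proj₁ (D⊆ v i)) (proj₂ (D⊆ v i)) (no₁ v i))
    ... | yes a₁ with via-T₁ handle a₁
      where
      handle : ∀ w Q → Cut D (Nb T₁) B w Q → ¬ z ∈ Q → Adm k W A B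
      handle w Q c z∉Q = via-T₂-cut w Q (w∈ c) (Cut.Q⊆ c) (closed c) (noB c) (noA c)
        (proj₁ (some c) , proj₂ (some c) , λ { refl → z∉Q (proj₂ (some c)) })
        (λ (v , i , t , t∈ , _) u j _ → loss₂ (t , t∈) u (proj₁ (D⊆ u (proj₁ (Cut.Q⊆ c u j))))
             (proj₂ (D⊆ u (proj₁ (Cut.Q⊆ c u j)))) (noA c u j))
    ...   | inj₁ s = inj₁ s
    ...   | inj₂ L with Fin.any? (λ v → mem (Leftover.Q L) v ×-dec ¬? (v Fin.≟ z))
    ...     | no ¬v = inj₂ (pendant L a₁ (λ v q → decidable-stable (v Fin.≟ z) (λ ne → ¬v (v , q , ne))))
    ...     | yes v₀ = inj₁ (via-T₂-cut e Q (left-D L a₁) inD clos freeB no₁ v₀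
                (λ (v , i , t , t∈ , _) u j _ → loss₂ (t , t∈) u (proj₁ (D⊆ u (proj₁ (inD u j))))
                  (proj₂ (D⊆ u (proj₁ (inD u j)))) (no₁ u j)))
      where open Leftover L

  -- Clique cores inside A

  Clique : DSet n → Set
  Clique K = ∀ u v → u ∈ K → v ∈ K → u ≢ v → u ~ v

  clique-path : ∀ i K p → p ∈ K → Clique K → i < count K → ∃ λ u → u ∈ K × Path K p u i
  clique-path zero K p p∈ _ _ = p , p∈ , end p∈
  clique-path (suc i) K p p∈ cl i< with ≤-pred (≤-trans i< (count-del K p))
  ... | j< with count-pos (K - p) (≤-trans (s≤s z≤n) j<)
  ... | q , q∈ with clique-path i (K - p) q q∈ (λ u v a b → cl u v (proj₁ a) (proj₁ b)) j<
  ... | u , u∈ , r = u , proj₁ u∈ , cons p∈ (cl p q p∈ (proj₁ q∈) (λ e → proj₂ q∈ (sym e))) r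

  MaximalIn : DSet n → DSet n → Set
  MaximalIn X K = ∀ v → v ∈ X → ¬ v ∈ K → ∃ λ t → t ∈ K × ¬ t ~ v

  grow-clique : ∀ f X K → count (X ∖ K) ≤ f → K ⊆ X → Clique K →
    Σ (DSet n) λ M → K ⊆ M × M ⊆ X × Clique M × MaximalIn X M
  grow-clique f X K le K⊆ cl with Fin.any? (λ v → mem (X ∖ K) v ×-dec ¬? (Fin.any? (λ t → mem K t ×-dec ¬? (t ~? v))))
  ... | no ¬v = K , (λ _ i → i) , K⊆ , cl , λ v x ¬k → decidable-stable (Fin.any? (λ t → mem K t ×-dec ¬? (t ~? v)))
                  (λ ¬t → ¬v (v , (x , ¬k) , ¬t))
  grow-clique zero X K le K⊆ cl | yes (v , x , _) = contradiction (≤-trans (one≤count (X ∖ K) v x) le) λ ()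
  grow-clique (suc f) X K le K⊆ cl | yes (v , x , all) = proj₁ M , (λ u i → proj₁ (proj₂ M) u (inj₁ i)) , proj₂ (proj₂ M)
    where
    adj-all : ∀ t → t ∈ K → t ~ v
    adj-all t i = decidable-stable (t ~? v) (λ ¬a → all (t , i , ¬a))
    cl′ : Clique (K ∪ ⁅ v ⁆)
    cl′ a b (inj₁ i) (inj₁ j) ne = cl a b i j ne
    cl′ a b (inj₁ i) (inj₂ refl) ne = adj-all a i
    cl′ a b (inj₂ refl) (inj₁ j) ne = ~-sym (adj-all b j)
    cl′ a b (inj₂ refl) (inj₂ refl) ne = contradiction refl ne
    M = grow-clique f X (K ∪ ⁅ v ⁆)
      (≤-pred (≤-trans (count-⊂ (X ∖ (K ∪ ⁅ v ⁆)) (X ∖ K) v (λ u i → proj₁ i , λ k → proj₂ i (inj₁ k)) x (λ i → proj₂ i (inj₂ refl))) le))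
      (λ u → [ K⊆ u , (λ { refl → proj₁ x }) ]′) cl′

  -- The normal form to which every problem with k ≥ 2 is reduced. It is symmetric in A and B, so
  -- each core can be tried from both roots.
  record Node (k : ℕ) (W A B : DSet n) (z : V) : Set₁ where
    field
      rt   : IsRooted W A B
      conn : ∀ u v → u ∈ W → v ∈ W → Reach W u v
      dg   : ∀ v → v ∈ W → v ≢ z → DegreeAt k W A B v
      ih   : IH (count W)
      z∉A  : ¬ z ∈ A
      z∉B  : ¬ z ∈ B
      A⊆W  : A ⊆ W
      B⊆W  : B ⊆ W
      2≤k  : 2 ≤ k
      2≤A  : 2 ≤ count A
      2≤B  : 2 ≤ count B

  node-swap : ∀ {k W A B z} → Node k W A B z → Node k W B A z
  node-swap {k} {W} {A} {B} N₀ = record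
    { rt = rooted-swap rt ; conn = conn
    ; dg = λ v i ne → subst (λ x → suc k ≤ count (N v ∩ W) + x) (+-comm (ind A v) (ind B v)) (dg v i ne)
    ; ih = ih ; z∉A = z∉B ; z∉B = z∉A ; A⊆W = B⊆W ; B⊆W = A⊆W ; 2≤k = 2≤k ; 2≤A = 2≤B ; 2≤B = 2≤A }
    where open Node N₀

  count-mono-N : ∀ v X → count (N v ∩ X) ≤ count X
  count-mono-N v X = count-⊆ (N v ∩ X) X (λ _ → proj₂)

  count-no-Nb : ∀ v X → ¬ v ∈ Nb X → count (N v ∩ X) ≡ 0
  count-no-Nb v X ¬i = count-empty (N v ∩ X) (λ u (a , i) → ¬i (u , i , ~-sym a))

  clique-source : ∀ {A H T} → Clique T → T ⊆ A → T ⊆ H → ∀ m → suc m ≤ count T → Source A H T m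
  clique-source {A} {H} {T} cl T⊆A T⊆H m m< = source 0 (inj₁ refl) λ p p∈ i i≤ →
    let (u , u∈ , r) = clique-path i T p p∈ cl (≤-trans (s≤s i≤) m<) in
    subst (Between H A ⁅ p ⁆) (sym (*-identityʳ i)) (between (T⊆A u u∈) refl (prev (pmono T⊆H r)))

  empty-source : ∀ {A H} → Source A H ∅ 0
  empty-source = source 0 (inj₁ refl) (λ _ ())

  -- By maximality a vertex of A outside `T` misses a vertex of `T`, which offsets its edge to x; so
  -- |T| lengths suffice. With `T₂` empty a pendant would have no foot.
  triangle-core : ∀ {k W A B z} → Node k W A B z → ∀ a a′ → a ∈ A → a′ ∈ A → a ~ a′ →
    Adm k W A B ⊎ Σ (DSet n) λ T → Clique T × T ⊆ A × B ⊆ T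
  triangle-core {k} {W} {A} {B} {z} N₀ a a′ a∈ a′∈ a~ with grow-clique _ A (⁅ a ⁆ ∪ ⁅ a′ ⁆) ≤-refl
       (λ { _ (inj₁ refl) → a∈ ; _ (inj₂ refl) → a′∈ })
       (λ { _ _ (inj₁ refl) (inj₁ refl) ne → contradiction refl ne ; _ _ (inj₁ refl) (inj₂ refl) _ → a~
          ; _ _ (inj₂ refl) (inj₁ refl) _ → ~-sym a~ ; _ _ (inj₂ refl) (inj₂ refl) ne → contradiction refl ne })
  ... | T , K⊆T , T⊆A , cl , mx with any∈ (B ∖ T)
  ... | no ¬b = inj₂ (T , cl , T⊆A , λ v b → decidable-stable (mem T v) (λ ¬t → ¬b (v , b , ¬t)))
  ... | yes (b₀ , b₀∈B , b₀∉T) = inj₁ ([ id , (λ p → ⊥-elim (proj₁ (proj₂ (Pendant.foot p)))) ]′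
          (core-result (attached a∈T (conn b₀ a (B⊆W b₀ b₀∈B) (A⊆W a a∈))) (λ ())))
    where
    open Node N₀
    a∈T : a ∈ T
    a∈T = K⊆T a (inj₁ refl)
    2≤T : 2 ≤ count T
    2≤T = two≤count T a a′ (K⊆T a (inj₁ refl)) (K⊆T a′ (inj₂ refl)) (~⇒≢ a~)
    m₁ = pred (count T)
    m₁≡ : suc m₁ ≡ count T
    m₁≡ = suc-pred (count T) {{>-nonZero (≤-trans (s≤s z≤n) 2≤T)}}
    loss : ∀ v → v ∈ W → ¬ v ∈ T → count (N v ∩ T) + ind A v ≤ m₁ + ind (Nb T) v
    loss v w ¬t with mem (Nb T) v
    ... | no ¬nb rewrite count-no-Nb v T ¬nb = ≤-trans (χ≤1 (mem A v)) (≤-trans (≤-pred (≤-trans 2≤T (≤-reflexive (sym m₁≡)))) (m≤m+n m₁ 0))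
    ... | yes _ with mem A v
    ...   | no _ = ≤-trans (≤-reflexive (+-identityʳ _)) (≤-trans (count-mono-N v T) (≤-reflexive (trans (sym m₁≡) (+-comm 1 m₁))))
    ...   | yes a with mx v a ¬t
    ...     | t , t∈ , ¬t~v = ≤-trans (≤-reflexive (+-comm _ 1))
              (≤-trans (count-⊂ (N v ∩ T) T t (λ _ → proj₂) t∈ (λ i → ¬t~v (~-sym (proj₁ i))))
                (≤-reflexive (trans (sym m₁≡) (+-comm 1 m₁))))
    b₀≢z : b₀ ≢ z
    b₀≢z refl = z∉B b₀∈B
    open Pendants {k} rt ih z∉A T T ∅ (λ v i → A⊆W v (T⊆A v i)) (λ _ → inj₁) (λ _ i → i) (λ _ ())
      (λ v w _ → dg v w) (clique-source cl T⊆A (λ _ i → i) m₁ (≤-reflexive m₁≡)) empty-source loss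
      a (K⊆T a (inj₁ refl)) b₀ (B⊆W b₀ b₀∈B) b₀∉T b₀∈B b₀≢z

  -- Cores given by a clique joined to two vertices of A

  pair : V → V → DSet n
  pair a a′ = ⁅ a ⁆ ∪ ⁅ a′ ⁆

  count-pair : ∀ X a a′ → X ⊆ pair a a′ → count X ≤ 2
  count-pair X a a′ h = ≤-trans (count-∪ X ⁅ a ⁆ ⁅ a′ ⁆ h) (≤-reflexive (cong₂ _+_ (count-sing a) (count-sing a′)))

  Independent : DSet n → Set
  Independent A = ∀ u v → u ∈ A → v ∈ A → u ~ v → ⊥

  -- Once these configurations are excluded, a vertex with a neighbour in S has at most one neighbour in
  -- Common A S.
  NoJoin : DSet n → DSet n → Set
  NoJoin W A = ∀ a a′ c v → a ∈ A → a′ ∈ A → a ≢ a′ → c ∈ W → v ∈ W → c ~ v → a ~ c → a′ ~ c → a ~ v → a′ ~ v → ⊥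

  path-to : ∀ {K q r} i → Clique K → (∀ v → v ∈ K → q ~ v) → r ∈ K → i < count K →
    Path (K ∪ ⁅ q ⁆) r q (suc i)
  path-to {K} {q} {r} i cl adjq r∈ i< =
    let (u , u∈ , p) = clique-path i K r r∈ cl i< in
    subst (Path (K ∪ ⁅ q ⁆) r q) (+-comm i 1)
      (cat p (~-sym (adjq u u∈)) (end {⁅ q ⁆} refl) (λ _ → inj₁) (λ _ → inj₂)
        (λ { _ k refl → ~-irrefl (adjq q k) }))

  module JoinCore {k : ℕ} {W A B : DSet n} {z : V} (N₀ : Node k W A B z) (noTri : Independent A)
    (a a′ : V) (a∈ : a ∈ A) (a′∈ : a′ ∈ A) (a≢a′ : a ≢ a′)
    (M : DSet n) (cl : Clique M) (2≤M : 2 ≤ count M) (M⊆W : M ⊆ W)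
    (a~M : ∀ v → v ∈ M → a ~ v) (a′~M : ∀ v → v ∈ M → a′ ~ v)
    (mx : ∀ v → v ∈ W → a ~ v → a′ ~ v → ¬ v ∈ M → ∃ λ t → t ∈ M × ¬ t ~ v) where

    open Node N₀

    P H : DSet n
    P = pair a a′
    H = M ∪ P

    m = count M

    H⊆W : H ⊆ W
    H⊆W v = [ M⊆W v , [ (λ { refl → A⊆W a a∈ }) , (λ { refl → A⊆W a′ a′∈ }) ]′ ]′

    a∉M : ¬ a ∈ M
    a∉M i = ~-irrefl (a~M a i)

    a′∉M : ¬ a′ ∈ M
    a′∉M i = ~-irrefl (a′~M a′ i)

    route₁ : ∀ p → p ∈ M → ∀ i → i ≤ m → Between H A ⁅ p ⁆ (1 + i * 1)
    route₁ p p∈ i i≤ rewrite *-identityʳ i with suc i ≤? m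
    ... | yes i< = between a∈ refl (prev (pmono (λ v → [ inj₁ , (λ e → inj₂ (inj₁ e)) ]′) (path-to i cl a~M p∈ i<)))
    -- Length m + 1 uses both vertices of A: from `p` to `a′`, back into M at `q`, through all of M
    -- - p, and on to `a`. The m - 2 edges inside M - p make 1 + 1 + (m - 2) + 1.
    ... | no ¬i< rewrite ≤-antisym i≤ (≤-pred (≰⇒> ¬i<)) = between a∈ refl (prev
          (subst (Path H p a) (cong suc m≡) (cons (inj₁ p∈) (~-sym (a′~M p p∈))
            (cons (inj₂ (inj₂ refl) , (λ { refl → a′∉M p∈ })) (a′~M q (proj₁ q∈))
              (pmono inc (path-to (m ∸ 2) (λ u v x y → cl u v (proj₁ x) (proj₁ y)) (λ v x → a~M v (proj₁ x)) q∈ le))))))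
      where
      m≡ : suc (suc (m ∸ 2)) ≡ m
      m≡ = m+[n∸m]≡n 2≤M
      le : suc (m ∸ 2) ≤ count (M - p)
      le = ≤-pred (≤-trans (≤-reflexive m≡) (count-del M p))
      q = proj₁ (count-pos (M - p) (≤-trans (s≤s z≤n) le))
      q∈ = proj₂ (count-pos (M - p) (≤-trans (s≤s z≤n) le))
      inc : ((M - p) ∪ ⁅ a ⁆) ⊆ ((H - p) - a′)
      inc v (inj₁ (x , ne)) = (inj₁ x , ne) , λ { refl → a′∉M x }
      inc v (inj₂ refl) = (inj₂ (inj₁ refl) , λ { refl → a∉M p∈ }) , a≢a′

    route₂ : ∀ {q q′} → q ∈ P → q ≢ q′ → q′ ∈ A → (∀ v → v ∈ M → q ~ v) → (∀ v → v ∈ M → q′ ~ v) → q′ ∈ P →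
      ∀ i → i < m → Between H A ⁅ q ⁆ (2 + i * 1)
    route₂ {q} {q′} q∈ q≢q′ q′∈A q~ q′~ q′∈ i i< rewrite *-identityʳ i =
      let (r , r∈) = count-pos M (≤-trans (s≤s z≤n) 2≤M) in
      between q′∈A refl (prev (cons (inj₂ q∈) (q~ r r∈) (pmono inc (path-to i cl q′~ r∈ i<))))
      where
      inc : (M ∪ ⁅ q′ ⁆) ⊆ (H - q)
      inc v (inj₁ x) = inj₁ x , λ { refl → ~-irrefl (q~ v x) }
      inc v (inj₂ refl) = inj₂ q′∈ , λ e → q≢q′ (sym e)

    pm≡ : suc (pred m) ≡ m
    pm≡ = suc-pred m {{>-nonZero (≤-trans (s≤s z≤n) 2≤M)}}

    src₁ : Source A H M m
    src₁ = source 1 (inj₁ refl) route₁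

    src₂ : Source A H P (pred m)
    src₂ = source 2 (inj₁ refl) λ
      { p (inj₁ refl) i i≤ → route₂ (inj₁ refl) a≢a′ a′∈ a~M a′~M (inj₂ refl) i (≤-trans (s≤s i≤) (≤-reflexive pm≡))
      ; p (inj₂ refl) i i≤ → route₂ (inj₂ refl) (λ e → a≢a′ (sym e)) a∈ a′~M a~M (inj₁ refl) i (≤-trans (s≤s i≤) (≤-reflexive pm≡)) }

    -- Since A is independent, among the edges to `a`, `a′` and x only the first two can occur
    -- together. If they do, maximality of M makes `v` miss a vertex of M, which pays for the second
    -- edge.
    PairLoss : V → Set
    PairLoss v = (count (N v ∩ P) + ind A v ≤ 1) ⊎
      (a ~ v × count (N v ∩ P) + ind A v ≤ 2 × suc (count (N v ∩ M)) ≤ m)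

    pair-loss : ∀ v → v ∈ W → ¬ v ∈ H → PairLoss v
    pair-loss v w ¬h with a ~? v | a′ ~? v
    ... | yes x | yes y with mx v w x y (λ i → ¬h (inj₁ i))
    ...   | t , t∈ , ¬t = inj₂ (x , ≤-trans (≤-reflexive (trans (cong (count (N v ∩ P) +_) (χ-no (mem A v) (λ i → noTri a v a∈ i x))) (+-identityʳ _)))
              (count-pair (N v ∩ P) a a′ (λ _ → proj₂)) , count-⊂ (N v ∩ M) M t (λ _ → proj₂) t∈ (λ i → ¬t (~-sym (proj₁ i))))
    pair-loss v w ¬h | yes x | no ¬y = inj₁ (≤-trans (≤-reflexive (trans (cong (count (N v ∩ P) +_) (χ-no (mem A v) (λ i → noTri a v a∈ i x))) (+-identityʳ _)))
              (≤-trans (count-⊆ (N v ∩ P) ⁅ a ⁆ (λ { u (_ , inj₁ e) → e ; u (b , inj₂ refl) → contradiction (~-sym b) ¬y })) (≤-reflexive (count-sing a))))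
    pair-loss v w ¬h | no ¬x | yes y = inj₁ (≤-trans (≤-reflexive (trans (cong (count (N v ∩ P) +_) (χ-no (mem A v) (λ i → noTri a′ v a′∈ i y))) (+-identityʳ _)))
              (≤-trans (count-⊆ (N v ∩ P) ⁅ a′ ⁆ (λ { u (_ , inj₂ e) → e ; u (b , inj₁ refl) → contradiction (~-sym b) ¬x })) (≤-reflexive (count-sing a′))))
    pair-loss v w ¬h | no ¬x | no ¬y = inj₁ (≤-trans (≤-reflexive (cong (_+ ind A v) (count-empty (N v ∩ P)
              (λ { u (b , inj₁ refl) → ¬x (~-sym b) ; u (b , inj₂ refl) → ¬y (~-sym b) })))) (χ≤1 (mem A v)))

    split-H : ∀ v → count (N v ∩ H) + ind A v ≤ count (N v ∩ M) + (count (N v ∩ P) + ind A v)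
    split-H v = ≤-trans (+-monoˡ-≤ (ind A v) (count-∪ (N v ∩ H) (N v ∩ M) (N v ∩ P)
      λ { u (b , inj₁ x) → inj₁ (b , x) ; u (b , inj₂ x) → inj₂ (b , x) })) (≤-reflexive (+-assoc (count (N v ∩ M)) _ _))

    loss₁ : ∀ v → v ∈ W → ¬ v ∈ H → count (N v ∩ H) + ind A v ≤ m + ind (Nb M) v
    loss₁ v w ¬h = ≤-trans (split-H v) (go (mem (Nb M) v) (pair-loss v w ¬h))
      where
      go : (d : Dec (v ∈ Nb M)) → PairLoss v → count (N v ∩ M) + (count (N v ∩ P) + ind A v) ≤ m + χ d
      go (no ¬nb) (inj₁ y) rewrite count-no-Nb v M ¬nb = ≤-trans y (≤-trans (≤-trans (s≤s z≤n) 2≤M) (m≤m+n m 0))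
      go (no ¬nb) (inj₂ (_ , y , _)) rewrite count-no-Nb v M ¬nb = ≤-trans y (≤-trans 2≤M (m≤m+n m 0))
      go (yes _) (inj₁ y) = +-mono-≤ (count-mono-N v M) y
      go (yes _) (inj₂ (_ , y , x)) = ≤-trans (+-monoʳ-≤ (count (N v ∩ M)) y)
        (≤-trans (≤-reflexive (trans (+-comm (count (N v ∩ M)) 2) (sym (+-comm (suc (count (N v ∩ M))) 1)))) (+-monoˡ-≤ 1 x))

    loss₂ : ∀ v → v ∈ W → ¬ v ∈ H → ¬ v ∈ Nb M → count (N v ∩ H) + ind A v ≤ pred m + ind (Nb P) v
    loss₂ v w ¬h ¬nb = ≤-trans (split-H v) (go (pair-loss v w ¬h))
      where
      1≤pm : 1 ≤ pred m
      1≤pm = ≤-pred (≤-trans 2≤M (≤-reflexive (sym pm≡)))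
      go : PairLoss v → count (N v ∩ M) + (count (N v ∩ P) + ind A v) ≤ pred m + ind (Nb P) v
      go (inj₁ y) rewrite count-no-Nb v M ¬nb = ≤-trans y (≤-trans 1≤pm (m≤m+n _ _))
      go (inj₂ (x , y , _)) rewrite count-no-Nb v M ¬nb = ≤-trans y (+-mono-≤ 1≤pm
        (≤-reflexive (sym (χ-yes (mem (Nb P) v) (a , inj₁ refl , x)))))

    -- The path q, M, q′, z, e through all of M is longer by one than the longest path through H to e.
    pendant-paths : ∀ {q q′} e → q ∈ A → q ∈ P → q′ ∈ P → q ≢ q′ → (∀ v → v ∈ M → q ~ v) → (∀ v → v ∈ M → q′ ~ v) →
      e ∈ B → ¬ e ∈ H → ¬ z ∈ H → z ∈ W → z ~ e → e ≢ z → q′ ~ z → e ∈ Nb M → Adm (suc (suc m)) W A B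
    pendant-paths {q} {q′} e q∈A q∈ q′∈ q≢q′ q~ q′~ e∈B e∉H z∉H z∈W z~e e≢z q′~z (r , r∈ , r~e) =
      adm 2 (inj₁ refl) λ i i< → go i (≤-pred i<)
      where
      long : Path W e q (suc (suc (suc m)))
      long = cons (B⊆W e e∈B) (~-sym z~e) (cons (z∈W , λ x → e≢z (sym x)) (~-sym q′~z)
               (cons ((H⊆W q′ (inj₂ q′∈) , λ { refl → e∉H (inj₂ q′∈) }) , λ { refl → z∉H (inj₂ q′∈) }) (q′~ r r∈)
                 (pmono inc (subst (Path (M ∪ ⁅ q ⁆) r q) pm≡ (path-to (pred m) cl q~ r∈ (≤-reflexive pm≡))))))
        where
        inc : (M ∪ ⁅ q ⁆) ⊆ (((W - e) - z) - q′)
        inc v (inj₁ x) = ((M⊆W v x , λ { refl → e∉H (inj₁ x) }) , λ { refl → z∉H (inj₁ x) }) , λ { refl → ~-irrefl (q′~ v x) }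
        inc v (inj₂ refl) = ((H⊆W v (inj₂ q∈) , λ { refl → e∉H (inj₂ q∈) }) , λ { refl → z∉H (inj₂ q∈) }) , q≢q′
      go : ∀ i → i ≤ suc m → Between W A B (2 + i * 1)
      go i i≤ with i ≤? m
      ... | yes j≤ with route₁ r r∈ i j≤
      ...   | between {s = s} u∈ refl p = between u∈ e∈B (subst (Path W s e) (+-comm (1 + i * 1) 1)
                (cat p r~e (end {⁅ e ⁆} refl) H⊆W (λ { _ refl → B⊆W e e∈B }) (λ { _ h refl → e∉H h })))
      go i i≤ | no ¬j rewrite ≤-antisym i≤ (≰⇒> ¬j) | *-identityʳ m = between q∈A e∈B (prev long)

    result : Adm k W A B ⊎ B ⊆ H
    result with any∈ (B ∖ H)
    ... | no ¬b = inj₂ (λ v b → decidable-stable (mem H v) (λ ¬h → ¬b (v , b , ¬h)))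
    ... | yes (b₀ , b₀∈B , b₀∉H) = inj₁ ([ id , explicit ]′ (core-result (attached (inj₂ (inj₁ refl)) (conn b₀ a (B⊆W b₀ b₀∈B) (A⊆W a a∈))) (λ _ → loss₂)))
      where
      b₀≢z : b₀ ≢ z
      b₀≢z refl = z∉B b₀∈B
      open Pendants {k} rt ih z∉A H M P H⊆W (λ _ h → h) (λ _ → inj₁) (λ _ → inj₂)
        (λ v w _ → dg v w) src₁ src₂ loss₁ a (inj₂ (inj₁ refl)) b₀ (B⊆W b₀ b₀∈B) b₀∉H b₀∈B b₀≢z
      explicit : Pendant → Adm k W A B
      explicit p = adm-mono {W = W} {W} k≤ (λ _ x → x) (λ _ _ x → x) (λ _ _ x → x) (build foot)
        where
        open Pendant p
        e∈W∖H = D⊆ e e∈D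
        z∈W∖H = D⊆ z z∈D
        build : (∃ λ t → t ∈ P × t ~ z) → Adm (suc (suc m)) W A B
        build (_ , inj₁ refl , t) = pendant-paths e a′∈ (inj₂ refl) (inj₁ refl) (λ x → a≢a′ (sym x)) a′~M a~M e∈B
          (proj₂ e∈W∖H) (proj₂ z∈W∖H) (proj₁ z∈W∖H) z~e e≢z t e∈Nb
        build (_ , inj₂ refl , t) = pendant-paths e a∈ (inj₁ refl) (inj₂ refl) a≢a′ a~M a′~M e∈B
          (proj₂ e∈W∖H) (proj₂ z∈W∖H) (proj₁ z∈W∖H) z~e e≢z t e∈Nb
        -- The degree of `e` is at most m + 3: at most m + 1 for the core and x together, then `z`
        -- and y.
        k≤ : k ≤ suc (suc m)
        k≤ = ≤-pred (begin
          suc k ≤⟨ dg e (proj₁ e∈W∖H) e≢z ⟩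
          count (N e ∩ W) + (ind A e + ind B e) ≤⟨ +-mono-≤ (count-∪ (N e ∩ W) (N e ∩ H) ⁅ z ⁆
             (λ u (x , w) → [ (λ h → inj₁ (x , h)) , inj₂ ]′ (e-nbs u w x))) (+-monoʳ-≤ (ind A e) (χ≤1 (mem B e))) ⟩
          (count (N e ∩ H) + count ⁅ z ⁆) + (ind A e + 1) ≡⟨ cong (λ x → (count (N e ∩ H) + x) + (ind A e + 1)) (count-sing z) ⟩
          (count (N e ∩ H) + 1) + (ind A e + 1) ≡⟨ eq (count (N e ∩ H)) (ind A e) ⟩
          suc (suc (count (N e ∩ H) + ind A e)) ≤⟨ s≤s (s≤s (≤-trans (loss₁ e (proj₁ e∈W∖H) (proj₂ e∈W∖H)) (+-monoʳ-≤ m (χ≤1 (mem (Nb M) e))))) ⟩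
          suc (suc (m + 1)) ≡⟨ cong (λ x → suc (suc x)) (+-comm m 1) ⟩
          suc (suc (suc m)) ∎)
          where
          open ≤-Reasoning
          eq : ∀ x y → (x + 1) + (y + 1) ≡ suc (suc (x + y))
          eq = solve-∀

  -- If B lies in the core, independence and |B| ≥ 2 leave only `a` and `a′`, the one nonadjacent
  -- pair there. So B is the pair, and the construction can be repeated with the roots exchanged.
  join-core : ∀ {k W A B z} → Node k W A B z → Independent A → Independent B → ∀ a a′ c v → a ∈ A → a′ ∈ A → a ≢ a′ →
    c ∈ W → v ∈ W → c ~ v → a ~ c → a′ ~ c → a ~ v → a′ ~ v →
    Adm k W A B ⊎ (B ⊆ pair a a′ × pair a a′ ⊆ B)
  join-core {k} {W} {A} {B} {z} N₀ iA iB a a′ c v a∈ a′∈ ne c∈ v∈ c~v p q r s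
    with grow-clique _ (W ∩ (N a ∩ N a′)) (⁅ c ⁆ ∪ ⁅ v ⁆) ≤-refl
       (λ { _ (inj₁ refl) → c∈ , p , q ; _ (inj₂ refl) → v∈ , r , s })
       (λ { _ _ (inj₁ refl) (inj₁ refl) ne → contradiction refl ne ; _ _ (inj₁ refl) (inj₂ refl) _ → c~v
          ; _ _ (inj₂ refl) (inj₁ refl) _ → ~-sym c~v ; _ _ (inj₂ refl) (inj₂ refl) ne → contradiction refl ne })
  ... | M , cv⊆ , M⊆ , cl , mx with JoinCore.result N₀ iA a a′ a∈ a′∈ ne M cl
        (two≤count M c v (cv⊆ c (inj₁ refl)) (cv⊆ v (inj₂ refl)) (~⇒≢ c~v)) (λ u i → proj₁ (M⊆ u i))
        (λ u i → proj₁ (proj₂ (M⊆ u i))) (λ u i → proj₂ (proj₂ (M⊆ u i))) (λ u w x y → mx u (w , x , y))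
  ... | inj₁ done = inj₁ done
  ... | inj₂ B⊆H = inj₂ (B⊆P , P⊆B)
    where
    pick = count-two B (Node.2≤B N₀)
    other : ∀ b → ∃ λ b′ → b′ ∈ B × b ≢ b′
    other b with pick
    ... | x , y , x∈ , y∈ , x≢y with b Fin.≟ x
    ...   | yes refl = y , y∈ , x≢y
    ...   | no b≢x = x , x∈ , b≢x
    B⊆P : B ⊆ pair a a′
    B⊆P b b∈ with B⊆H b b∈ | other b
    ... | inj₂ h | _ = h
    ... | inj₁ m | b′ , b′∈ , b≢b′ with B⊆H b′ b′∈
    ...   | inj₁ m′ = ⊥-elim (iB b b′ b∈ b′∈ (cl b b′ m m′ b≢b′))
    ...   | inj₂ (inj₁ refl) = ⊥-elim (iB b′ b b′∈ b∈ (proj₁ (proj₂ (M⊆ b m))))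
    ...   | inj₂ (inj₂ refl) = ⊥-elim (iB b′ b b′∈ b∈ (proj₂ (proj₂ (M⊆ b m))))
    P⊆B : pair a a′ ⊆ B
    P⊆B u i with pick
    ... | x , y , x∈ , y∈ , x≢y with B⊆P x x∈ | B⊆P y y∈ | i
    ...   | inj₁ refl | inj₁ refl | _ = contradiction refl x≢y
    ...   | inj₂ refl | inj₂ refl | _ = contradiction refl x≢y
    ...   | inj₁ refl | inj₂ refl | inj₁ refl = x∈
    ...   | inj₁ refl | inj₂ refl | inj₂ refl = y∈
    ...   | inj₂ refl | inj₁ refl | inj₁ refl = y∈
    ...   | inj₂ refl | inj₁ refl | inj₂ refl = x∈

  -- Cores given by a biclique

  -- Adjacency to all of `S` is expressed as the absence of a counterexample, which a finite search
  -- decides.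
  Common : DSet n → DSet n → DSet n
  Common A S = record { ∋ = λ v → v ∈ A × ¬ (∃ λ c → c ∈ S × ¬ c ~ v)
                      ; mem = λ v → mem A v ×-dec ¬? (Fin.any? (λ c → mem S c ×-dec ¬? (c ~? v))) }

  common-adj : ∀ {A S} c t → c ∈ S → t ∈ Common A S → c ~ t
  common-adj c t i (_ , h) = decidable-stable (c ~? t) (λ ¬a → h (c , i , ¬a))

  biclique-path : ∀ i S T p → p ∈ T → (∀ c t → c ∈ S → t ∈ T → c ~ t) →
    i ≤ count S → i < count T → ∃ λ u → u ∈ T × Path (S ∪ T) p u (i * 2)
  biclique-path zero S T p p∈ _ _ _ = p , p∈ , end (inj₂ p∈)
  biclique-path (suc i) S T p p∈ ad i≤ i< with count-pos S (≤-trans (s≤s z≤n) i≤) | ≤-pred (≤-trans i< (count-del T p))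
  ... | c , c∈ | j< with count-pos (T - p) (≤-trans (s≤s z≤n) j<)
  ... | q , q∈ with biclique-path i (S - c) (T - p) q q∈ (λ d t x y → ad d t (proj₁ x) (proj₁ y))
                      (≤-pred (≤-trans i≤ (count-del S c))) j<
  ... | u , u∈ , r = u , proj₁ u∈ , cons (inj₂ p∈) (~-sym (ad c p c∈ p∈))
          (cons (inj₁ c∈ , λ { refl → ~-irrefl (ad c c c∈ p∈) }) (ad c q c∈ (proj₁ q∈)) (pmono inc r))
    where
    inc : ((S - c) ∪ (T - p)) ⊆ (((S ∪ T) - p) - c)
    inc v (inj₁ (x , ne)) = (inj₁ x , λ { refl → ~-irrefl (ad v v x p∈) }) , ne
    inc v (inj₂ (y , ne)) = (inj₂ y , ne) , λ { refl → ~-irrefl (ad v v c∈ y) }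

  -- A path with both ends in T that uses i vertices of S needs i + 1 vertices of T. Therefore |S| <
  -- |T| is exactly what yields all even lengths up to 2|S|.
  biclique-source₁ : ∀ {A S T} → (∀ c t → c ∈ S → t ∈ T → c ~ t) → T ⊆ A → ∀ m → m ≤ count S → m < count T →
    Source A (S ∪ T) T m
  biclique-source₁ ad T⊆A m m≤ m< = source 0 (inj₂ refl) λ p p∈ i i≤ →
    let (u , u∈ , r) = biclique-path i _ _ p p∈ ad (≤-trans i≤ m≤) (≤-trans (s≤s i≤) m<) in
    between (T⊆A u u∈) refl (prev r)

  -- One vertex of S is the end of the path, so at most |S| - 1 others are passed: |S| odd lengths.
  biclique-source₂ : ∀ {A S T} → (∀ c t → c ∈ S → t ∈ T → c ~ t) → T ⊆ A → count S ≤ count T → 1 ≤ count T →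
    Source A (S ∪ T) S (pred (count S))
  biclique-source₂ {A} {S} {T} ad T⊆A S≤T 1≤T = source 1 (inj₂ refl) λ p p∈ i i≤ →
    let (t , t∈) = count-pos T 1≤T
        p≡ = suc-pred (count S) {{>-nonZero (one≤count S p p∈)}}
        (u , u∈ , r) = biclique-path i (S - p) T t t∈ (λ c t x y → ad c t (proj₁ x) y)
          (≤-pred (≤-trans (s≤s i≤) (≤-trans (≤-reflexive p≡) (count-del S p))))
          (≤-trans (s≤s i≤) (≤-trans (≤-reflexive p≡) S≤T))
    in between (T⊆A u u∈) refl (prev (cons (inj₁ p∈) (ad p t p∈ t∈) (pmono (inc p p∈) r)))
    where
    inc : ∀ p → p ∈ S → ((S - p) ∪ T) ⊆ ((S ∪ T) - p)
    inc p p∈ v (inj₁ (x , ne)) = inj₁ x , ne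
    inc p p∈ v (inj₂ y) = inj₂ y , λ { refl → ~-irrefl (ad p p p∈ y) }

  record Fan (W A : DSet n) (S : DSet n) : Set where
    field
      S⊆W  : S ⊆ W
      big  : suc (count S) ≤ count (Common A S)
      max  : ∀ v → v ∈ W → ¬ v ∈ S → count (N v ∩ Common A S) ≤ suc (count S)

  -- A vertex with |S| + 2 neighbours in the common neighbourhood can join `S` without violating |S|
  -- < |T|. When no such vertex remains, the bound |S| + 1 is what the contraction can afford.
  grow-fan : ∀ f W A S → count (W ∖ S) ≤ f → S ⊆ W → suc (count S) ≤ count (Common A S) → Σ (DSet n) (Fan W A)
  grow-fan f W A S le S⊆W big with Fin.any? (λ v → mem (W ∖ S) v ×-dec ¬? (count (N v ∩ Common A S) ≤? suc (count S)))
  ... | no ¬v = S , record { S⊆W = S⊆W ; big = big ; max = λ v w ¬s →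
          decidable-stable (count (N v ∩ Common A S) ≤? suc (count S)) (λ h → ¬v (v , (w , ¬s) , h)) }
  grow-fan zero W A S le S⊆W big | yes (v , i , _) = contradiction (≤-trans (one≤count (W ∖ S) v i) le) λ ()
  grow-fan (suc f) W A S le S⊆W big | yes (v , i , h) = grow-fan f W A (S ∪ ⁅ v ⁆)
    (≤-pred (≤-trans (count-⊂ (W ∖ (S ∪ ⁅ v ⁆)) (W ∖ S) v (λ u j → proj₁ j , λ s → proj₂ j (inj₁ s)) i (λ j → proj₂ j (inj₂ refl))) le))
    (λ u → [ S⊆W u , (λ { refl → proj₁ i }) ]′)
    (≤-trans (s≤s (≤-trans (count-∪ (S ∪ ⁅ v ⁆) S ⁅ v ⁆ (λ _ x → x))
        (≤-reflexive (trans (cong (count S +_) (count-sing v)) (+-comm (count S) 1)))))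
      (≤-trans (≰⇒> h) (count-⊆ (N v ∩ Common A S) (Common A (S ∪ ⁅ v ⁆))
        (λ { t (a , t∈ , all) → t∈ , λ { (c , inj₁ s , ¬a) → all (c , s , ¬a) ; (c , inj₂ refl , ¬a) → ¬a a } }))))

  half-≤ : ∀ i s → i * 2 ≤ suc s → i ≤ s
  half-≤ zero s _ = z≤n
  half-≤ (suc i) s (s≤s h) = ≤-trans (s≤s (m≤m*n i 2)) h

  halve : ∀ q → ∃ λ i → q ≡ i * 2 ⊎ q ≡ suc (i * 2)
  halve zero = 0 , inj₁ refl
  halve (suc q) with halve q
  ... | i , inj₁ refl = i , inj₂ refl
  ... | i , inj₂ refl = suc i , inj₁ refl

  -- The only obstruction left for the biclique core: the component of W ∖ (S ∪ Common A S) that contains z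
  -- reaches B only in e.
  record Spoke (W A B : DSet n) (z : V) (S : DSet n) (e : V) : Set where
    field
      e∈B  : e ∈ B
      e∉H  : ¬ e ∈ (S ∪ Common A S)
      foot : ∃ λ t → t ∈ Common A S × t ~ e
      z⇝e  : Reach (W ∖ (S ∪ Common A S)) e z
      only : ∀ b → Reach (W ∖ (S ∪ Common A S)) e b → b ∈ B → b ≡ e
      tip  : (z ~ e × (∀ u → u ∈ W → z ~ u → u ∈ S ⊎ u ≡ e) × 2 ≤ count (N e ∩ Common A S))
           ⊎ (∃ λ q → q ∈ A × ¬ q ∈ (S ∪ Common A S) × ¬ q ∈ B)

  module FanCore {k : ℕ} {W A B : DSet n} {z : V} (N₀ : Node k W A B z) (noTri : Independent A) (noJoin : NoJoin W A)
    (S : DSet n) (fan : Fan W A S) where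

    open Node N₀
    open Fan fan

    T H : DSet n
    T = Common A S
    H = S ∪ T

    σ = count S

    T⊆A : T ⊆ A
    T⊆A v = proj₁

    ad : ∀ c t → c ∈ S → t ∈ T → c ~ t
    ad = common-adj {A} {S}

    H⊆W : H ⊆ W
    H⊆W v = [ S⊆W v , (λ t → A⊆W v (T⊆A v t)) ]′

    t₀ = count-pos T (≤-trans (s≤s z≤n) big)

    one-T : ∀ c v → c ∈ S → v ∈ W → c ~ v → count (N v ∩ T) ≤ 1
    one-T c v c∈ w c~v = count≤1 (N v ∩ T) λ t t′ (a , i) (a′ , i′) → decidable-stable (t Fin.≟ t′) λ ne →
      noJoin t t′ c v (T⊆A t i) (T⊆A t′ i′) ne (S⊆W c c∈) w c~v
        (~-sym (ad c t c∈ i)) (~-sym (ad c t′ c∈ i′)) (~-sym a) (~-sym a′)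

    split-H : ∀ v → count (N v ∩ H) ≤ count (N v ∩ S) + count (N v ∩ T)
    split-H v = count-∪ (N v ∩ H) (N v ∩ S) (N v ∩ T) λ { u (b , inj₁ x) → inj₁ (b , x) ; u (b , inj₂ x) → inj₂ (b , x) }

    T-loss : ∀ v → v ∈ W → ¬ v ∈ S → count (N v ∩ H) ≤ suc σ
    T-loss v w ¬s = ≤-trans (split-H v) (go (Fin.any? (λ c → mem S c ×-dec (c ~? v))))
      where
      go : Dec (v ∈ Nb S) → count (N v ∩ S) + count (N v ∩ T) ≤ suc σ
      go (yes (c , c∈ , a)) = ≤-trans (+-mono-≤ (count-mono-N v S) (one-T c v c∈ w a)) (≤-reflexive (+-comm σ 1))
      go (no ¬nb) rewrite count-no-Nb v S ¬nb = max v w ¬s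

    S-loss : ∀ v → v ∈ A → ¬ v ∈ T → suc (count (N v ∩ S)) ≤ σ
    S-loss v a ¬t with Fin.any? (λ c → mem S c ×-dec ¬? (c ~? v))
    ... | no all = contradiction (a , all) ¬t
    ... | yes (c , c∈ , ¬c~v) = count-⊂ (N v ∩ S) S c (λ _ → proj₂) c∈ (λ i → ¬c~v (~-sym (proj₁ i)))

    no-T : ∀ v → ¬ v ∈ Nb T → count (N v ∩ H) ≤ count (N v ∩ S)
    no-T v ¬nb = ≤-trans (split-H v) (≤-reflexive (trans (cong (count (N v ∩ S) +_) (count-no-Nb v T ¬nb)) (+-identityʳ _)))

    loss₁ : ∀ v → v ∈ W → ¬ v ∈ H → count (N v ∩ H) + ind A v ≤ σ + ind (Nb T) v
    loss₁ v w ¬h with mem (Nb T) v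
    ... | yes (t , t∈ , a) rewrite χ-no (mem A v) (λ i → noTri t v (T⊆A t t∈) i a) =
      ≤-trans (≤-reflexive (+-identityʳ _)) (≤-trans (T-loss v w (λ s → ¬h (inj₁ s))) (≤-reflexive (+-comm 1 σ)))
    ... | no ¬nb with mem A v
    ...   | no _ = +-monoˡ-≤ 0 (≤-trans (no-T v ¬nb) (count-mono-N v S))
    ...   | yes a = ≤-trans (+-monoˡ-≤ 1 (no-T v ¬nb)) (≤-trans (≤-reflexive (+-comm _ 1))
              (≤-trans (S-loss v a (λ t → ¬h (inj₂ t))) (m≤m+n σ 0)))

    -- The critical vertex lies in A and has no neighbour in the core: it loses its edge to x, and
    -- `pred σ` covers this loss only when σ ≥ 2.
    loss₂ : 1 ≤ σ → ∀ v → ¬ v ∈ H → ¬ v ∈ Nb T → 2 ≤ σ ⊎ ¬ v ∈ A → count (N v ∩ H) + ind A v ≤ pred σ + ind (Nb S) v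
    loss₂ 1≤σ v ¬h ¬nb alt with mem (Nb S) v | mem A v
    ... | yes _ | no _ = ≤-trans (≤-reflexive (+-identityʳ _)) (≤-trans (no-T v ¬nb) (≤-trans (count-mono-N v S)
            (≤-reflexive (trans (sym (suc-pred σ {{>-nonZero 1≤σ}})) (+-comm 1 _)))))
    ... | yes _ | yes a = +-monoˡ-≤ 1 (≤-trans (no-T v ¬nb) (≤-pred (≤-trans (S-loss v a (λ t → ¬h (inj₂ t)))
            (≤-reflexive (sym (suc-pred σ {{>-nonZero 1≤σ}}))))))
    ... | no ¬nbS | no _ = ≤-trans (≤-reflexive (+-identityʳ _)) (≤-trans (no-T v ¬nb)
            (≤-trans (≤-reflexive (count-no-Nb v S ¬nbS)) z≤n))
    ... | no ¬nbS | yes a = ≤-trans (+-monoˡ-≤ 1 (≤-trans (no-T v ¬nb) (≤-reflexive (count-no-Nb v S ¬nbS))))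
            (≤-trans (2≤σ alt) (m≤m+n (pred σ) 0))
      where
      2≤σ : 2 ≤ σ ⊎ ¬ v ∈ A → 1 ≤ pred σ
      2≤σ (inj₁ h) = ≤-pred (≤-trans h (≤-reflexive (sym (suc-pred σ {{>-nonZero 1≤σ}}))))
      2≤σ (inj₂ ¬a) = contradiction a ¬a

    src₁ : Source A H T σ
    src₁ = biclique-source₁ ad T⊆A σ ≤-refl big

    src₂ : Source A H S (pred σ)
    src₂ = biclique-source₂ ad T⊆A (≤-trans (n≤1+n _) big) (≤-trans (s≤s z≤n) big)

    module Run (b₀ : V) (b₀∈B : b₀ ∈ B) (b₀∉H : ¬ b₀ ∈ H) where

      b₀≢z : b₀ ≢ z
      b₀≢z refl = z∉B b₀∈B

      open Pendants {k} rt ih z∉A H T S H⊆W (λ _ → swap) (λ _ → inj₂) (λ _ → inj₁) (λ v w _ → dg v w) src₁ src₂ loss₁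
        (proj₁ t₀) (inj₂ (proj₂ t₀)) b₀ (B⊆W b₀ b₀∈B) b₀∉H b₀∈B b₀≢z public

      D∉H : ∀ v → v ∈ D → ¬ v ∈ H
      D∉H v d = proj₂ (D⊆ v d)

      D∈W : ∀ v → v ∈ D → v ∈ W
      D∈W v d = proj₁ (D⊆ v d)

      -- In the contracted graph on the single vertex `e`, the two edges to the roots give degree 2,
      -- enough for the k - σ ≤ 1 paths still required.
      short : ∀ e → e ∈ D → e ∈ B → e ∈ Nb T → e ≢ z → k ≤ suc σ → Adm k W A B
      short e d b nb ne k≤ = recurse ih ⁅ e ⁆ (Nb T) B H ∅ z σ (λ { _ refl → D∈W e d })
        (proj₁ t₀ , H⊆W _ (inj₂ (proj₂ t₀)) , λ { refl → D∉H e d (inj₂ (proj₂ t₀)) })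
        (connected-rooted (λ { _ _ refl refl → here refl }) (e , refl , nb) (e , refl , b)
          (λ { _ _ refl refl x → contradiction refl x })) (e , refl , ne)
        (λ v h → H⊆W v h , λ { refl → D∉H e d h }) (λ _ ()) (λ _ _ ()) (source-family ⁅ e ⁆ src₁)
        (exits 0 (λ v _ b → direct b))
        (λ { v refl _ → ≤-trans (s≤s k≤) (≤-trans (≤-reflexive (cong₂ (λ x y → (x + y) + σ) (sym (χ-yes (mem (Nb T) v) nb)) (sym (χ-yes (mem B v) b))))
              (+-monoˡ-≤ σ (m≤n+m _ (count (N v ∩ ⁅ v ⁆))))) })

      -- A neighbour of `b₀` in S settles the case: even routes to T and odd routes to S together
      -- give consecutive lengths from 1 to σ + 2, and the degree of `b₀` bounds k by σ + 2.
      spoke : Pendant → Adm k W A B ⊎ Spoke W A B z S b₀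
      spoke p with Pendant.only p b₀ b₀∈D b₀∈B
      ... | refl with k ≤? suc σ
      ...   | yes k≤ = inj₁ (short b₀ b₀∈D b₀∈B e∈Nb e≢z k≤)
        where open Pendant p
      ...   | no k≰ with Fin.any? (λ c → mem S c ×-dec (c ~? b₀))
      -- Since k > σ + 1, `b₀` has at least σ + 1 neighbours in the core, all of them in T; and σ ≥
      -- 1 because `z` has its foot in S.
      ...     | no ¬c = inj₂ (record { e∈B = b₀∈B ; e∉H = b₀∉H ; foot = e∈Nb ; z⇝e = z∈D ; only = only
                    ; tip = inj₁ (z~e , z-nbs , ≤-trans (s≤s (one≤count S (proj₁ foot) (proj₁ (proj₂ foot)))) (≤-trans many (≤-trans (split-H b₀)
                        (≤-reflexive (cong (_+ count (N b₀ ∩ T)) (count-no-Nb b₀ S ¬c)))))) })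
        where
        open Pendant p
        indA : ind A b₀ ≡ 0
        indA = χ-no (mem A b₀) (λ i → noTri _ b₀ (T⊆A _ (proj₁ (proj₂ e∈Nb))) i (proj₂ (proj₂ e∈Nb)))
        many : suc σ ≤ count (N b₀ ∩ H)
        many = +-cancelʳ-≤ 2 _ _ (begin
          suc σ + 2 ≡⟨ +-comm (suc σ) 2 ⟩
          suc (suc (suc σ)) ≤⟨ s≤s (≰⇒> k≰) ⟩
          suc k ≤⟨ dg b₀ (B⊆W b₀ b₀∈B) e≢z ⟩
          count (N b₀ ∩ W) + (ind A b₀ + ind B b₀) ≤⟨ +-mono-≤ (count-∪ (N b₀ ∩ W) (N b₀ ∩ H) ⁅ z ⁆
              (λ u (x , w) → [ (λ h → inj₁ (x , h)) , inj₂ ]′ (e-nbs u w x))) (≤-trans (≤-reflexive (cong (_+ ind B b₀) indA)) (χ≤1 (mem B b₀))) ⟩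
          (count (N b₀ ∩ H) + count ⁅ z ⁆) + 1 ≡⟨ cong (λ x → (count (N b₀ ∩ H) + x) + 1) (count-sing z) ⟩
          (count (N b₀ ∩ H) + 1) + 1 ≡⟨ +-assoc (count (N b₀ ∩ H)) 1 1 ⟩
          count (N b₀ ∩ H) + 2 ∎)
          where open ≤-Reasoning
      ...     | yes (c , c∈ , c~b) = inj₁ (adm-mono {W = W} {W} k≤ (λ _ x → x) (λ _ _ x → x) (λ _ _ x → x)
                  (adm 1 (inj₁ refl) λ q q< → subst (Between W A B) (cong suc (sym (*-identityʳ q))) (go q (≤-pred q<) (halve q))))
        where
        open Pendant p
        k≤ : k ≤ suc (suc σ)
        k≤ = ≤-pred (begin
          suc k ≤⟨ dg b₀ (B⊆W b₀ b₀∈B) e≢z ⟩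
          count (N b₀ ∩ W) + (ind A b₀ + ind B b₀) ≤⟨ +-mono-≤ (count-∪ (N b₀ ∩ W) (N b₀ ∩ H) ⁅ z ⁆
              (λ u (x , w) → [ (λ h → inj₁ (x , h)) , inj₂ ]′ (e-nbs u w x)))
              (+-mono-≤ (≤-reflexive (χ-no (mem A b₀) (λ i → noTri _ b₀ (T⊆A _ (proj₁ (proj₂ e∈Nb))) i (proj₂ (proj₂ e∈Nb))))) (χ≤1 (mem B b₀))) ⟩
          (count (N b₀ ∩ H) + count ⁅ z ⁆) + 1 ≤⟨ +-monoˡ-≤ 1 (+-mono-≤ (T-loss b₀ (B⊆W b₀ b₀∈B) (λ s → b₀∉H (inj₁ s))) (≤-reflexive (count-sing z))) ⟩
          (suc σ + 1) + 1 ≡⟨ trans (+-assoc (suc σ) 1 1) (+-comm (suc σ) 2) ⟩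
          suc (suc (suc σ)) ∎)
          where open ≤-Reasoning
        append : ∀ {p l} → Between H A ⁅ p ⁆ l → p ~ b₀ → Between W A B (suc l)
        append {l = l} (between {s = s} u∈ refl r) a = between u∈ b₀∈B (subst (Path W s b₀) (+-comm l 1)
          (cat r a (end {⁅ b₀ ⁆} refl) H⊆W (λ { _ refl → B⊆W b₀ b₀∈B }) (λ { _ h refl → b₀∉H h })))
        σ≡ : suc (pred σ) ≡ σ
        σ≡ = suc-pred σ {{>-nonZero (one≤count S c c∈)}}
        go : ∀ q → q ≤ suc σ → (∃ λ i → q ≡ i * 2 ⊎ q ≡ suc (i * 2)) → Between W A B (suc q)
        go q q≤ (i , inj₁ refl) = append (Source.route src₁ _ (proj₁ (proj₂ e∈Nb)) i (half-≤ i σ q≤)) (proj₂ (proj₂ e∈Nb))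
        go q q≤ (i , inj₂ refl) = append (Source.route src₂ c c∈ i
          (half-≤ i (pred σ) (≤-trans (≤-pred q≤) (≤-reflexive (sym σ≡))))) c~b

    run-general : σ ≢ 1 → ∀ b₀ → b₀ ∈ B → ¬ b₀ ∈ H → Adm k W A B ⊎ Spoke W A B z S b₀
    run-general σ≢1 b₀ b₀∈B b₀∉H = [ inj₁ , spoke ]′ (core-result (attached (inj₂ (proj₂ t₀)) (conn b₀ _ (B⊆W b₀ b₀∈B) (H⊆W _ (inj₂ (proj₂ t₀))))) λ (c , c∈) v w ¬h ¬nb →
        loss₂ (one≤count S c c∈) v ¬h ¬nb (inj₁ (≤∧≢⇒< (one≤count S c c∈) (λ e → σ≢1 (sym e)))))
      where open Run b₀ b₀∈B b₀∉H

  -- Bicliques with |S| = 1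

  module Single {k : ℕ} {W A B : DSet n} {z : V} (N₀ : Node k W A B z) (noTri : Independent A) (noJoin : NoJoin W A)
    (S : DSet n) (fan : Fan W A S) (σ≡1 : count S ≡ 1)
    (b₀ : V) (b₀∈B : b₀ ∈ B) (b₀∉H : ¬ b₀ ∈ (S ∪ Common A S)) where

    open Node N₀
    open FanCore N₀ noTri noJoin S fan
    open Run b₀ b₀∈B b₀∉H

    private
      c : V
      c = proj₁ (count-pos S (≤-reflexive (sym σ≡1)))

      c∈ : c ∈ S
      c∈ = proj₂ (count-pos S (≤-reflexive (sym σ≡1)))

      is-c : ∀ v → v ∈ S → v ≡ c
      is-c v i = decidable-stable (v Fin.≟ c) λ ne →
        contradiction (≤-trans (two≤count S v c i c∈ ne) (≤-reflexive σ≡1)) λ { (s≤s ()) }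

      1≤σ : 1 ≤ σ
      1≤σ = ≤-reflexive (sym σ≡1)

      c∈W : c ∈ W
      c∈W = S⊆W c c∈
        where open Fan fan

      T⊆W : T ⊆ W
      T⊆W v t = A⊆W v (T⊆A v t)

      c~T : ∀ t → t ∈ T → c ~ t
      c~T t = ad c t c∈

    private
      edge-c : (∀ v → v ∈ D → ¬ v ∈ Nb T) → ∀ u v → u ∈ (W ∖ D) → v ∈ D → u ~ v → u ≡ c
      edge-c no₁ u v i d a with D-closed v u d (proj₁ i) (~-sym a)
      ... | inj₁ d′ = contradiction d′ (proj₂ i)
      ... | inj₂ (inj₁ s) = is-c u s
      ... | inj₂ (inj₂ t) = contradiction (u , t , a) (no₁ v d)

    -- When D is attached to H only in c, the vertex c is the only one of W ∖ D that loses neighbours.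
    blob : z ∈ D → (∀ v → v ∈ D → ¬ v ∈ Nb T) → Adm k W A B
    blob z∈D no₁ = go (any∈ (U ∩ B))
      where
      U : DSet n
      U = W ∖ D
      c∈U : c ∈ U
      c∈U = c∈W , λ d → D∉H c d (inj₁ c∈)
      T∈U : ∀ t → t ∈ T → t ∈ U
      T∈U t i = T⊆W t i , λ d → D∉H t d (inj₂ i)
      T≢c : ∀ t → t ∈ T → t ≢ c
      T≢c t i refl = ~-irrefl (c~T t i)
      inside : ∀ {u v} → u ∈ U → v ∈ W → u ~ v → u ≢ c → v ∈ U
      inside {u} {v} i w a ne = w , λ d → ne (edge-c no₁ u v i d a)
      to-c : ∀ v → v ∈ U → Reach U v c
      to-c v i with leave U i (conn v b₀ (proj₁ i) (B⊆W b₀ b₀∈B))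
      ... | inj₁ r = contradiction b₀∈D (proj₂ (tgt r))
      ... | inj₂ (p , q , r , a , w , ¬u) with p Fin.≟ c
      ...   | yes refl = r
      ...   | no ne = contradiction (inside (tgt r) w a ne) ¬u
      go : Dec (∃ λ v → v ∈ (U ∩ B)) → Adm k W A B
      go (no ¬b) = separated c (U - c) c∈W (λ v i → proj₁ (proj₁ i) , proj₂ i) cl
          (λ v i b → ¬b (v , proj₁ i , b)) (λ v i → dg v (proj₁ (proj₁ i)))
          (proj₁ t₀ , (T∈U _ (proj₂ t₀) , T≢c _ (proj₂ t₀)) , λ { refl → D∉H _ z∈D (inj₂ (proj₂ t₀)) })
        where
        cl : Closed W (U - c) c
        cl u v i w a with v Fin.≟ c
        ... | yes e = inj₂ e
        ... | no ne = inj₁ (inside (proj₁ i) w a (proj₂ i) , ne)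
      go (yes (b , b∈U , b∈B)) = recurse ih U A B ∅ ∅ c 0 (λ _ → proj₁) (b₀ , B⊆W b₀ b₀∈B , λ i → proj₂ i b₀∈D)
          (record { toA = λ v i → proj₁ t₀ , T⊆A _ (proj₂ t₀) , rtrans (to-c v i) (step c∈U (c~T _ (proj₂ t₀)) (here (T∈U _ (proj₂ t₀))))
                  ; toB = λ v i → b , b∈B , rtrans (to-c v i) (rsym (to-c b b∈U))
                  ; two = two″ })
          (proj₁ t₀ , T∈U _ (proj₂ t₀) , T≢c _ (proj₂ t₀)) (λ _ ()) (λ _ ()) (λ _ ())
          (family 0 (inj₁ refl) (λ { v _ a zero _ → direct a ; v _ a (suc _) () })) (exits 0 (λ v _ b → direct b))
          (λ v i ne → ≤-trans (dg v (proj₁ i) (λ { refl → proj₂ i z∈D })) (≤-trans (+-monoˡ-≤ _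
             (count-⊆ (N v ∩ W) (N v ∩ U) (λ u (a , w) → a , inside i w a ne))) (≤-reflexive (sym (+-identityʳ _)))))
        where
        two″ : ∀ w v → w ∈ U → v ∈ U → v ≢ w → ∃ λ u → (u ∈ A ⊎ u ∈ B) × Reach (U - w) v u
        two″ w v w∈U i v≢w with two′ rt w v (proj₁ i) v≢w
        ... | u , s , r with leave (U - w) (i , v≢w) r
        ...   | inj₁ r′ = u , s , r′
        ...   | inj₂ (p , q , r′ , a , m , ¬i) with p Fin.≟ c
        ...     | no ne = contradiction (inside (proj₁ (tgt r′)) (proj₁ m) a ne , proj₂ m) ¬i
        -- T has at least two vertices, all adjacent to `c`, so one of them survives the deletion of
        -- `w`.
        ...     | yes refl with count-pos (T - w) (≤-pred (≤-trans (subst (λ x → suc x ≤ count T) σ≡1 (Fan.big fan)) (count-del T w)))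
        ...       | t , t∈ , t≢w = t , inj₁ (T⊆A t t∈) , rtrans r′ (step (tgt r′) (c~T t t∈) (here (T∈U t t∈ , t≢w)))

    private
      H-nbs : ∀ v → v ∈ W → ¬ v ∈ Nb T → ∀ u → u ∈ (N v ∩ H) → u ≡ c
      H-nbs v _ _ u (a , inj₁ s) = is-c u s
      H-nbs v _ no₁ u (a , inj₂ t) = contradiction (u , t , ~-sym a) no₁

    -- As `z` is not in `C`, the exceptional place is free. With x attached directly through A, only
    -- neighbours of `c` lose an edge. A single one of them may be exceptional; if there are two or
    -- more, `c` is added to `C` and is exceptional itself.
    small-piece : ∀ C B′ → Outlet C B′ → C ⊆ D → (∀ u v → u ∈ C → v ∈ C → Reach C u v) → ¬ z ∈ C →
      (∀ v → v ∈ C → ¬ v ∈ Nb T) → (∃ λ v → v ∈ C) →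
      ((∀ v → v ∈ C → ¬ v ∈ Nb S) → Adm k W A B) → Adm k W A B
    small-piece C B′ o C⊆ con z∉C no₁ (v₀ , v₀∈) alt = start (any∈ (C ∩ A)) (any∈ (C ∩ N c))
      where
      open Outlet o
      ≢z : ∀ v → v ∈ C → v ≢ z
      ≢z v i refl = z∉C i
      K⊆W : K ⊆ (W ∖ C)
      K⊆W v i = D∈W v (proj₁ (K⊆ v i)) , proj₂ (K⊆ v i)
      no-entry : ∀ {X} → Family A ∅ X A 0
      no-entry = family 0 (inj₁ refl) (λ { v _ a zero _ → direct a ; v _ a (suc _) () })
      t∉C : ¬ proj₁ t₀ ∈ C
      t∉C i = D∉H _ (C⊆ _ i) (inj₂ (proj₂ t₀))
      tW : proj₁ t₀ ∈ W
      tW = T⊆W _ (proj₂ t₀)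
      deg-C : ∀ v → v ∈ C → ¬ c ~ v → suc k ≤ (count (N v ∩ C) + (ind A v + ind B′ v)) + 0
      deg-C v i ¬a = transfer-degree k _ (ind A v) (ind B v) (count (N v ∩ C)) 0 (ind B′ v) 0 (ind A v) (dgD v (C⊆ v i) (≢z v i))
        (≤-trans (nc v i) (≤-reflexive (cong (λ x → (count (N v ∩ C) + x) + ind B′ v)
          (count-empty (N v ∩ H) (λ u h → ¬a (subst (_~ v) (H-nbs v (D∈W v (C⊆ v i)) (no₁ v i) u h) (~-sym (proj₁ h)))))))) ≤-refl
      bad : (∃ λ w → Σ (DSet n) λ R → Cut C A B′ w R) → Adm k W A B
      bad (w , R , ct) = via-T₂-cut w R (C⊆ w (w∈ ct)) (λ v i → C⊆ v (R⊆ v i) , proj₂ (Cut.Q⊆ ct v i)) clR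
              (λ v i b → noB ct v i (covB v (R⊆ v i) b)) (λ v i → no₁ v (R⊆ v i))
              (proj₁ (some ct) , proj₂ (some ct) , ≢z _ (R⊆ _ (proj₂ (some ct))))
              (λ _ v i _ → loss₂ 1≤σ v (D∉H v (C⊆ v (R⊆ v i))) (no₁ v (R⊆ v i)) (inj₂ (noA ct v i)))
        where
        R⊆ : R ⊆ C
        R⊆ v i = proj₁ (Cut.Q⊆ ct v i)
        clR : Closed D R w
        clR u v i d e = [ (λ j → closed ct u v i j e) , (λ b → contradiction b (noB ct u i)) ]′ (cl u v (R⊆ u i) d e)
      -- A neighbour `u` of `c` outside the core is not in A, otherwise it would belong to T. If it
      -- were alone in `C`, its degree would be at most 2, counting `c` and the second root, whereas
      -- k + 1 ≥ 3.
      other : ∀ u → u ∈ C → c ~ u → Dec (∃ λ v → v ∈ C × v ≢ u) → ∃ λ v → v ∈ C × v ≢ u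
      other u u∈ c~u (yes v) = v
      other u u∈ c~u (no ¬w) = contradiction (≤-trans (s≤s 2≤k) (begin
            suc k ≤⟨ dgD u (C⊆ u u∈) (≢z u u∈) ⟩
            count (N u ∩ W) + (ind A u + ind B u) ≡⟨ cong (λ x → count (N u ∩ W) + (x + ind B u)) (χ-no (mem A u)
               (λ x → D∉H u (C⊆ u u∈) (inj₂ (x , λ { (s , s∈ , ¬s~u) → ¬s~u (subst (_~ u) (sym (is-c s s∈)) c~u) })))) ⟩
            count (N u ∩ W) + ind B u ≤⟨ nc u u∈ ⟩
            (count (N u ∩ C) + count (N u ∩ H)) + ind B′ u ≤⟨ +-mono-≤ (+-mono-≤
               (≤-reflexive (count-empty (N u ∩ C) (λ v (e , i) → ¬w (v , i , λ { refl → ~-irrefl e }))))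
               (≤-trans (count-⊆ (N u ∩ H) ⁅ c ⁆ (H-nbs u (D∈W u (C⊆ u u∈)) (no₁ u u∈))) (≤-reflexive (count-sing c)))) (χ≤1 (mem B′ u)) ⟩
            2 ∎)) λ { (s≤s (s≤s ())) }
          where open ≤-Reasoning
      module _ (a : V) (a∈C : a ∈ C) (a∈A : a ∈ A)
        (t : ∀ w v → w ∈ C → v ∈ C → v ≢ w → ∃ λ x → (x ∈ A ⊎ x ∈ B′) × Reach (C - w) v x) where
        rtC : IsRooted C A B′
        rtC = connected-rooted con (a , a∈C , a∈A) out t
        C⊆W : C ⊆ W
        C⊆W v i = D∈W v (C⊆ v i)
        on-C : ∀ e → (∃ λ v → v ∈ C × v ≢ e) → (∀ v → v ∈ C → v ≢ e → ¬ c ~ v) → Adm k W A B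
        on-C e v₁ h = recurse ih C A B′ ∅ K e 0 C⊆W (proj₁ t₀ , tW , t∉C) rtC v₁ (λ _ ()) K⊆W (λ _ ()) no-entry ex
          (λ v i ne → deg-C v i (h v i ne))
        module _ (u u′ : V) (u∈ : u ∈ C) (c~u : c ~ u) (u′∈ : u′ ∈ C) (c~u′ : c ~ u′) (u′≢u : u′ ≢ u) where
          C₂ B₂ : DSet n
          C₂ = C ∪ ⁅ c ⁆
          -- The exits are available from vertices of `C` only, so `c` must not count as adjacent to
          -- the second root.
          B₂ = B′ ∩ C
          Goal : V → V → Set
          Goal w v = ∃ λ x → (x ∈ A ⊎ x ∈ B₂) × Reach (C₂ - w) v x
          up : ∀ {p q} → Reach C p q → Reach C₂ p q
          up = rmono (λ _ → inj₁)
          to-u : ∀ v → v ∈ C₂ → Reach C₂ v u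
          to-u v (inj₁ i) = up (con v u i u∈)
          to-u v (inj₂ refl) = step (inj₂ refl) c~u (here (inj₁ u∈))
          weaken : ∀ {w v} → (∃ λ x → (x ∈ A ⊎ x ∈ B′) × Reach (C - w) v x) → Goal w v
          weaken (x , s , r) = x , [ inj₁ , (λ b → inj₂ (b , proj₁ (tgt r))) ]′ s , rmono (λ _ (i , ne) → inj₁ i , ne) r
          prepend : ∀ {w v} → c ~ v → c ≢ w → Goal w v → Goal w c
          prepend e ne (x , s , r) = x , s , step (inj₂ refl , ne) e r
          detour : ∀ w → w ∈ C → c ≢ w → Dec (u ≡ w) → Goal w c
          detour w wi ne (no u≢w) = prepend c~u ne (weaken (t w u wi u∈ u≢w))
          detour w wi ne (yes refl) = prepend c~u′ ne (weaken (t w u′ wi u′∈ u′≢u))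
          two″ : ∀ w v → w ∈ C₂ → v ∈ C₂ → v ≢ w → Goal w v
          two″ w v (inj₂ refl) (inj₂ refl) ne = contradiction refl ne
          two″ w v (inj₂ refl) (inj₁ i) ne = a , inj₁ a∈A , rmono (λ x j → inj₁ j , λ { refl → D∉H x (C⊆ x j) (inj₁ c∈) }) (con v a i a∈C)
          two″ w v (inj₁ wi) (inj₁ i) ne = weaken (t w v wi i ne)
          two″ w v (inj₁ wi) (inj₂ refl) ne = detour w wi ne (u Fin.≟ w)
          deg₂ : ∀ v → v ∈ C → suc k ≤ (count (N v ∩ C₂) + (ind A v + ind B₂ v)) + 0
          deg₂ v i = transfer-degree k _ (ind A v) (ind B v) (count (N v ∩ C₂)) 0 (ind B₂ v) 0 (ind A v) (dgD v (C⊆ v i) (≢z v i))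
            (≤-trans (nc v i) (+-mono-≤ (≤-trans (count-⊎ (N v ∩ C₂) (N v ∩ C) (N v ∩ H) (λ x (e , j) → e , inj₁ j)
              (λ x h → proj₁ h , inj₂ (H-nbs v (D∈W v (C⊆ v i)) (no₁ v i) x h)) (λ x (_ , j) (_ , h) → D∉H x (C⊆ x j) h))
              (≤-reflexive (sym (+-identityʳ _)))) (χ-mono (mem B′ v) (mem B₂ v) (λ b → b , i)))) ≤-refl
          rt₂ : IsRooted C₂ A B₂
          rt₂ = record { toA = λ v i → a , a∈A , rtrans (to-u v i) (up (con u a u∈ a∈C))
                       ; toB = λ v i → proj₁ out , (proj₂ (proj₂ out) , proj₁ (proj₂ out)) , rtrans (to-u v i) (up (con u _ u∈ (proj₁ (proj₂ out))))
                       ; two = two″ }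
          on-C₂ : Adm k W A B
          on-C₂ = recurse ih C₂ A B₂ ∅ K c 0 (λ v → [ C⊆W v , (λ { refl → c∈W }) ]′)
                  (proj₁ t₀ , tW , [ t∉C , (λ e → ~⇒≢ (c~T _ (proj₂ t₀)) (sym e)) ]′)
                  rt₂ (u , inj₁ u∈ , λ { refl → ~-irrefl c~u }) (λ _ ())
                  (λ v i → proj₁ (K⊆W v i) , [ proj₂ (K⊆W v i) , (λ { refl → D∉H v (proj₁ (K⊆ v i)) (inj₁ c∈) }) ]′) (λ _ ())
                  no-entry (exits (Exits.len ex) (λ v _ (b , i) → Exits.exit ex v i b))
                  (λ { v (inj₂ refl) ne → contradiction refl ne ; v (inj₁ i) _ → deg₂ v i })
        by-nbs : Dec (∃ λ v → v ∈ (C ∩ N c)) → Adm k W A B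
        by-nbs (no ¬u) = on-C z (v₀ , v₀∈ , ≢z v₀ v₀∈) (λ v i _ x → ¬u (v , i , x))
        by-nbs (yes (u , u∈ , c~u)) = second (Fin.any? (λ v → mem (C ∩ N c) v ×-dec ¬? (v Fin.≟ u)))
          where
          second : Dec (∃ λ v → v ∈ (C ∩ N c) × v ≢ u) → Adm k W A B
          second (no ¬v) = on-C u (other u u∈ c~u (Fin.any? (λ v → mem C v ×-dec ¬? (v Fin.≟ u))))
                                  (λ v i ne x → ¬v (v , (i , x) , ne))
          second (yes (u′ , (u′∈ , c~u′) , u′≢u)) = on-C₂ u u′ u∈ c~u u′∈ c~u′ u′≢u
      start : Dec (∃ λ v → v ∈ (C ∩ A)) → Dec (∃ λ v → v ∈ (C ∩ N c)) → Adm k W A B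
      start (no ¬a) (no ¬u) = alt (λ { v i (s , s∈ , a) → ¬u (v , i , subst (_~ v) (is-c s s∈) a) })
      start (no ¬a) (yes (u , u∈ , a)) = via-T₂ C B′ o C⊆ con (v₀ , v₀∈ , ≢z v₀ v₀∈) no₁ (u , u∈ , c , c∈ , a)
        (λ v i _ → loss₂ 1≤σ v (D∉H v (C⊆ v i)) (no₁ v i) (inj₂ (λ x → ¬a (v , i , x))))
      start (yes (a , a∈C , a∈A)) u? = [ (λ t → by-nbs a a∈C a∈A t u?) , bad ]′ (two? C A B′)

    run-single : Adm k W A B ⊎ Spoke W A B z S b₀
    run-single = by-T (any∈ (D ∩ Nb T))
      where
      module _ (no₁ : ∀ v → v ∈ D → ¬ v ∈ Nb T) where
        by-z : Dec (z ∈ D) → Adm k W A B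
        by-z (yes z∈D) = blob z∈D no₁
        by-z (no z∉D) = small-piece D B outlet-whole (λ _ i → i) D-connected z∉D no₁ (b₀ , b₀∈D)
          (λ no₂ → ⊥-elim (unattached no₂ (attached (inj₂ (proj₂ t₀)) (conn b₀ _ (B⊆W b₀ b₀∈B) (T⊆W _ (proj₂ t₀))))))
          where
          unattached : (∀ v → v ∈ D → ¬ v ∈ Nb S) → (∃ λ a → a ∈ D × (a ∈ Nb T ⊎ a ∈ Nb S)) → ⊥
          unattached no₂ (a , d , s) = [ no₁ a d , no₂ a d ]′ s
      handle : ∀ w Q → Cut D (Nb T) B w Q → ¬ z ∈ Q → Adm k W A B
      handle w Q ct z∉Q = small-piece Q₀ (N w)
          (outlet-cut w Q₀ (w∈ ct) Q₀⊆ cl₀ noB₀ (q , here q∈))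
          (λ v r → proj₁ (Q₀⊆ v r)) (comp-connected Q q) (λ r → z∉Q (tgt r))
          (λ v r → noA ct v (tgt r)) (q , here q∈)
          (λ no₂ → detached w Q₀ (w∈ ct) Q₀⊆ cl₀ noB₀ (λ v r → noA ct v (tgt r)) no₂ (q , here q∈))
        where
        q = proj₁ (some ct)
        q∈ = proj₂ (some ct)
        Q₀ : DSet n
        Q₀ = comp Q q
        Q₀⊆ : Q₀ ⊆ (D - w)
        Q₀⊆ v r = Cut.Q⊆ ct v (tgt r)
        cl₀ : Closed D Q₀ w
        cl₀ = comp-closed D Q w q (λ v i → proj₁ (Cut.Q⊆ ct v i)) (closed ct)
        noB₀ : ∀ v → v ∈ Q₀ → ¬ v ∈ B
        noB₀ v r = noB ct v (tgt r)
      module _ (a₁ : ∃ λ a → a ∈ D × a ∈ Nb T) (L : Leftover) where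
        open Leftover L
        finish : Dec (∃ λ v → v ∈ Q × v ≢ z) → Dec (∃ λ v → v ∈ (Q ∩ A)) → Adm k W A B ⊎ Spoke W A B z S b₀
        finish (no ¬v) _ = spoke (pendant L a₁ (λ v q → decidable-stable (v Fin.≟ z) (λ ne → ¬v (v , q , ne))))
        finish (yes v₀) (no ¬a) = inj₁ (via-T₂-cut e Q (left-D L a₁) inD clos freeB no₁ v₀
          (λ _ v i _ → loss₂ 1≤σ v (D∉H v (proj₁ (inD v i))) (no₁ v i) (inj₂ (λ x → ¬a (v , i , x)))))
        -- With a vertex of A in `Q` the bound for S may fail; the vertex `q` is recorded instead
        -- and used when the two roots are compared.
        finish (yes _) (yes (q , q∈ , qA)) = inj₂ (record
          { e∈B = b₀∈B ; e∉H = b₀∉H ; foot = subst (_∈ Nb T) e≡ (left-Nb L a₁) ; z⇝e = proj₁ (inD z z∈Q)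
          ; only = λ b d b∈ → [ (λ i → contradiction b∈ (freeB b i)) , (λ x → trans x e≡) ]′ (cover b d)
          ; tip = inj₂ (q , qA , D∉H q (proj₁ (inD q q∈)) , freeB q q∈) })
          where
          e≡ : e ≡ b₀
          e≡ = [ (λ i → contradiction b₀∈B (freeB b₀ i)) , sym ]′ (cover b₀ b₀∈D)
      left : (∃ λ a → a ∈ D × a ∈ Nb T) → Leftover → Adm k W A B ⊎ Spoke W A B z S b₀
      left a₁ L = finish a₁ L (Fin.any? (λ v → mem Q v ×-dec ¬? (v Fin.≟ z))) (any∈ (Q ∩ A))
        where open Leftover L
      by-T : Dec (∃ λ a → a ∈ (D ∩ Nb T)) → Adm k W A B ⊎ Spoke W A B z S b₀
      by-T (no ¬t) = inj₁ (by-z (λ v d t → ¬t (v , d , t)) (mem D z))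
      by-T (yes a₁) = [ inj₁ , left a₁ ]′ (via-T₁ handle a₁)

  -- Biclique cores at both roots

  Tail : (W A B : DSet n) (z : V) (S : DSet n) → Set
  Tail W A B z S = B ⊆ (S ∪ Common A S) ⊎ ∃ λ e → Spoke W A B z S e × B ⊆ ((S ∪ Common A S) ∪ ⁅ e ⁆)

  -- Each unresolved vertex of B outside the core shares its component with `z`, and is the only
  -- vertex of B there. Hence at most one exists.
  fan-tail : ∀ {k W A B z} (N₀ : Node k W A B z) → Independent A → NoJoin W A → ∀ S → Fan W A S →
    Adm k W A B ⊎ Tail W A B z S
  fan-tail {k} {W} {A} {B} {z} N₀ noTri noJoin S fan = first (any∈ (B ∖ H))
    where
    open Node N₀
    H = S ∪ Common A S
    run : Dec (count S ≡ 1) → ∀ b → b ∈ B → ¬ b ∈ H → Adm k W A B ⊎ Spoke W A B z S b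
    run (yes eq) b b∈ ¬h = Single.run-single N₀ noTri noJoin S fan eq b b∈ ¬h
    run (no ne) b b∈ ¬h = FanCore.run-general N₀ noTri noJoin S fan ne b b∈ ¬h
    second : ∀ e → Spoke W A B z S e → Dec (∃ λ b → b ∈ (B ∖ H) × b ≢ e) → Adm k W A B ⊎ Tail W A B z S
    second e sp (no ¬b) = inj₂ (inj₂ (e , sp , cov))
      where
      cov : B ⊆ (H ∪ ⁅ e ⁆)
      cov v b = decidable-stable (mem (H ∪ ⁅ e ⁆) v) (λ ¬h → ¬b (v , (b , (λ h → ¬h (inj₁ h))) , λ x → ¬h (inj₂ x)))
    second e sp (yes (b , (b∈ , ¬h) , ne)) = [ inj₁ , clash ]′ (run (count S ≟ 1) b b∈ ¬h)
      where
      clash : Spoke W A B z S b → Adm k W A B ⊎ Tail W A B z S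
      clash sp′ = contradiction (Spoke.only sp b (rtrans (Spoke.z⇝e sp) (rsym (Spoke.z⇝e sp′))) b∈) ne
    first : Dec (∃ λ b → b ∈ (B ∖ H)) → Adm k W A B ⊎ Tail W A B z S
    first (no ¬b) = inj₂ (inj₁ (λ v b → decidable-stable (mem H v) (λ ¬h → ¬b (v , b , ¬h))))
    first (yes (b , b∈ , ¬h)) = [ inj₁ , (λ sp → second b sp (Fin.any? (λ v → mem (B ∖ H) v ×-dec ¬? (v Fin.≟ b)))) ]′
      (run (count S ≟ 1) b b∈ ¬h)

  -- All of `S′` is adjacent to `u` in A, so `S′` misses A, and the second tail leaves at most one
  -- vertex in A but not in B. The foot of the spoke is one, being adjacent to `e` in B; either form
  -- of `tip` gives another.
  meeting-no-spoke : ∀ {W A B z S S′ u} → Independent A → Independent B → u ∈ Common A S → u ∈ Common B S′ →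
    ∀ e → Spoke W A B z S e → Tail W B A z S′ → ⊥
  meeting-no-spoke {W} {A} {B} {z} {S} {S′} {u} iA iB u∈ u∈′ e sp tail = go tail
    where
    open Spoke sp
    not-S′ : ∀ t → t ∈ A → t ∈ S′ → ⊥
    not-S′ t a s = iA t u a (proj₁ u∈) (common-adj {B} {S′} t u s u∈′)
    not-B : ∀ t → t ~ e → t ∈ B → ⊥
    not-B t a b = iB t e b e∈B a
    t = proj₁ foot
    t∈ = proj₁ (proj₂ foot)
    t~e = proj₂ (proj₂ foot)
    go : Tail W B A z S′ → ⊥
    go (inj₁ A⊆) = [ not-S′ t (proj₁ t∈) , (λ i → not-B t t~e (proj₁ i)) ]′ (A⊆ t (proj₁ t∈))
    go (inj₂ (e′ , _ , A⊆)) = final tip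
      where
      only-e′ : ∀ v → v ∈ A → ¬ v ∈ B → v ≡ e′
      only-e′ v a ¬b = [ [ (λ s → ⊥-elim (not-S′ v a s)) , (λ i → contradiction (proj₁ i) ¬b) ]′ , id ]′ (A⊆ v a)
      final : _ ⊎ _ → ⊥
      final (inj₁ (_ , _ , many)) with count-two (N e ∩ Common A S) many
      ... | v , v′ , (a , i) , (a′ , i′) , ne = ne (trans (only-e′ v (proj₁ i) (not-B v (~-sym a)))
                                                      (sym (only-e′ v′ (proj₁ i′) (not-B v′ (~-sym a′)))))
      final (inj₂ (q , qA , ¬h , ¬b)) = ¬h (inj₂ (subst (_∈ Common A S)
        (trans (only-e′ t (proj₁ t∈) (not-B t t~e)) (sym (only-e′ q qA ¬b))) t∈))

  -- `Common A S` is covered by `S′` and possibly one vertex more, so |S| < |S′| or at least |S| ≤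
  -- |S′|. Combined with the same inequalities for exchanged roots, only |S| = |S′| with a spoke on
  -- both sides is conceivable.
  module Disjoint {W A B : DSet n} {z : V} {S S′ : DSet n} (iA : Independent A) (A⊆W : A ⊆ W)
    (big : suc (count S) ≤ count (Common A S)) (big′ : suc (count S′) ≤ count (Common B S′))
    (dis : ∀ u → u ∈ Common A S → u ∈ Common B S′ → ⊥) where

    T⊆S′ : A ⊆ (S′ ∪ Common B S′) → Common A S ⊆ S′
    T⊆S′ A⊆ v i = [ id , (λ j → ⊥-elim (dis v i j)) ]′ (A⊆ v (proj₁ i))

    T⊆S′e : ∀ {e} → A ⊆ ((S′ ∪ Common B S′) ∪ ⁅ e ⁆) → Common A S ⊆ (S′ ∪ ⁅ e ⁆)
    T⊆S′e A⊆ v i = [ [ inj₁ , (λ j → ⊥-elim (dis v i j)) ]′ , inj₂ ]′ (A⊆ v (proj₁ i))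

    count-∪-sing : ∀ (X : DSet n) e → count (X ∪ ⁅ e ⁆) ≤ suc (count X)
    count-∪-sing X e = ≤-trans (count-∪ (X ∪ ⁅ e ⁆) X ⁅ e ⁆ (λ _ x → x))
      (≤-reflexive (trans (cong (count X +_) (count-sing e)) (+-comm (count X) 1)))

    tight : A ⊆ (S′ ∪ Common B S′) → suc (count S) ≤ count S′
    tight A⊆ = ≤-trans big (count-⊆ (Common A S) S′ (T⊆S′ A⊆))

    loose : ∀ {e} → A ⊆ ((S′ ∪ Common B S′) ∪ ⁅ e ⁆) → count S ≤ count S′
    loose {e} A⊆ = ≤-pred (≤-trans big (≤-trans (count-⊆ (Common A S) (S′ ∪ ⁅ e ⁆) (T⊆S′e A⊆)) (count-∪-sing S′ e)))

    -- The vertex `q` also lies in the covering set but not in `Common A S`; this regains the 1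
    -- conceded to the extra vertex.
    blob-tight : ∀ {e q} → A ⊆ ((S′ ∪ Common B S′) ∪ ⁅ e ⁆) → q ∈ A → ¬ q ∈ (S ∪ Common A S) → ¬ q ∈ B → suc (count S) ≤ count S′
    blob-tight {e} {q} A⊆ qA ¬h ¬b = ≤-pred (≤-trans (s≤s big) (≤-trans
      (count-⊂ (Common A S) (S′ ∪ ⁅ e ⁆) q (T⊆S′e A⊆)
        ([ [ inj₁ , (λ j → contradiction (proj₁ j) ¬b) ]′ , inj₂ ]′ (A⊆ q qA)) (λ t → ¬h (inj₂ t)))
      (count-∪-sing S′ e)))

    -- As a neighbour of `z`, `e′` is in S or equals `e`. In both cases it is adjacent to the foot,
    -- although both lie in the independent set A.
    twins : ∀ {e e′} → Spoke W A B z S e → (∀ u → u ∈ W → z ~ u → u ∈ S ⊎ u ≡ e) → z ~ e′ → e′ ∈ A → ⊥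
    twins {e} {e′} sp nbs a e′A with nbs e′ (A⊆W e′ e′A) a | Spoke.foot sp
    ... | inj₂ refl | t , t∈ , t~e = iA t e′ (proj₁ t∈) e′A t~e
    ... | inj₁ s | t , t∈ , _ = iA e′ t e′A (proj₁ t∈) (common-adj {A} {S} e′ t s t∈)

  disjoint-fans : ∀ {W A B z S S′} → Independent A → Independent B → A ⊆ W → B ⊆ W →
    suc (count S) ≤ count (Common A S) → suc (count S′) ≤ count (Common B S′) →
    (∀ u → u ∈ Common A S → u ∈ Common B S′ → ⊥) → Tail W A B z S → Tail W B A z S′ → ⊥
  disjoint-fans {W} {A} {B} {z} {S} {S′} iA iB A⊆W B⊆W big big′ dis = go
    where
    module X = Disjoint {W} {A} {B} {z} {S} {S′} iA A⊆W big big′ dis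
    module Y = Disjoint {W} {B} {A} {z} {S′} {S} iB B⊆W big′ big (λ u i j → dis u j i)
    clash : ∀ {p q} → suc p ≤ q → q ≤ p → ⊥
    clash h h′ = <-irrefl refl (≤-trans h h′)
    go : Tail W A B z S → Tail W B A z S′ → ⊥
    go (inj₁ B⊆) (inj₁ A⊆) = clash (X.tight A⊆) (<⇒≤ (Y.tight B⊆))
    go (inj₁ B⊆) (inj₂ (_ , _ , A⊆)) = clash (Y.tight B⊆) (X.loose A⊆)
    go (inj₂ (_ , _ , B⊆)) (inj₁ A⊆) = clash (X.tight A⊆) (Y.loose B⊆)
    go (inj₂ (e , sp , B⊆)) (inj₂ (e′ , sp′ , A⊆)) = ends (Spoke.tip sp) (Spoke.tip sp′)
      where
      ends : _ ⊎ _ → _ ⊎ _ → ⊥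
      ends (inj₂ (_ , qA , ¬h , ¬b)) _ = clash (X.blob-tight A⊆ qA ¬h ¬b) (Y.loose B⊆)
      ends (inj₁ _) (inj₂ (_ , qB , ¬h , ¬a)) = clash (Y.blob-tight B⊆ qB ¬h ¬a) (X.loose A⊆)
      ends (inj₁ (_ , nbs , _)) (inj₁ (z~e′ , _)) = X.twins sp nbs z~e′ (Spoke.e∈B sp′)

  fan-core : ∀ {k W A B z} → Node k W A B z → Independent A → Independent B → NoJoin W A → NoJoin W B →
    Adm k W A B ⊎ Σ (DSet n) λ S → Fan W A S × A ⊆ Common A S × A ⊆ B × B ⊆ A
  fan-core {k} {W} {A} {B} {z} N₀ iA iB jA jB = go (fan-tail N₀ iA jA S fan) (fan-tail (node-swap N₀) iB jB S′ fan′)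
    where
    open Node N₀
    start : ∀ A → 2 ≤ count A → suc (count {n} ∅) ≤ count (Common A ∅)
    start A 2≤A = ≤-trans (s≤s (≤-reflexive (count-empty {n} ∅ (λ _ ()))))
      (≤-trans (≤-trans (s≤s z≤n) 2≤A) (count-⊆ A (Common A ∅) (λ v i → i , λ ())))
    g = grow-fan _ W A ∅ ≤-refl (λ _ ()) (start A 2≤A)
    g′ = grow-fan _ W B ∅ ≤-refl (λ _ ()) (start B 2≤B)
    S = proj₁ g
    S′ = proj₁ g′
    fan : Fan W A S
    fan = proj₂ g
    fan′ : Fan W B S′
    fan′ = proj₂ g′
    Result : Set₁
    Result = Adm k W A B ⊎ Σ (DSet n) λ S → Fan W A S × A ⊆ Common A S × A ⊆ B × B ⊆ A
    -- The shared vertex lies in A and B and is adjacent to all of `S` and `S′`, so `S` misses B and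
    -- `S′` misses A. Without spokes this forces A = B.
    meet : ∀ u → u ∈ Common A S → u ∈ Common B S′ → Tail W A B z S → Tail W B A z S′ → Result
    meet u i j t@(inj₂ (e , sp , _)) t′ = ⊥-elim (meeting-no-spoke iA iB i j e sp t′)
    meet u i j t@(inj₁ _) t′@(inj₂ (e , sp , _)) = ⊥-elim (meeting-no-spoke iB iA j i e sp t)
    meet u i j (inj₁ B⊆H) (inj₁ A⊆H) = inj₂ (S , fan , (λ v a → B⊆T v (A⊆B v a)) , A⊆B , (λ v b → proj₁ (B⊆T v b)))
      where
      B⊆T : B ⊆ Common A S
      B⊆T v b = [ (λ s → ⊥-elim (iB v u b (proj₁ j) (common-adj {A} {S} v u s i))) , id ]′ (B⊆H v b)
      A⊆B : A ⊆ B
      A⊆B v a = [ (λ s → ⊥-elim (iA v u a (proj₁ i) (common-adj {B} {S′} v u s j))) , proj₁ ]′ (A⊆H v a)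
    tails : Tail W A B z S → Tail W B A z S′ → Dec (∃ λ u → u ∈ (Common A S ∩ Common B S′)) → Result
    tails t t′ (no ¬u) = ⊥-elim (disjoint-fans {z = z} iA iB A⊆W B⊆W (Fan.big fan) (Fan.big fan′) (λ u i j → ¬u (u , i , j)) t t′)
    tails t t′ (yes (u , i , j)) = meet u i j t t′
    go : Adm k W A B ⊎ Tail W A B z S → Adm k W B A ⊎ Tail W B A z S′ → Result
    go (inj₁ d) _ = inj₁ d
    go (inj₂ _) (inj₁ d) = inj₁ (adm-rev d)
    go (inj₂ t) (inj₂ t′) = tails t t′ (any∈ (Common A S ∩ Common B S′))

  -- Roots with a common neighbourhood

  -- If x and y have the same neighbourhood A, delete some b ∈ A and replace y by b.
  module Remove {k : ℕ} {W A B : DSet n} {z : V} (N₀ : Node k W A B z) (A⊆B : A ⊆ B) (B⊆A : B ⊆ A)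
    (b : V) (b∈A : b ∈ A) where

    open Node N₀

    b∈W : b ∈ W
    b∈W = A⊆W b b∈A

    deg-off : ∀ v → v ∈ W → ¬ v ∈ A → v ≢ z → suc k ≤ count (N v ∩ W)
    deg-off v w ¬a ne = ≤-trans (dg v w ne) (≤-reflexive (trans
      (cong₂ (λ x y → count (N v ∩ W) + (x + y)) (χ-no (mem A v) ¬a) (χ-no (mem B v) (λ i → ¬a (B⊆A v i)))) (+-identityʳ _)))

    to-A : ∀ {u} → (u ∈ A ⊎ u ∈ B) → u ∈ A
    to-A = [ id , B⊆A _ ]′

    rt′ : IsRooted (W - b) (A - b) (N b)
    rt′ = record { toA = toA′ ; toB = toB′ ; two = two″ }
      where
      toA′ : ∀ v → v ∈ (W - b) → ∃ λ a → a ∈ (A - b) × Reach (W - b) v a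
      toA′ v (w , ne) with two′ rt b v w ne
      ... | u , s , r = u , (to-A s , proj₂ (tgt r)) , r
      toB′ : ∀ v → v ∈ (W - b) → ∃ λ a → a ∈ N b × Reach (W - b) v a
      toB′ v i = touch W (W - b) b (λ u v i w a → edge v w) i (λ j → proj₂ j refl) (conn v b (proj₁ i) b∈W)
        where
        edge : ∀ v → v ∈ W → v ∈ (W - b) ⊎ v ≡ b
        edge v w with v Fin.≟ b
        ... | yes e = inj₂ e
        ... | no ne = inj₁ (w , ne)
      two″ : ∀ w v → w ∈ (W - b) → v ∈ (W - b) → v ≢ w → ∃ λ u → (u ∈ (A - b) ⊎ u ∈ N b) × Reach ((W - b) - w) v u
      two″ w v _ i ne with two′ rt w v (proj₁ i) ne
      ... | u , s , r with leave ((W - b) - w) (i , ne) r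
      ...   | inj₁ r′ = u , inj₁ (to-A s , proj₂ (proj₁ (tgt r′))) , r′
      ...   | inj₂ (p , q , r′ , a , m , ¬i) with q Fin.≟ b
      ...     | yes refl = p , inj₂ (~-sym a) , r′
      ...     | no q≢b = contradiction ((proj₁ m , q≢b) , proj₂ m) ¬i

    ih′ : IH (count (W - b))
    ih′ k W′ A′ B′ z h = ih k W′ A′ B′ z (≤-trans h (<⇒≤ (count-del-< W b b∈W)))

    dg′ : ∀ v → v ∈ (W - b) → ¬ v ∈ A → v ≢ z → DegreeAt k (W - b) (A - b) (N b) v
    dg′ v i ¬a ne = ≤-trans (deg-off v (proj₁ i) ¬a ne) (≤-trans (count-∪ (N v ∩ W) (N v ∩ (W - b)) (N v ∩ ⁅ b ⁆) spl)
        (+-monoʳ-≤ (count (N v ∩ (W - b))) (≤-trans (count-N-sing v b) (m≤n+m _ _))))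
      where
      spl : ∀ u → u ∈ (N v ∩ W) → u ∈ (N v ∩ (W - b)) ⊎ u ∈ (N v ∩ ⁅ b ⁆)
      spl u (a , w) with u Fin.≟ b
      ... | yes e = inj₂ (a , e)
      ... | no ¬e = inj₁ (a , w , ¬e)

    restore : Adm k (W - b) (A - b) (N b) → Adm k W A B
    restore (adm l s f) = adm (suc l) s λ i i< → ext (f i i<)
      where
      ext : ∀ {m} → Between (W - b) (A - b) (N b) m → Between W A B (suc m)
      ext {m} (between {s = u} u∈ a p) = between (proj₁ u∈) (A⊆B b b∈A) (subst (Path W u b) (+-comm m 1)
        (cat p (~-sym a) (end {⁅ b ⁆} refl) (λ _ → proj₁) (λ { _ refl → b∈W }) (λ _ i e → proj₂ i e)))

  module _ {k : ℕ} {W A B : DSet n} {z : V} (N₀ : Node k W A B z) (A⊆B : A ⊆ B) (B⊆A : B ⊆ A) where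

    open Node N₀

    deg-on : ∀ v → v ∈ W → v ≢ z → suc k ≤ count (N v ∩ W) + 2
    deg-on v w ne = ≤-trans (dg v w ne) (+-monoʳ-≤ _ (+-mono-≤ (χ≤1 (mem A v)) (χ≤1 (mem B v))))

    A≢z : ∀ v → v ∈ A → v ≢ z
    A≢z v a refl = z∉A a

    -- Requiring only that A - b be a clique covers both a clique A and an independent pair.
    clique-minus : (∀ b → b ∈ A → Clique (A - b)) → ∀ b b₀ → b ∈ A → b₀ ∈ W → ¬ b₀ ∈ A → b₀ ≢ z → b ~ b₀ → Adm k W A B
    clique-minus cl b b₀ b∈A b₀∈W b₀∉A b₀≢z b~b₀ = restore ([ id , (λ p → ⊥-elim (proj₁ (proj₂ (Pendant.foot p)))) ]′
        (core-result att (λ ())))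
      where
      open Remove N₀ A⊆B B⊆A b b∈A
      H = A - b
      h₀ : ∃ λ v → v ∈ H
      h₀ = count-pos H (≤-pred (≤-trans 2≤A (count-del A b)))
      m = pred (count H)
      m≡ : suc m ≡ count H
      m≡ = suc-pred (count H) {{>-nonZero (one≤count H (proj₁ h₀) (proj₂ h₀))}}
      off : ∀ v → v ∈ (W - b) → ¬ v ∈ H → ¬ v ∈ A
      off v i ¬h a = ¬h (a , proj₂ i)
      loss : ∀ v → v ∈ (W - b) → ¬ v ∈ H → count (N v ∩ H) + ind H v ≤ m + ind (Nb H) v
      loss v w ¬h rewrite χ-no (mem H v) ¬h with mem (Nb H) v
      ... | yes _ = ≤-trans (≤-reflexive (+-identityʳ _)) (≤-trans (count-mono-N v H) (≤-reflexive (trans (sym m≡) (+-comm 1 m))))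
      ... | no ¬nb = ≤-trans (≤-reflexive (trans (+-identityʳ _) (count-no-Nb v H ¬nb))) z≤n
      b₀∈ : b₀ ∈ (W - b)
      b₀∈ = b₀∈W , λ { refl → b₀∉A b∈A }
      open Pendants {k} rt′ ih′ (λ i → z∉A (proj₁ i)) H H ∅ (λ v i → A⊆W v (proj₁ i) , proj₂ i) (λ _ → inj₁) (λ _ i → i) (λ _ ())
        (λ v i ¬h → dg′ v i (off v i ¬h)) (clique-source (cl b b∈A) (λ _ i → i) (λ _ i → i) m (≤-reflexive m≡)) empty-source loss
        (proj₁ h₀) (proj₂ h₀) b₀ b₀∈ (λ h → b₀∉A (proj₁ h)) b~b₀ b₀≢z
      att : ∃ λ a → a ∈ D × (a ∈ Nb H ⊎ a ∈ Nb ∅)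
      att with toA rt′ b₀ b₀∈
      ... | a , a∈ , r = attached a∈ r

    -- Deleting `z` does not separate `v` from A; the first step of a walk into A is the required
    -- edge.
    outside : ∀ v → v ∈ W → ¬ v ∈ A → v ≢ z → ∃ λ b → ∃ λ b₀ → b ∈ A × b₀ ∈ W × ¬ b₀ ∈ A × b₀ ≢ z × b ~ b₀
    outside v w ¬a ne with two′ rt z v w ne
    ... | u , s , r with leave ((W ∖ A) - z) ((w , ¬a) , ne) r
    ...   | inj₁ r′ = contradiction ([ id , B⊆A u ]′ s) (proj₂ (proj₁ (tgt r′)))
    ...   | inj₂ (p , q , r′ , a , m , ¬i) = q , p , decidable-stable (mem A q) (λ ¬q → ¬i ((proj₁ m , ¬q) , proj₂ m)) ,
            proj₁ (proj₁ (tgt r′)) , proj₂ (proj₁ (tgt r′)) , proj₂ (tgt r′) , ~-sym a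

    twin-clique : Clique A → Adm k W A B
    twin-clique cl with Fin.any? (λ v → mem (W ∖ A) v ×-dec ¬? (v Fin.≟ z))
    ... | yes (v , (w , ¬a) , ne) with outside v w ¬a ne
    ...   | b , b₀ , b∈ , w₀ , ¬a₀ , ne₀ , a₀ =
            clique-minus (λ b _ u v i j → cl u v (proj₁ i) (proj₁ j)) b b₀ b∈ w₀ ¬a₀ ne₀ a₀
    twin-clique cl | no only-z with k ≤? count A
    ... | yes k≤ = adm 0 (inj₁ refl) λ i i< →
          let (p , p∈) = count-pos A (≤-trans (s≤s z≤n) 2≤A)
              (u , u∈ , r) = clique-path i A p p∈ cl (≤-trans i< k≤)
          in subst (Between W A B) (sym (*-identityʳ i)) (between p∈ (A⊆B u u∈) (pmono A⊆W r))
    -- Now W is A and possibly `z`, with k > |A|. Degrees force every vertex of A to be adjacent to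
    -- `z` and k ≤ |A| + 1; the missing length |A| is realised by a path through `z` and all of A.
    ... | no k≰ = adm 0 (inj₁ refl) λ i i< → subst (Between W A B) (sym (*-identityʳ i)) (go i (≤-pred (≤-trans i< k≤)))
      where
      t = count A
      in-A-or-z : ∀ v → v ∈ W → ¬ v ∈ A → v ≡ z
      in-A-or-z v w ¬a = decidable-stable (v Fin.≟ z) (λ ne → only-z (v , (w , ¬a) , ne))
      t≡ : suc (suc (t ∸ 2)) ≡ t
      t≡ = m+[n∸m]≡n 2≤A
      to-z : ∀ b → b ∈ A → b ~ z × z ∈ W
      to-z b b∈ with mem (N b ∩ W) z
      ... | yes i = i
      ... | no ¬i = contradiction (+-cancelʳ-≤ 2 _ _ (≤-trans (≤-trans (≤-reflexive (+-comm (suc (count (A - b))) 2))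
            (s≤s (s≤s (count-del-< A b b∈)))) (≤-trans (s≤s (≰⇒> k≰)) (≤-trans (deg-on b (A⊆W b b∈) (A≢z b b∈)) (+-monoˡ-≤ 2
              (count-⊆ (N b ∩ W) (A - b) sub)))))) (<-irrefl refl)
        where
        sub : (N b ∩ W) ⊆ (A - b)
        sub u (a , w) with mem A u
        ... | yes i = i , λ e → ~⇒≢ a (sym e)
        ... | no ¬u with in-A-or-z u w ¬u
        ...   | refl = contradiction (a , w) ¬i
      p = proj₁ (count-pos A (≤-trans (s≤s z≤n) 2≤A))
      p∈ = proj₂ (count-pos A (≤-trans (s≤s z≤n) 2≤A))
      k≤ : k ≤ suc t
      k≤ = ≤-pred (≤-trans (deg-on p (A⊆W p p∈) (A≢z p p∈)) (≤-trans (+-monoˡ-≤ 2 (≤-trans (count-∪ (N p ∩ W) (A - p) ⁅ z ⁆ spl)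
             (≤-reflexive (cong (count (A - p) +_) (count-sing z))))) (≤-trans (≤-reflexive (trans (+-assoc (count (A - p)) 1 2) (+-comm (count (A - p)) 3)))
               (s≤s (s≤s (count-del-< A p p∈))))))
        where
        spl : ∀ u → u ∈ (N p ∩ W) → u ∈ (A - p) ⊎ u ∈ ⁅ z ⁆
        spl u (a , w) with mem A u
        ... | yes i = inj₁ (i , λ e → ~⇒≢ a (sym e))
        ... | no ¬u = inj₂ (in-A-or-z u w ¬u)
      long : Between W A B t
      long = let le = ≤-pred (≤-trans (≤-reflexive t≡) (count-del A p))
                 (q , q∈) = count-pos (A - p) (≤-trans (s≤s z≤n) le)
                 (u , u∈ , r) = clique-path (t ∸ 2) (A - p) q q∈ (λ u v i j → cl u v (proj₁ i) (proj₁ j)) le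
                 (p~z , z∈W) = to-z p p∈
             in between p∈ (A⊆B u (proj₁ u∈)) (subst (Path W p u) t≡ (cons (A⊆W p p∈) p~z
                  (cons (z∈W , (λ e → A≢z p p∈ (sym e))) (~-sym (proj₁ (to-z q (proj₁ q∈))))
                    (pmono (λ v i → (A⊆W v (proj₁ i) , proj₂ i) , A≢z v (proj₁ i)) r))))
      go : ∀ i → i ≤ t → Between W A B i
      go i i≤ with suc i ≤? t
      ... | yes i< = let (u , u∈ , r) = clique-path i A p p∈ cl i< in between p∈ (A⊆B u u∈) (pmono A⊆W r)
      ... | no ¬i rewrite ≤-antisym i≤ (≤-pred (≰⇒> ¬i)) = long

    twin-pair : Independent A → ∀ a a′ → a ∈ A → a′ ∈ A → a ≢ a′ → A ⊆ pair a a′ → Adm k W A B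
    twin-pair iA a a′ a∈ a′∈ a≢a′ A⊆ with Fin.any? (λ v → mem (W ∖ A) v ×-dec ¬? (v Fin.≟ z))
    ... | yes (v , (w , ¬a) , ne) with outside v w ¬a ne
    ...   | b , b₀ , b∈ , w₀ , ¬a₀ , ne₀ , a₀ = clique-minus cl b b₀ b∈ w₀ ¬a₀ ne₀ a₀
      where
      cl : ∀ b → b ∈ A → Clique (A - b)
      cl b b∈ u v i j ne with A⊆ b b∈ | A⊆ u (proj₁ i) | A⊆ v (proj₁ j)
      ... | _ | inj₁ refl | inj₁ refl = contradiction refl ne
      ... | _ | inj₂ refl | inj₂ refl = contradiction refl ne
      ... | inj₁ refl | inj₁ refl | inj₂ refl = contradiction refl (proj₂ i)
      ... | inj₁ refl | inj₂ refl | inj₁ refl = contradiction refl (proj₂ j)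
      ... | inj₂ refl | inj₁ refl | inj₂ refl = contradiction refl (proj₂ j)
      ... | inj₂ refl | inj₂ refl | inj₁ refl = contradiction refl (proj₂ i)
    twin-pair iA a a′ a∈ a′∈ a≢a′ A⊆ | no only-z = adm 0 (inj₂ refl) λ i i< → go i (≤-trans i< k≤2)
      where
      sub : ∀ b → b ∈ A → (N b ∩ W) ⊆ ⁅ z ⁆
      sub b b∈ u (e , w) = decidable-stable (u Fin.≟ z) (λ ne → only-z (u , (w , iA′) , ne))
        where
        iA′ : ¬ u ∈ A
        iA′ i = iA b u b∈ i e
      k≤2 : k ≤ 2
      k≤2 = ≤-pred (≤-trans (deg-on a (A⊆W a a∈) (A≢z a a∈)) (+-monoˡ-≤ 2 (≤-trans (count-⊆ (N a ∩ W) ⁅ z ⁆ (sub a a∈)) (≤-reflexive (count-sing z)))))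
      to-z : ∀ b → b ∈ A → b ~ z × z ∈ W
      to-z b b∈ with count-pos (N b ∩ W) (+-cancelʳ-≤ 2 _ _ (≤-trans (s≤s 2≤k) (deg-on b (A⊆W b b∈) (A≢z b b∈))))
      ... | u , i with sub b b∈ u i
      ...   | refl = i
      go : ∀ i → i < 2 → Between W A B (i * 2)
      go zero _ = between a∈ (A⊆B a a∈) (end (A⊆W a a∈))
      go (suc zero) _ = between a∈ (A⊆B a′ a′∈) (cons (A⊆W a a∈) (proj₁ (to-z a a∈))
        (cons (proj₂ (to-z a a∈) , (λ e → A≢z a a∈ (sym e))) (~-sym (proj₁ (to-z a′ a′∈)))
          (end ((A⊆W a′ a′∈ , λ e → a≢a′ (sym e)) , A≢z a′ a′∈))))
      go (suc (suc _)) (s≤s (s≤s ()))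

  module _ {k : ℕ} {W A B : DSet n} {z : V} (N₀ : Node k W A B z) (A⊆B : A ⊆ B) (B⊆A : B ⊆ A)
    (iA : Independent A) (noJoin : NoJoin W A) (S : DSet n) (fan : Fan W A S) (A⊆T : A ⊆ Common A S) where

    open Node N₀
    open Fan fan

    private
      σ = count S

      ad : ∀ c t → c ∈ S → t ∈ A → c ~ t
      ad c t s a = common-adj {A} {S} c t s (A⊆T t a)

      big-A : suc σ ≤ count A
      big-A = ≤-trans big (count-⊆ (Common A S) A (λ _ → proj₁))

      S∉A : ∀ v → v ∈ S → ¬ v ∈ A
      S∉A v s a = ~-irrefl (ad v v s a)

      one-A : ∀ c v → c ∈ S → v ∈ W → c ~ v → count (N v ∩ A) ≤ 1
      one-A c v c∈ w c~v = count≤1 (N v ∩ A) λ t t′ (a , i) (a′ , i′) → decidable-stable (t Fin.≟ t′) λ ne →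
        noJoin t t′ c v i i′ ne (S⊆W c c∈) w c~v (~-sym (ad c t c∈ i)) (~-sym (ad c t′ c∈ i′)) (~-sym a) (~-sym a′)

    -- The core after deletion of `b` is (S″, A - b), where `S″` may be smaller than `S`. Hence
    -- `cap` stands in for maximality, while `cap′` and the bound on k exclude pendants.
    module Reduced (S″ : DSet n) (S″⊆S : S″ ⊆ S) (b b₀ : V) (b∈A : b ∈ A) (b₀∈W : b₀ ∈ W) (b₀∉S : ¬ b₀ ∈ S″)
      (b₀∉A : ¬ b₀ ∈ A) (b₀≢z : b₀ ≢ z) (b~b₀ : b ~ b₀) (size : count S″ < count (A - b))
      (cap : ∀ v → v ∈ W → ¬ v ∈ S″ → ¬ v ∈ A → count (N v ∩ (A - b)) ≤ suc (count S″))
      (cap′ : ∀ v → v ∈ W → ¬ v ∈ S″ → ¬ v ∈ A → b ~ v → count (N v ∩ (A - b)) ≤ σ)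
      (k≥ : suc (suc σ) ≤ k) where

      open Remove N₀ A⊆B B⊆A b b∈A

      private
        T H : DSet n
        T = A - b
        H = S″ ∪ T

        m = count S″

        ad″ : ∀ c t → c ∈ S″ → t ∈ T → c ~ t
        ad″ c t s i = ad c t (S″⊆S c s) (proj₁ i)

        H⊆W : H ⊆ (W - b)
        H⊆W v (inj₁ s) = S⊆W v (S″⊆S v s) , λ { refl → S∉A v (S″⊆S v s) b∈A }
        H⊆W v (inj₂ i) = A⊆W v (proj₁ i) , proj₂ i

        off : ∀ v → v ∈ (W - b) → ¬ v ∈ H → ¬ v ∈ A
        off v i ¬h a = ¬h (inj₂ (a , proj₂ i))

        split-H : ∀ v → count (N v ∩ H) ≤ count (N v ∩ S″) + count (N v ∩ T)
        split-H v = count-∪ (N v ∩ H) (N v ∩ S″) (N v ∩ T) λ { u (e , inj₁ x) → inj₁ (e , x) ; u (e , inj₂ x) → inj₂ (e , x) }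

        T-count : ∀ v → v ∈ W → ¬ v ∈ S″ → ¬ v ∈ A → Dec (v ∈ Nb S″) → count (N v ∩ S″) + count (N v ∩ T) ≤ suc m
        T-count v w ¬s ¬a (yes (c , c∈ , e)) = ≤-trans (+-mono-≤ (count-mono-N v S″)
          (≤-trans (count-⊆ (N v ∩ T) (N v ∩ A) (λ u (x , i) → x , proj₁ i)) (one-A c v (S″⊆S c c∈) w e))) (≤-reflexive (+-comm m 1))
        T-count v w ¬s ¬a (no ¬nb) = ≤-trans (≤-reflexive (cong (_+ count (N v ∩ T)) (count-no-Nb v S″ ¬nb))) (cap v w ¬s ¬a)

        drop-ind : ∀ v {x} → ¬ v ∈ T → x + ind T v ≡ x
        drop-ind v ¬t = trans (cong (_ +_) (χ-no (mem T v) ¬t)) (+-identityʳ _)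

        loss₁ : ∀ v → v ∈ (W - b) → ¬ v ∈ H → count (N v ∩ H) + ind T v ≤ m + ind (Nb T) v
        loss₁ v w ¬h = ≤-trans (≤-reflexive (drop-ind v (λ t → ¬h (inj₂ t)))) (≤-trans (split-H v) (go (mem (Nb T) v)))
          where
          go : (d : Dec (v ∈ Nb T)) → count (N v ∩ S″) + count (N v ∩ T) ≤ m + χ d
          go (yes _) = ≤-trans (T-count v (proj₁ w) (λ s → ¬h (inj₁ s)) (off v w ¬h) (mem (Nb S″) v)) (≤-reflexive (+-comm 1 m))
          go (no ¬nb) = +-mono-≤ (count-mono-N v S″) (≤-reflexive (count-no-Nb v T ¬nb))

        loss₂ : (∃ λ c → c ∈ S″) → ∀ v → v ∈ (W - b) → ¬ v ∈ H → ¬ v ∈ Nb T → count (N v ∩ H) + ind T v ≤ pred m + ind (Nb S″) v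
        loss₂ (c , c∈) v w ¬h ¬nb = ≤-trans (≤-reflexive (drop-ind v (λ t → ¬h (inj₂ t)))) (≤-trans (split-H v)
            (≤-trans (≤-reflexive (trans (cong (count (N v ∩ S″) +_) (count-no-Nb v T ¬nb)) (+-identityʳ _))) (go (mem (Nb S″) v))))
          where
          go : (d : Dec (v ∈ Nb S″)) → count (N v ∩ S″) ≤ pred m + χ d
          go (no ¬s) = ≤-trans (≤-reflexive (count-no-Nb v S″ ¬s)) z≤n
          go (yes _) = ≤-trans (count-mono-N v S″)
            (≤-reflexive (trans (sym (suc-pred m {{>-nonZero (one≤count S″ c c∈)}})) (+-comm 1 _)))

        t₀ : ∃ λ v → v ∈ T
        t₀ = count-pos T (≤-trans (s≤s z≤n) size)

        b₀∉H : ¬ b₀ ∈ H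
        b₀∉H = [ b₀∉S , (λ i → b₀∉A (proj₁ i)) ]′

        b₀∈ : b₀ ∈ (W - b)
        b₀∈ = b₀∈W , λ { refl → b₀∉A b∈A }

        module C = Pendants {k} {W - b} {T} {N b} {z} rt′ ih′ (λ i → z∉A (proj₁ i)) H T S″ H⊆W (λ _ → swap) (λ _ → inj₂) (λ _ → inj₁)
          (λ v i ¬h → dg′ v i (off v i ¬h))
          (biclique-source₁ ad″ (λ _ i → i) m ≤-refl size)
          (biclique-source₂ ad″ (λ _ i → i) (<⇒≤ size) (≤-trans (s≤s z≤n) size)) loss₁
          (proj₁ t₀) (inj₂ (proj₂ t₀)) b₀ b₀∈ b₀∉H b~b₀ b₀≢z

        att : (∃ λ a → a ∈ T × Reach (W - b) b₀ a) → ∃ λ a → a ∈ C.D × (a ∈ Nb T ⊎ a ∈ Nb S″)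
        att (a , a∈ , r) = C.attached (inj₂ a∈) r

        -- A pendant `e` is adjacent to `b` and to another vertex of A, hence to nothing in `S″`.
        -- Its neighbours are then `z`, `b` and at most σ vertices of A - b: fewer than k + 1.
        no-pendant : C.Pendant → ⊥
        no-pendant p = go (mem (Nb S″) e)
          where
          open C.Pendant p
          e∈W = proj₁ (C.D⊆ e e∈D)
          e∉H = proj₂ (C.D⊆ e e∈D)
          e∉A = off e e∈W e∉H
          two-nbs : (t : ∃ λ t → t ∈ T × t ~ e) → 2 ≤ count (N e ∩ A)
          two-nbs (t , t∈ , a) = two≤count (N e ∩ A) b t (~-sym e∈B , b∈A) (~-sym a , proj₁ t∈) (λ x → proj₂ t∈ (sym x))
          many : suc k ≤ count (N e ∩ H) + 2
          many = ≤-trans (deg-off e (proj₁ e∈W) e∉A e≢z) (≤-trans (count-∪ (N e ∩ W) (N e ∩ H) (pair z b) spl)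
                   (+-monoʳ-≤ _ (count-pair (pair z b) z b (λ _ x → x))))
            where
            spl : ∀ u → u ∈ (N e ∩ W) → u ∈ (N e ∩ H) ⊎ u ∈ pair z b
            spl u (a , w) = by-b (u Fin.≟ b)
              where
              by-b : Dec (u ≡ b) → u ∈ (N e ∩ H) ⊎ u ∈ pair z b
              by-b (yes x) = inj₂ (inj₂ x)
              by-b (no ne) = [ (λ h → inj₁ (a , h)) , (λ x → inj₂ (inj₁ x)) ]′ (e-nbs u (w , ne) a)
          go : Dec (e ∈ Nb S″) → ⊥
          go (yes (c , c∈ , a)) = contradiction (≤-trans (two-nbs e∈Nb) (one-A c e (S″⊆S c c∈) (proj₁ e∈W) a)) λ { (s≤s ()) }
          go (no ¬nb) = <-irrefl refl (≤-trans (s≤s k≥) (≤-trans many (≤-trans (+-monoˡ-≤ 2 (≤-trans (split-H e)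
            (≤-trans (≤-reflexive (cong (_+ count (N e ∩ T)) (count-no-Nb e S″ ¬nb)))
              (cap′ e (proj₁ e∈W) (λ s → e∉H (inj₁ s)) e∉A e∈B)))) (≤-reflexive (+-comm σ 2)))))

      reduced : Adm k W A B
      reduced = restore ([ id , (λ p → ⊥-elim (no-pendant p)) ]′ (C.core-result (att (toA rt′ b₀ b₀∈)) loss₂))

    twin-fan : Adm k W A B
    twin-fan = by-k (k ≤? suc σ)
      where
      pair-case : ¬ suc (suc σ) ≤ count A → σ ≤ 1 → Adm k W A B
      pair-case ¬t σ≤1 =
        let (a , a′ , i , i′ , ne) = count-two A 2≤A in
        twin-pair N₀ A⊆B B⊆A iA a a′ i i′ ne λ v v∈ → decidable-stable (mem (pair a a′) v) λ ¬p →
          contradiction (≤-trans (s≤s (two≤count (A - v) a a′ (i , λ e → ¬p (inj₁ (sym e))) (i′ , λ e → ¬p (inj₂ (sym e))) ne))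
            (≤-trans (count-del-< A v v∈) (≤-trans (≤-pred (≰⇒> ¬t)) (s≤s σ≤1)))) λ { (s≤s (s≤s ())) }
      tight-case : suc (suc σ) ≤ k → ¬ suc (suc σ) ≤ count A → 2 ≤ σ → Adm k W A B
      -- Here |A| = σ + 1, and deleting `b` would leave S as large as A - b. A vertex `c` of S other
      -- than `z` is given up and takes the role of `b₀`.
      tight-case k≥ ¬t 2≤σ =
        let (c , c∈ , c≢z) = count-pos (S - z) (≤-pred (≤-trans 2≤σ (count-del S z)))
            (b , b∈) = count-pos A (≤-trans (s≤s z≤n) 2≤A)
            cap : ∀ v → count (N v ∩ (A - b)) ≤ σ
            cap v = ≤-trans (count-mono-N v (A - b)) (≤-pred (≤-trans (count-del-< A b b∈) (≤-pred (≰⇒> ¬t))))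
        in Reduced.reduced (S - c) (λ _ → proj₁) b c b∈ (S⊆W c c∈) (λ i → proj₂ i refl) (S∉A c c∈) c≢z (~-sym (ad c b c∈ b∈))
             (≤-trans (count-del-< S c c∈) (≤-pred (≤-trans big-A (count-del A b))))
             (λ v _ _ _ → ≤-trans (cap v) (count-del S c)) (λ v _ _ _ _ → cap v) k≥
      wide-case : suc (suc σ) ≤ k → suc (suc σ) ≤ count A →
        Dec (∃ λ b → b ∈ A × ∃ λ e → (e ∈ W × ¬ e ∈ S) × ¬ e ∈ A × e ≢ z × b ~ e) → Adm k W A B
      wide-case k≥ t≥ (yes (b , b∈ , e , (e∈W , e∉S) , e∉A , e≢z , b~e)) =
        Reduced.reduced S (λ _ i → i) b e b∈ e∈W e∉S e∉A e≢z b~e (≤-pred (≤-trans t≥ (count-del A b)))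
          (λ v w ¬s _ → ≤-trans (count-⊆ (N v ∩ (A - b)) (N v ∩ Common A S) (λ u (x , i) → x , A⊆T u (proj₁ i))) (max v w ¬s))
          (λ v w ¬s _ b~v → ≤-pred (≤-trans (count-⊂ (N v ∩ (A - b)) (N v ∩ Common A S) b (λ u (x , i) → x , A⊆T u (proj₁ i))
             (~-sym b~v , A⊆T b b∈) (λ i → proj₂ (proj₂ i) refl)) (max v w ¬s))) k≥
      -- Vertices of A then have all their neighbours in S and `z`. As k ≥ σ + 2, all of them need
      -- `z`, which has at least σ + 2 neighbours in A and would have joined S.
      wide-case k≥ t≥ (no none) = ⊥-elim (<-irrefl refl (≤-trans t≥ (≤-trans
          (count-⊆ A (N z ∩ Common A S) (λ b i → ~-sym (proj₁ (to-z b i)) , A⊆T b i))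
          (let (b , i) = count-pos A (≤-trans (s≤s z≤n) 2≤A) in max z (proj₁ (proj₂ (to-z b i))) (proj₂ (proj₂ (to-z b i)))))))
        where
        to-z : ∀ b → b ∈ A → b ~ z × z ∈ W × ¬ z ∈ S
        to-z b i = decidable-stable ((b ~? z) ×-dec (mem W z ×-dec ¬? (mem S z))) λ ¬z →
          <-irrefl refl (≤-trans (s≤s k≥) (≤-trans (deg-on N₀ A⊆B B⊆A b (A⊆W b i) (A≢z N₀ A⊆B B⊆A b i))
            (≤-trans (+-monoˡ-≤ 2 (count-⊆ (N b ∩ W) S λ u (a , w) → decidable-stable (mem S u) λ ¬s →
               none (b , i , u , (w , ¬s) , (λ u∈ → iA b u i u∈ a) , (λ { refl → ¬z (a , w , ¬s) }) , a)))
              (≤-reflexive (+-comm σ 2)))))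
      by-k : Dec (k ≤ suc σ) → Adm k W A B
      by-k (yes k≤) = adm 0 (inj₂ refl) λ i i< →
        let (p , p∈) = count-pos A (≤-trans (s≤s z≤n) 2≤A) in
        widen p p∈ (Source.route (biclique-source₁ ad (λ _ a → a) σ ≤-refl big-A) p p∈ i (≤-pred (≤-trans i< k≤)))
        where
        widen : ∀ p → p ∈ A → ∀ {l} → Between (S ∪ A) A ⁅ p ⁆ l → Between W A B l
        widen p p∈ (between u∈ refl r) = between u∈ (A⊆B p p∈) (pmono (λ v → [ S⊆W v , A⊆W v ]′) r)
      by-k (no k≰) = by-A (suc (suc σ) ≤? count A) (2 ≤? σ)
        where
        by-A : Dec (suc (suc σ) ≤ count A) → Dec (2 ≤ σ) → Adm k W A B
        by-A (yes t≥) _ = wide-case (≰⇒> k≰) t≥ (Fin.any? (λ b → mem A b ×-dec Fin.any? (λ e →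
          mem (W ∖ S) e ×-dec (¬? (mem A e) ×-dec (¬? (e Fin.≟ z) ×-dec (b ~? e))))))
        by-A (no ¬t) (yes 2≤σ) = tight-case (≰⇒> k≰) ¬t 2≤σ
        by-A (no ¬t) (no ¬σ) = pair-case ¬t (≤-pred (≰⇒> ¬σ))

  -- The induction

  -- When B lies in a clique of A, it is itself a clique on at least two vertices, so the same core
  -- works from the other root. If that fails too, the two inclusions give A = B.
  clique-node : ∀ {k W A B z} → Node k W A B z → ∀ a a′ → a ∈ A → a′ ∈ A → a ~ a′ → Adm k W A B
  clique-node {k} {W} {A} {B} {z} N₀ a a′ a∈ a′∈ a~ = first (triangle-core N₀ a a′ a∈ a′∈ a~)
    where
    first : Adm k W A B ⊎ Σ (DSet n) (λ T → Clique T × T ⊆ A × B ⊆ T) → Adm k W A B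
    first (inj₁ d) = d
    first (inj₂ (T , cl , T⊆A , B⊆T)) =
      let (b , b′ , i , i′ , ne) = count-two B (Node.2≤B N₀)
      in second (triangle-core (node-swap N₀) b b′ i i′ (cl b b′ (B⊆T b i) (B⊆T b′ i′) ne))
      where
      second : Adm k W B A ⊎ Σ (DSet n) (λ T → Clique T × T ⊆ B × A ⊆ T) → Adm k W A B
      second (inj₁ d) = adm-rev d
      second (inj₂ (T′ , cl′ , T′⊆B , A⊆T′)) = twin-clique N₀ (λ v a → T′⊆B v (A⊆T′ v a)) (λ v b → T⊆A v (B⊆T v b))
        (λ u v i j → cl′ u v (A⊆T′ u i) (A⊆T′ v j))

  Joint : DSet n → DSet n → Set
  Joint W A = ∃ λ a → ∃ λ a′ → ∃ λ c → ∃ λ v → a ∈ A × a′ ∈ A × a ≢ a′ × c ∈ W × v ∈ W × c ~ v × a ~ c × a′ ~ c × a ~ v × a′ ~ v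

  joint? : ∀ W A → Dec (Joint W A)
  joint? W A = Fin.any? λ a → Fin.any? λ a′ → Fin.any? λ c → Fin.any? λ v →
    mem A a ×-dec (mem A a′ ×-dec (¬? (a Fin.≟ a′) ×-dec (mem W c ×-dec (mem W v ×-dec
    ((c ~? v) ×-dec ((a ~? c) ×-dec ((a′ ~? c) ×-dec ((a ~? v) ×-dec (a′ ~? v)))))))))

  joint-node : ∀ {k W A B z} → Node k W A B z → Independent A → Independent B → Joint W A → Adm k W A B
  joint-node {k} {W} {A} {B} N₀ iA iB (a , a′ , c , v , a∈ , a′∈ , ne , c∈ , v∈ , e , p , q , r , s) =
    first (join-core N₀ iA iB a a′ c v a∈ a′∈ ne c∈ v∈ e p q r s)
    where
    first : Adm k W A B ⊎ (B ⊆ pair a a′ × pair a a′ ⊆ B) → Adm k W A B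
    first (inj₁ d) = d
    first (inj₂ (B⊆ , ⊆B)) = second (join-core (node-swap N₀) iB iA a a′ c v (⊆B a (inj₁ refl)) (⊆B a′ (inj₂ refl)) ne c∈ v∈ e p q r s)
      where
      second : Adm k W B A ⊎ (A ⊆ pair a a′ × pair a a′ ⊆ A) → Adm k W A B
      second (inj₁ d) = adm-rev d
      second (inj₂ (A⊆ , ⊆A)) = twin-pair N₀ (λ v i → ⊆B v (A⊆ v i)) (λ v i → ⊆A v (B⊆ v i)) iA a a′ a∈ a′∈ ne A⊆

  Triangle : DSet n → Set
  Triangle A = ∃ λ a → ∃ λ a′ → a ∈ A × a′ ∈ A × a ~ a′

  triangle? : ∀ A → Dec (Triangle A)
  triangle? A = Fin.any? λ a → Fin.any? λ a′ → mem A a ×-dec (mem A a′ ×-dec (a ~? a′))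

  node-adm : ∀ {k W A B z} → Node k W A B z → Adm k W A B
  node-adm {k} {W} {A} {B} {z} N₀ = go (triangle? A) (triangle? B) (joint? W A) (joint? W B)
    where
    fans : Independent A → NoJoin W A → Adm k W A B ⊎ Σ (DSet n) (λ S → Fan W A S × A ⊆ Common A S × A ⊆ B × B ⊆ A) → Adm k W A B
    fans iA jA (inj₁ d) = d
    fans iA jA (inj₂ (S , fan , A⊆T , A⊆B , B⊆A)) = twin-fan N₀ A⊆B B⊆A iA jA S fan A⊆T
    go : Dec (Triangle A) → Dec (Triangle B) → Dec (Joint W A) → Dec (Joint W B) → Adm k W A B
    go (yes (a , a′ , i , i′ , e)) _ _ _ = clique-node N₀ a a′ i i′ e
    go (no _) (yes (b , b′ , i , i′ , e)) _ _ = adm-rev (clique-node (node-swap N₀) b b′ i i′ e)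
    go (no ¬tA) (no ¬tB) ja jb = go′ ja jb
      where
      iA : Independent A
      iA u v i j e = ¬tA (u , v , i , j , e)
      iB : Independent B
      iB u v i j e = ¬tB (u , v , i , j , e)
      go′ : Dec (Joint W A) → Dec (Joint W B) → Adm k W A B
      go′ (yes j) _ = joint-node N₀ iA iB j
      go′ (no _) (yes j) = adm-rev (joint-node (node-swap N₀) iB iA j)
      go′ (no ¬jA) (no ¬jB) = fans iA jA (fan-core N₀ iA iB jA jB)
        where
        jA : NoJoin W A
        jA a a′ c v p q r s t u w x y z = ¬jA (a , a′ , c , v , p , q , r , s , t , u , w , x , y , z)
        jB : NoJoin W B
        jB a a′ c v p q r s t u w x y z = ¬jB (a , a′ , c , v , p , q , r , s , t , u , w , x , y , z)

  -- Reduction to connected W with z outside A and B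

  record Setting (k : ℕ) (W A B : DSet n) (z : V) : Set₁ where
    field
      rt   : IsRooted W A B
      conn : ∀ u v → u ∈ W → v ∈ W → Reach W u v
      dg   : ∀ v → v ∈ W → v ≢ z → DegreeAt k W A B v
      ih   : IH (count W)
      A⊆W  : A ⊆ W
      B⊆W  : B ⊆ W
      2≤k  : 2 ≤ k
      vert : ∃ λ v → v ∈ W × v ≢ z

  degree-swap : ∀ k W A B v → DegreeAt k W A B v → DegreeAt k W B A v
  degree-swap k W A B v = subst (λ x → suc k ≤ count (N v ∩ W) + x) (+-comm (ind A v) (ind B v))

  setting-swap : ∀ {k W A B z} → Setting k W A B z → Setting k W B A z
  setting-swap {k} {W} {A} {B} s = record
    { rt = rooted-swap rt ; conn = conn ; dg = λ v i ne → degree-swap k W A B v (dg v i ne)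
    ; ih = ih ; A⊆W = B⊆W ; B⊆W = A⊆W ; 2≤k = 2≤k ; vert = vert }
    where open Setting s

  module _ {k : ℕ} {W A B : DSet n} {z : V} (st : Setting k W A B z) where

    open Setting st

    cut-off : ∀ w Q → w ∈ W → Q ⊆ (W - w) → Closed W Q w → (∀ v → v ∈ Q → ¬ v ∈ A) → (∃ λ v → v ∈ Q × v ≢ z) → Adm k W A B
    cut-off w Q w∈ Q⊆ cl noA v₀ = adm-rev (Separated.separated {k} {W} {B} {A} {z} (rooted-swap rt) ih w Q w∈ Q⊆ cl noA
      (λ v i ne → degree-swap k W A B v (dg v (proj₁ (Q⊆ v i)) ne)) v₀)

    -- If `b` is the only neighbour of y in W, it can serve as second root in place of y.
    all-but : ∀ b → b ∈ W → (∀ v → v ∈ B → v ≡ b) → (∃ λ v → v ∈ (W - b) × v ≢ z) → Adm k W A B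
    all-but b b∈ only v₀ = Separated.separated {k} {W} {A} {B} {z} rt ih b (W - b) b∈ (λ _ i → i)
      (λ u v _ w _ → del v w (v Fin.≟ b)) (λ v i j → proj₂ i (only v j)) (λ v i → dg v (proj₁ i)) v₀
      where
      del : ∀ v → v ∈ W → Dec (v ≡ b) → v ∈ (W - b) ⊎ v ≡ b
      del v w (yes e) = inj₂ e
      del v w (no ne) = inj₁ (w , ne)

    many-B : ¬ z ∈ A → ¬ z ∈ B → Adm k W A B ⊎ 2 ≤ count B
    many-B z∉A z∉B = go (2 ≤? count B)
      where
      go : Dec (2 ≤ count B) → Adm k W A B ⊎ 2 ≤ count B
      go (yes h) = inj₂ h
      go (no ¬h) = inj₁ (single (toB rt (proj₁ vert) (proj₁ (proj₂ vert))))
        where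
        single : (∃ λ b → b ∈ B × Reach W (proj₁ vert) b) → Adm k W A B
        single (b , b∈ , _) = more (Fin.any? (λ v → mem (W - b) v ×-dec ¬? (v Fin.≟ z)))
          where
          b≢z : b ≢ z
          b≢z refl = z∉B b∈
          only : ∀ v → v ∈ B → v ≡ b
          only v i = decidable-stable (v Fin.≟ b) (λ ne → ¬h (two≤count B v b i b∈ ne))
          more : Dec (∃ λ v → v ∈ (W - b) × v ≢ z) → Adm k W A B
          more (yes v₀) = all-but b (B⊆W b b∈) only v₀
          -- W - b contains at most `z`. If `z` were adjacent to `b`, deleting `b` would cut `z` off
          -- from both roots; so `b` has degree at most 2.
          more (no ¬v) = contradiction (≤-trans (s≤s 2≤k) (≤-trans (dg b (B⊆W b b∈) b≢z) (≤-trans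
              (≤-reflexive (cong (_+ (ind A b + ind B b)) (count-empty (N b ∩ W) isolated))) (+-mono-≤ (χ≤1 (mem A b)) (χ≤1 (mem B b))))))
              λ { (s≤s (s≤s ())) }
            where
            is-z : ∀ v → v ∈ (W - b) → v ≡ z
            is-z v i = decidable-stable (v Fin.≟ z) (λ ne → ¬v (v , i , ne))
            isolated : ∀ u → ¬ u ∈ (N b ∩ W)
            isolated u (a , w) with is-z u (w , λ e → ~⇒≢ a (sym e))
            ... | refl with two′ rt b u w (λ e → b≢z (sym e))
            ...   | x , s , r with is-z x (tgt r)
            ...     | refl = [ z∉A , z∉B ]′ s

  node-of : ∀ {k W A B z} → Setting k W A B z → ¬ z ∈ A → ¬ z ∈ B → Adm k W A B
  node-of {k} {W} {A} {B} {z} st z∉A z∉B = go (many-B st z∉A z∉B) (many-B (setting-swap st) z∉B z∉A)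
    where
    open Setting st
    go : Adm k W A B ⊎ 2 ≤ count B → Adm k W B A ⊎ 2 ≤ count A → Adm k W A B
    go (inj₁ d) _ = d
    go (inj₂ _) (inj₁ d) = adm-rev d
    go (inj₂ 2≤B) (inj₂ 2≤A) = node-adm (record { rt = rt ; conn = conn ; dg = dg ; ih = ih ; z∉A = z∉A ; z∉B = z∉B
      ; A⊆W = A⊆W ; B⊆W = B⊆W ; 2≤k = 2≤k ; 2≤A = 2≤A ; 2≤B = 2≤B })

  -- The edge zy is irrelevant for the degree condition and may be deleted.
  module DropEdge {k : ℕ} {W A B : DSet n} {z : V} (st : Setting k W A B z) (z∈B : z ∈ B) where

    open Setting st

    B₀ : DSet n
    B₀ = B - z

    ind-B₀ : ∀ v → v ≢ z → ind B v ≤ ind B₀ v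
    ind-B₀ v ne = χ-mono (mem B v) (mem B₀ v) (λ i → i , ne)

    dg₀ : ∀ v → v ∈ W → v ≢ z → DegreeAt k W A B₀ v
    dg₀ v w ne = ≤-trans (dg v w ne) (+-monoʳ-≤ (count (N v ∩ W)) (+-monoʳ-≤ (ind A v) (ind-B₀ v ne)))

    weaken : Adm k W A B₀ → Adm k W A B
    weaken = adm-mono ≤-refl (λ _ x → x) (λ _ _ x → x) (λ _ _ → proj₁)

    z∈W : z ∈ W
    z∈W = B⊆W z z∈B

    -- The remaining case: z has w as its only neighbour in W, and w becomes the exceptional vertex of W - z.
    module Leaf (b : V) (b∈ : b ∈ B₀) (w : V) (w∈ : w ∈ W) (w≢z : w ≢ z) (z∉A : ¬ z ∈ A)
      (nb : ∀ v → v ∈ W → z ~ v → v ≡ w) where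

      nbr : ∀ {p q} → q ∈ W → ¬ q ∈ (W - z) → p ∈ W → p ~ q → p ≡ w
      nbr {p} {q} m ¬i p∈ a = nb p p∈ (~-sym (subst (p ~_) (decidable-stable (q Fin.≟ z) (λ ne → ¬i (m , ne))) a))

      to-w : ∀ v → v ∈ (W - z) → Reach (W - z) v w
      to-w v i with leave (W - z) i (conn v w (proj₁ i) w∈)
      ... | inj₁ r = r
      ... | inj₂ (p , q , r , a , m , ¬j) with nbr m ¬j (proj₁ (tgt r)) a
      ...   | refl = r

      conn₀ : ∀ u v → u ∈ (W - z) → v ∈ (W - z) → Reach (W - z) u v
      conn₀ u v i j = rtrans (to-w u i) (rsym (to-w v j))

      a₀ : ∃ λ a → a ∈ (W - z) × a ∈ A
      a₀ with toA rt z z∈W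
      ... | a , a∈ , r = a , (tgt r , λ { refl → z∉A a∈ }) , a∈

      z~w : z ~ w
      z~w with conn z w z∈W w∈
      ... | here _ = contradiction refl w≢z
      ... | step _ a r with nb _ (src r) a
      ...   | refl = a

      -- Here W consists of `w` and `z`. The second path ends at `z` and so uses the edge from `z`
      -- to y.
      tiny : (∀ v → v ∈ (W - z) → v ≡ w) → Adm k W A B
      tiny only = adm 0 (inj₁ refl) λ i i< → go i (≤-trans i< k≤2)
        where
        w∈A : w ∈ A
        w∈A = subst (_∈ A) (only _ (proj₁ (proj₂ a₀))) (proj₂ (proj₂ a₀))
        w∈B : w ∈ B
        w∈B = subst (_∈ B) (only b (B⊆W b (proj₁ b∈) , proj₂ b∈)) (proj₁ b∈)
        k≤2 : k ≤ 2
        k≤2 = ≤-pred (≤-trans (dg w w∈ w≢z) (+-mono-≤ {v = 2} (≤-trans (count-⊆ (N w ∩ W) ⁅ z ⁆ (λ u (a , m) →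
          decidable-stable (u Fin.≟ z) (λ ne → ~⇒≢ a (sym (only u (m , ne)))))) (≤-reflexive (count-sing z)))
          (+-mono-≤ (χ≤1 (mem A w)) (χ≤1 (mem B w)))))
        go : ∀ i → i < 2 → Between W A B (i * 1)
        go zero _ = between w∈A w∈B (end w∈)
        go (suc zero) _ = between w∈A z∈B (cons w∈ (~-sym z~w) (end (z∈W , λ e → w≢z (sym e))))
        go (suc (suc _)) (s≤s (s≤s ()))

      split : (∀ x v → x ∈ (W - z) → v ∈ (W - z) → v ≢ x → ∃ λ u → (u ∈ A ⊎ u ∈ B₀) × Reach ((W - z) - x) v u)
            ⊎ (∃ λ x → Σ (DSet n) λ R → Cut (W - z) A B₀ x R) → Adm k W A B
      split (inj₁ t) = rest (Fin.any? (λ v → mem (W - z) v ×-dec ¬? (v Fin.≟ w)))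
        where
        rest : Dec (∃ λ v → v ∈ (W - z) × v ≢ w) → Adm k W A B
        rest (no ¬v) = tiny (λ v i → decidable-stable (v Fin.≟ w) (λ ne → ¬v (v , i , ne)))
        rest (yes v₀) = adm-mono ≤-refl (λ _ → proj₁) (λ _ _ x → x) (λ _ _ → proj₁)
          (ih k (W - z) A B₀ w (count-del-< W z z∈W) (record
            { rooted = connected-rooted conn₀ a₀ (b , (B⊆W b (proj₁ b∈) , proj₂ b∈) , b∈) t
            ; large = λ v i ne → ≤-trans (dg₀ v (proj₁ i) (proj₂ i)) (+-monoˡ-≤ (ind A v + ind B₀ v) (count-⊆ (N v ∩ W) (N v ∩ (W - z))
                (λ u (a , m) → a , m , λ { refl → ne (nb v (proj₁ i) (~-sym a)) })))
            ; vertex = v₀ }))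
      split (inj₂ (x , R , c)) = by-w (mem R w)
        where
        x∈ = Cut.w∈ c
        R⊆ : R ⊆ ((W - z) - x)
        R⊆ = Cut.Q⊆ c
        by-w : Dec (w ∈ R) → Adm k W A B
        -- In W the vertex `z` hangs from `w`, so `R` together with `z` is cut off by `x` from the
        -- rest and misses A.
        by-w (yes w∈R) = cut-off st x (R ∪ ⁅ z ⁆) (proj₁ x∈)
          (λ { v (inj₁ i) → proj₁ (proj₁ (R⊆ v i)) , proj₂ (R⊆ v i) ; v (inj₂ refl) → z∈W , λ e → proj₂ x∈ (sym e) })
          cl (λ { v (inj₁ i) → noA c v i ; v (inj₂ refl) → z∉A }) (w , inj₁ w∈R , w≢z)
          where
          cl : Closed W (R ∪ ⁅ z ⁆) x
          cl u v (inj₂ refl) m a = inj₁ (inj₁ (subst (_∈ R) (sym (nb v m a)) w∈R))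
          cl u v (inj₁ i) m a = in-R (v Fin.≟ z)
            where
            in-R : Dec (v ≡ z) → v ∈ (R ∪ ⁅ z ⁆) ⊎ v ≡ x
            in-R (yes e) = inj₁ (inj₂ e)
            in-R (no ne) = [ (λ j → inj₁ (inj₁ j)) , inj₂ ]′ (closed c u v i (m , ne) a)
        -- Without `w`, `R` has no edge to `z` and would already be cut off from both roots in W,
        -- against `rt`.
        by-w (no w∉R) = ⊥-elim (absurd (some c))
          where
          cl : ∀ p q → p ∈ R → q ∈ (W - x) → p ~ q → q ∈ R
          cl p q i m a = in-R (q Fin.≟ z)
            where
            in-R : Dec (q ≡ z) → q ∈ R
            in-R (yes refl) = contradiction (subst (_∈ R) (nb p (proj₁ (proj₁ (R⊆ p i))) (~-sym a)) i) w∉R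
            in-R (no ne) = [ id , (λ e → contradiction e (proj₂ m)) ]′ (closed c p q i (proj₁ m , ne) a)
          absurd : (∃ λ q → q ∈ R) → ⊥
          absurd (q , i) = stop (two′ rt x q (proj₁ (proj₁ (R⊆ q i))) (proj₂ (R⊆ q i)))
            where
            stop : (∃ λ u → (u ∈ A ⊎ u ∈ B) × Reach (W - x) q u) → ⊥
            stop (u , s , r) = let j = tgt (stay R cl i r) in
              [ noA c u j , (λ b → noB c u j (b , proj₂ (proj₁ (R⊆ u j)))) ]′ s

    -- Dropping the edge may destroy 2-connectedness. The part cut off misses A, so if it has a
    -- vertex other than `z` it is solved with y and the cutvertex as roots; otherwise it is `z`
    -- alone.
    drop : (Setting k W A B₀ z → ¬ z ∈ B₀ → Adm k W A B₀) → Adm k W A B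
    drop next = by-B (any∈ B₀)
      where
      by-B : Dec (∃ λ b → b ∈ B₀) → Adm k W A B
      by-B (no ¬b) = all-but st z z∈W (λ v i → decidable-stable (v Fin.≟ z) (λ ne → ¬b (v , i , ne)))
        (proj₁ vert , (proj₁ (proj₂ vert) , proj₂ (proj₂ vert)) , proj₂ (proj₂ vert))
      by-B (yes (b , b∈)) = by-two (two? W A B₀)
        where
        by-two : (∀ w v → w ∈ W → v ∈ W → v ≢ w → ∃ λ u → (u ∈ A ⊎ u ∈ B₀) × Reach (W - w) v u)
               ⊎ (∃ λ w → Σ (DSet n) λ Q → Cut W A B₀ w Q) → Adm k W A B
        by-two (inj₁ t) = weaken (next (record
          { rt = record { toA = toA rt ; toB = λ v i → b , b∈ , conn v b i (B⊆W b (proj₁ b∈)) ; two = t }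
          ; conn = conn ; dg = dg₀ ; ih = ih ; A⊆W = A⊆W ; B⊆W = λ v i → B⊆W v (proj₁ i) ; 2≤k = 2≤k ; vert = vert })
          (λ i → proj₂ i refl))
        by-two (inj₂ (w , Q , c)) = by-Q (Fin.any? (λ v → mem Q v ×-dec ¬? (v Fin.≟ z)))
          where
          by-Q : Dec (∃ λ v → v ∈ Q × v ≢ z) → Adm k W A B
          by-Q (yes v₀) = cut-off st w Q (w∈ c) (Cut.Q⊆ c) (closed c) (noA c) v₀
          by-Q (no ¬v) = Leaf.split b b∈ w (w∈ c) (λ e → proj₂ (Cut.Q⊆ c z z∈Q) (sym e)) (noA c z z∈Q)
              (λ v m a → [ (λ i → contradiction (subst (z ~_) (is-z v i) a) ~-irrefl) , id ]′ (closed c z v z∈Q m a))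
              (two? (W - z) A B₀)
            where
            is-z : ∀ v → v ∈ Q → v ≡ z
            is-z v i = decidable-stable (v Fin.≟ z) (λ ne → ¬v (v , i , ne))
            z∈Q : z ∈ Q
            z∈Q = subst (_∈ Q) (is-z _ (proj₂ (some c))) (proj₂ (some c))

  clean-B : ∀ {k W A B z} → Setting k W A B z → (∀ B′ → Setting k W A B′ z → ¬ z ∈ B′ → Adm k W A B′) → Adm k W A B
  clean-B {k} {W} {A} {B} {z} st next = go (mem B z)
    where
    go : Dec (z ∈ B) → Adm k W A B
    go (no ¬z) = next B st ¬z
    go (yes z∈B) = DropEdge.drop st z∈B (next (B - z))

  setting-adm : ∀ {k W A B z} → Setting k W A B z → Adm k W A B
  setting-adm st = clean-B st λ B′ st′ z∉B → adm-rev (clean-B (setting-swap st′) λ A′ st″ z∉A →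
    node-of st″ z∉B z∉A)

  prob-adm : ∀ k W A B z → IH (count W) → Prob k W A B z → Adm k W A B
  prob-adm k W A B z ih P = by-k (2 ≤? k)
    where
    v₀ = proj₁ (vertex P)
    v₀∈ = proj₁ (proj₂ (vertex P))
    C : DSet n
    -- W may be disconnected. Any component meets A and B, and that of `v₀` has a vertex other than
    -- `z`.
    C = comp W v₀
    C⊆ : C ⊆ W
    C⊆ _ r = tgt r
    cl : ∀ p q → p ∈ C → q ∈ W → p ~ q → q ∈ C
    cl p q r m a = rtrans r (step (tgt r) a (here m))
    by-k : Dec (2 ≤ k) → Adm k W A B
    by-k (no ¬2) = adm-mono {W = W} {W} (≤-pred (≰⇒> ¬2)) (λ _ x → x) (λ _ _ x → x) (λ _ _ x → x) (adm-one (rooted P) (v₀ , v₀∈))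
    by-k (yes 2≤k) = adm-mono {A′ = A ∩ C} {B′ = B ∩ C} ≤-refl C⊆ (λ _ _ → proj₁) (λ _ _ → proj₁) (setting-adm (record
      { rt = record { toA = toA′ ; toB = toB′ ; two = two″ } ; conn = comp-connected W v₀ ; dg = dg′
      ; ih = λ k′ W′ A′ B′ z′ h → ih k′ W′ A′ B′ z′ (≤-trans h (count-⊆ C W C⊆))
      ; A⊆W = λ _ → proj₂ ; B⊆W = λ _ → proj₂ ; 2≤k = 2≤k ; vert = v₀ , here v₀∈ , proj₂ (proj₂ (vertex P)) }))
      where
      toA′ : ∀ v → v ∈ C → ∃ λ a → a ∈ (A ∩ C) × Reach C v a
      toA′ v i with toA (rooted P) v (C⊆ v i)
      ... | a , a∈ , r = let r′ = stay C cl i r in a , (a∈ , tgt r′) , r′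
      toB′ : ∀ v → v ∈ C → ∃ λ b → b ∈ (B ∩ C) × Reach C v b
      toB′ v i with toB (rooted P) v (C⊆ v i)
      ... | b , b∈ , r = let r′ = stay C cl i r in b , (b∈ , tgt r′) , r′
      two″ : ∀ w v → w ∈ C → v ∈ C → v ≢ w → ∃ λ u → (u ∈ (A ∩ C) ⊎ u ∈ (B ∩ C)) × Reach (C - w) v u
      two″ w v w∈ i ne with two (rooted P) w v (C⊆ w w∈) (C⊆ v i) ne
      ... | u , s , r =
        let r′ = stay (C - w) (λ p q p∈ m a → cl p q (proj₁ p∈) (proj₁ m) a , proj₂ m) (i , ne) r
        in u , [ (λ a → inj₁ (a , proj₁ (tgt r′))) , (λ b → inj₂ (b , proj₁ (tgt r′))) ]′ s , r′
      dg′ : ∀ v → v ∈ C → v ≢ z → DegreeAt k C (A ∩ C) (B ∩ C) v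
      dg′ v i ne = ≤-trans (large P v (C⊆ v i) ne) (+-mono-≤
        (count-⊆ (N v ∩ W) (N v ∩ C) (λ u (a , m) → a , cl v u i m a))
        (+-mono-≤ (χ-mono (mem A v) (mem (A ∩ C) v) (λ x → x , i)) (χ-mono (mem B v) (mem (B ∩ C) v) (λ x → x , i))))

  all-sizes : ∀ m → IH m
  all-sizes (suc m) k W A B z (s≤s h) P = prob-adm k W A B z
    (λ k′ W′ A′ B′ z′ h′ → all-sizes m k′ W′ A′ B′ z′ (≤-trans h′ h)) P

  prob⇒adm : ∀ {k W A B z} → Prob k W A B z → Adm k W A B
  prob⇒adm {k} {W} {A} {B} {z} = all-sizes (suc (count W)) k W A B z ≤-refl

  -- Paths as lists and the original graph

  full : DSet n
  full = record { ∋ = λ _ → ⊤ ; mem = λ _ → yes tt }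

  list⇒reach : ∀ {W a b} P → Linked (Adj G) P → head P ≡ just a → last P ≡ just b → All (_∈ W) P → Reach W a b
  list⇒reach (u ∷ [])    _        refl refl (i ∷ _)  = here i
  list⇒reach (u ∷ v ∷ P) (a ∷ l) refl q    (i ∷ is) = step i a (list⇒reach (v ∷ P) l refl q is)

  record Listed (W : DSet n) (u v : V) (l : ℕ) : Set where
    field
      list   : List V
      path   : PathFromTo G u v list
      len    : edgeLen list ≡ l
      inside : All (_∈ W) list

  path⇒list : ∀ {W u v l} → Path W u v l → Listed W u v l
  path⇒list {u = u} (end i) = record { list = u ∷ [] ; path = (([] ∷ []) , [-]) , refl , refl ; len = refl ; inside = i ∷ [] }
  path⇒list {u = u} (cons i a p) = prepend i a (path⇒list p)
    where
    prepend : ∀ {W u v w l} → u ∈ W → u ~ v → Listed (W - u) v w l → Listed W u w (suc l)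
    prepend {u = u} i a record { list = v ∷ P ; path = (un , lk) , refl , e ; len = refl ; inside = all } = record
      { list = u ∷ v ∷ P
      ; path = (All.map (λ x e → proj₂ x (sym e)) all ∷ un , a ∷ lk) , refl , e
      ; len = refl ; inside = i ∷ All.map proj₁ all }

  module _ (k : ℕ) (x y z : V) (x≢y : x ≢ y) (tc : TwoConnected G) (w₀ : ∃[ w ] (w ≢ x × w ≢ y × w ≢ z))
    (large′ : ∀ v → v ≢ x → v ≢ y → v ≢ z → suc k ≤ deg G v) where

    U : DSet n
    U = (full - x) - y

    reach-off : ∀ w a b → a ≢ w → b ≢ w → Reach (full - w) a b
    reach-off w a b p q with proj₂ (proj₂ tc) w a b p q
    ... | P , ((_ , l) , h , t) , av = list⇒reach P l h t (All.map (λ ne → tt , ne) av)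

    is-root : ∀ {q} → ¬ q ∈ U → q ≡ x ⊎ q ≡ y
    is-root {q} ¬i with q Fin.≟ x | q Fin.≟ y
    ... | yes e | _     = inj₁ e
    ... | no _  | yes e = inj₂ e
    ... | no p  | no r  = contradiction ((tt , p) , r) ¬i

    rooted-xy : IsRooted U (N x) (N y)
    rooted-xy = record { toA = to-x ; toB = to-y ; two = two″ }
      where
      to-x : ∀ v → v ∈ U → ∃ λ a → a ∈ N x × Reach U v a
      to-x v i with leave U i (reach-off y v x (proj₂ i) x≢y)
      ... | inj₁ r = contradiction refl (proj₂ (proj₁ (tgt r)))
      ... | inj₂ (p , q , r , a , m , ¬j) with is-root ¬j
      ...   | inj₁ refl = p , ~-sym a , r
      ...   | inj₂ e = contradiction e (proj₂ m)
      to-y : ∀ v → v ∈ U → ∃ λ a → a ∈ N y × Reach U v a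
      to-y v i with leave U i (reach-off x v y (proj₂ (proj₁ i)) (λ e → x≢y (sym e)))
      ... | inj₁ r = contradiction refl (proj₂ (tgt r))
      ... | inj₂ (p , q , r , a , m , ¬j) with is-root ¬j
      ...   | inj₁ e = contradiction e (proj₂ m)
      ...   | inj₂ refl = p , ~-sym a , r
      two″ : ∀ w v → w ∈ U → v ∈ U → v ≢ w → ∃ λ u → (u ∈ N x ⊎ u ∈ N y) × Reach (U - w) v u
      two″ w v w∈ i ne with leave (U - w) (i , ne) (reach-off w v x ne (λ e → proj₂ (proj₁ w∈) (sym e)))
      ... | inj₁ r = contradiction refl (proj₂ (proj₁ (proj₁ (tgt r))))
      ... | inj₂ (p , q , r , a , m , ¬j) with is-root (λ j → ¬j (j , proj₂ m))
      ...   | inj₁ refl = p , inj₁ (~-sym a) , r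
      ...   | inj₂ refl = p , inj₂ (~-sym a) , r

    prob : Prob k U (N x) (N y) z
    prob = record
      { rooted = rooted-xy
      ; large  = λ v i ne → ≤-trans (large′ v (proj₂ (proj₁ i)) (proj₂ i) ne) (≤-trans (≤-reflexive (deg≡count v))
          (≤-trans (count-∪ (N v) (N v ∩ U) ((N v ∩ ⁅ x ⁆) ∪ (N v ∩ ⁅ y ⁆)) (spl v))
            (+-monoʳ-≤ (count (N v ∩ U)) (≤-trans (count-∪ ((N v ∩ ⁅ x ⁆) ∪ (N v ∩ ⁅ y ⁆)) (N v ∩ ⁅ x ⁆) (N v ∩ ⁅ y ⁆) (λ _ j → j))
              (+-mono-≤ (count-N-sing v x) (count-N-sing v y))))))
      ; vertex = proj₁ w₀ , ((tt , proj₁ (proj₂ w₀)) , proj₁ (proj₂ (proj₂ w₀))) , proj₂ (proj₂ (proj₂ w₀)) }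
      where
      spl : ∀ v u → u ∈ N v → u ∈ (N v ∩ U) ⊎ u ∈ ((N v ∩ ⁅ x ⁆) ∪ (N v ∩ ⁅ y ⁆))
      spl v u a with mem U u
      ... | yes i = inj₁ (a , i)
      ... | no ¬i = inj₂ ([ (λ e → inj₁ (a , e)) , (λ e → inj₂ (a , e)) ]′ (is-root ¬i))

    xy-path : ∀ {l} → Between U (N x) (N y) l → Path full x y (suc (l + 1))
    xy-path (between x~s y~t p) = cons tt x~s (cat p (~-sym y~t) (end {⁅ y ⁆} refl) (λ _ → proj₁)
      (λ { _ refl → tt , λ e → x≢y (sym e) }) (λ { _ j refl → proj₂ j refl }))

    admissible : 1 ≤ k → Adm k U (N x) (N y) → AdmissiblePaths G k x y
    admissible 1≤k (adm l {d} s f) = P , is-path , two≤ , diff s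
      where
      L : ℕ → ℕ
      -- The edges at x and y add 2 to the length in W; this makes even the shortest path
      -- admissible.
      L i = suc ((l + i * d) + 1)
      listed : ∀ i → i < k → Listed full x y (L i)
      listed i i< = path⇒list (xy-path (f i i<))
      P : ℕ → List V
      P i with i <? k
      ... | yes i< = Listed.list (listed i i<)
      -- A default value: the statement asks for a function on all of ℕ but constrains it only below
      -- `k`.
      ... | no _   = []
      is-path : ∀ i → i < k → PathFromTo G x y (P i)
      is-path i i< with i <? k
      ... | yes j< = Listed.path (listed i j<)
      ... | no ¬j  = contradiction i< ¬j
      P-len : ∀ i → i < k → edgeLen (P i) ≡ L i
      P-len i i< with i <? k
      ... | yes j< = Listed.len (listed i j<)
      ... | no ¬j  = contradiction i< ¬j
      two≤ : 2 ≤ edgeLen (P 0)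
      two≤ = ≤-trans (s≤s (m≤n+m 1 (l + 0))) (≤-reflexive (sym (P-len 0 1≤k)))
      next : ∀ i → suc i < k → edgeLen (P (suc i)) ≡ edgeLen (P i) + d
      next i h = trans (P-len (suc i) h) (trans (eq l (i * d) d) (cong (_+ d) (sym (P-len i (≤-trans (n≤1+n _) h)))))
        where
        eq : ∀ l e d → suc ((l + (d + e)) + 1) ≡ suc ((l + e) + 1) + d
        eq = solve-∀
      diff : Step d → (∀ i → suc i < k → edgeLen (P (suc i)) ≡ edgeLen (P i) + 1) ⊎
                      (∀ i → suc i < k → edgeLen (P (suc i)) ≡ edgeLen (P i) + 2)
      diff (inj₁ refl) = inj₁ next
      diff (inj₂ refl) = inj₂ next

theorem1 : (k : ℕ) → 1 ≤ k → (n : ℕ) → (G : Graph n) → TwoConnected G →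
    (x y z : Fin n) → x ≢ y →
    (∃[ w ] (w ≢ x × w ≢ y × w ≢ z)) →
    (∀ v → v ≢ x → v ≢ y → v ≢ z → suc k ≤ deg G v) →
    AdmissiblePaths G k x y
theorem1 k 1≤k n G tc x y z x≢y other degrees =
  admissible k x y z x≢y tc other degrees 1≤k (prob⇒adm (prob k x y z x≢y tc other degrees))
  where open AdmissiblePathsIn G
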